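{- Let $\lambda\vdash N$ and $r\geq0$. Then $$\mathcal G_rY_\lambda(x,y)=\sum_{\substack{\nu\supseteq\lambda\\ \nu/\lambda\text{ is a horizontal }r\text{ -strip}}}Y_\nu(x,y).$$
   Context: With $D=\partial_x+\partial_y$, the operators on $\mathbb Q[x,y]$ are $\mathcal G_0=\mathrm{id}$ and $\mathcal G_r=y^r\sum_{j=1}^{r}\binom{r-1}{j-1}\frac{x^j}{j!}D^j$ for $r\geq1$. For a partition $\lambda\vdash N$, $\mathrm{SYT}(\lambda)$ is the set of standard Young tableaux of shape $\lambda$ (fillings of the Young diagram, in English convention, by $1,\ldots,N$ each used once, increasing along rows and down columns). For $T\in\mathrm{SYT}(\lambda)$, $\mathrm{Des}(T)=\{j\in[N-1]: j+1\text{ lies in a lower row than }j\}$, and $$Y_\lambda(x,y)=\sum_{T\in\mathrm{SYT}(\lambda)}x^{|\mathrm{Des}(T)|+1}y^{N-|\mathrm{Des}(T)|}.$$ For the empty partition this gives $Y_\varnothing=x$. A horizontal $r$-strip is a skew diagram with $r$ cells, no two in the same column; the empty skew diagram is a horizontal $0$-strip. -}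

module Defs where

open import Data.Bool.Base using (if_then_else_)
open import Data.Empty using (⊥)
open import Data.Integer.Base using (+_)
open import Data.List.Base
  using (List; []; _∷_; _++_; map; concat; concatMap; filter; foldr; length;
         replicate; applyUpTo; upTo; cartesianProductWith)
open import Data.List.Properties
  using (length-map; length-++; length-applyUpTo; ∷-injective)
  renaming (≡-dec to ≡-decᴸ)
import Data.List.Membership.DecPropositional as DecMembership
open import Data.List.Membership.Propositional using (_∈_; _∉_)
open import Data.List.Membership.Propositional.Properties
  using (∈-filter⁺; ∈-filter⁻; ∈-map⁻; ∈-++⁺ˡ; ∈-++⁺ʳ; ∈-++⁻;
         ∈-applyUpTo⁺; ∈-concatMap⁺;
         ∈-cartesianProductWith⁺; ∈-cartesianProductWith⁻)
open import Data.List.Relation.Binary.Disjoint.Propositional using (Disjoint)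
open import Data.List.Relation.Binary.Permutation.Propositional
  using (_↭_; ↭-sym; ↭⇒↭ₛ)
open import Data.List.Relation.Binary.Permutation.Propositional.Properties
  using (∈-resp-↭; ↭-length)
import Data.List.Relation.Binary.Permutation.Setoid.Properties as PermutationSetoid
open import Data.List.Membership.Propositional.Properties.WithK
  using (unique∧set⇒bag)
open import Data.List.Relation.Binary.BagAndSetEquality using (∼bag⇒↭)
open import Data.List.Relation.Binary.Pointwise using (Pointwise; []; _∷_)
open import Data.List.Relation.Binary.Prefix.Heterogeneous using (Prefix)
open import Data.List.Relation.Binary.Prefix.Heterogeneous.Properties using (prefix?)
import Data.List.Relation.Binary.Subset.DecPropositional as DecSubset
open import Data.List.Relation.Binary.Subset.Propositional using (_⊆_)
open import Data.List.Relation.Unary.All as All using (All; []; _∷_; all?)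
import Data.List.Relation.Unary.All.Properties as All
import Data.List.Relation.Unary.AllPairs as AllPairs
import Data.List.Relation.Unary.AllPairs.Properties as AllPairs
open import Data.List.Relation.Unary.Any using (here; there)
import Data.List.Relation.Unary.Any.Properties as Any
open import Data.List.Relation.Unary.Linked using (Linked; linked?)
import Data.List.Relation.Unary.Unique.DecPropositional as DecUnique
open import Data.List.Relation.Unary.Unique.Propositional using (Unique; []; _∷_)
import Data.List.Relation.Unary.Unique.Propositional.Properties as Unique
open import Data.Nat.Base as ℕ
  using (ℕ; zero; suc; _∸_; _≤_; _<_; _≥_; _>_; _!; z≤n; s≤s)
open import Data.Nat.Combinatorics using (_C_)
open import Data.Nat.GeneralisedArithmetic using (iterate)
open import Data.Nat.ListAction using (sum)
open import Data.Nat.Properties as ℕ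
  using (_≟_; _<?_; _≥?_; _>?_; _!≢0; suc-injective)
open import Data.Product.Base using (_×_; _,_; proj₁; proj₂; ∃)
open import Data.Product.Properties using (≡-dec)
open import Data.Rational.Base as ℚ using (ℚ; 0ℚ; 1ℚ; _/_)
open import Data.Sum.Base using (inj₁; inj₂; [_,_]′)
open import Function.Base using (_∘_)
open import Function.Bundles using (_⇔_; mk⇔; Equivalence)
open import Relation.Binary.PropositionalEquality
  using (_≡_; _≢_; refl; sym; trans; cong; cong₂; setoid)
open import Relation.Nullary.Decidable
  using (Dec; yes; no; does; _×-dec_; map′)

[1‥_] : ℕ → List ℕ
[1‥ n ] = applyUpTo suc n

-- (c , a , b) stands for c xᵃ yᵇ.  A polynomial is a formal sum of such
-- terms; formal sums with the same coefficients are identified by _≈_.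

Term : Set
Term = ℚ × ℕ × ℕ

Poly : Set
Poly = List Term

coeff : Poly → ℕ → ℕ → ℚ
coeff []                a b = 0ℚ
coeff ((c , i , j) ∷ p) a b =
  (if does (i ≟ a ×-dec j ≟ b) then c else 0ℚ) ℚ.+ coeff p a b

infix 4 _≈_
_≈_ : Poly → Poly → Set
p ≈ q = ∀ a b → coeff p a b ≡ coeff q a b

infixl 6 _+ₚ_
_+ₚ_ : Poly → Poly → Poly
_+ₚ_ = _++_

Σₚ : List Poly → Poly
Σₚ = foldr _+ₚ_ []

infixl 7 _*ₚ_
_*ₚ_ : Poly → Poly → Poly
_*ₚ_ = cartesianProductWith
  λ (c , a , b) (c′ , a′ , b′) → c ℚ.* c′ , a ℕ.+ a′ , b ℕ.+ b′

mono : ℚ → ℕ → ℕ → Poly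
mono c a b = (c , a , b) ∷ []

-- When the exponent is 0 the new coefficient is 0, so the truncated
-- subtraction is harmless.

∂x ∂y : Poly → Poly
∂x = map λ (c , a , b) → c ℚ.* (+ a / 1) , a ∸ 1 , b
∂y = map λ (c , a , b) → c ℚ.* (+ b / 1) , a , b ∸ 1

D : Poly → Poly
D p = ∂x p +ₚ ∂y p

𝒢 : ℕ → Poly → Poly
𝒢 zero      p = p
𝒢 r@(suc _) p = mono 1ℚ 0 r *ₚ
  Σₚ (map (λ j → mono (binom/fact j) j 0 *ₚ iterate D p j) [1‥ r ])
  where
  binom/fact : ℕ → ℚ
  binom/fact j = _/_ (+ ((r ∸ 1) C (j ∸ 1))) (j !) {{j !≢0}}

record IsPartition (la : List ℕ) : Set where
  constructor isPartition
  field
    positive   : All (0 <_) la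
    decreasing : Linked _≥_ la

infix 4 _⊢_
_⊢_ : List ℕ → ℕ → Set
la ⊢ n = IsPartition la × sum la ≡ n

-- A cell is a pair (row , column), both counted from 0, with rows
-- numbered from top to bottom.

Cell : Set
Cell = ℕ × ℕ

cellsFrom : ℕ → List ℕ → List Cell
cellsFrom i []       = []
cellsFrom i (l ∷ la) = map (i ,_) (upTo l) ++ cellsFrom (suc i) la

cells : List ℕ → List Cell
cells = cellsFrom 0

open DecMembership (≡-dec _≟_ _≟_) using () renaming (_∈?_ to _∈ᶜ?_; _∉?_ to _∉ᶜ?_)

infix 4 _⊇ᵈ_
_⊇ᵈ_ : List ℕ → List ℕ → Set
nu ⊇ᵈ la = cells la ⊆ cells nu

infixl 7 _∖_
_∖_ : List ℕ → List ℕ → List Cell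
nu ∖ la = filter (_∉ᶜ? cells la) (cells nu)

record IsHorizontalStrip (r : ℕ) (cs : List Cell) : Set where
  constructor isHorizontalStrip
  field
    size            : length cs ≡ r
    distinctColumns : Unique (map proj₂ cs)

-- A filling is the list of its rows, from top to bottom.

Filling : Set
Filling = List (List ℕ)

-- Rows are left-justified, so the cells of the next row down lie below
-- an initial segment of the current one.

Above : List ℕ → List ℕ → Set
Above upper lower = Prefix _>_ lower upper

record IsSYT (la : List ℕ) (T : Filling) : Set where
  constructor isSYT
  field
    shape             : map length T ≡ la
    entries           : concat T ↭ [1‥ sum la ]
    rowsIncreasing    : All (Linked _<_) T
    columnsIncreasing : Linked Above T

open DecMembership _≟_ using (_∈?_)

row : ℕ → Filling → ℕ
row k []      = 0
row k (t ∷ T) = if does (k ∈? t) then 0 else suc (row k T)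

Des : Filling → List ℕ
Des T = filter (λ j → row j T <? row (suc j) T) [1‥ length (concat T) ∸ 1 ]

choices : ∀ {A : Set} → List (List A) → List (List A)
choices []         = [] ∷ []
choices (xs ∷ xss) = cartesianProductWith _∷_ xs (choices xss)

words : ∀ {A : Set} → List A → ℕ → List (List A)
words xs n = choices (replicate n xs)

isPartition? : ∀ la → Dec (IsPartition la)
isPartition? la = map′ (λ (p , q) → isPartition p q)
                       (λ (isPartition p q) → p , q)
                       (all? (0 <?_) la ×-dec linked? _≥?_ la)

_⊢?_ : ∀ la n → Dec (la ⊢ n)
la ⊢? n = isPartition? la ×-dec sum la ≟ n

partitions : ℕ → List (List ℕ)
partitions n = filter (_⊢? n) (concatMap (words [1‥ n ]) (upTo (suc n)))

isHorizontalStrip? : ∀ r cs → Dec (IsHorizontalStrip r cs)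
isHorizontalStrip? r cs = map′ (λ (p , q) → isHorizontalStrip p q)
                               (λ (isHorizontalStrip p q) → p , q)
                               (length cs ≟ r ×-dec DecUnique.unique? _≟_ (map proj₂ cs))

_⊇ᵈ?_ : ∀ nu la → Dec (nu ⊇ᵈ la)
nu ⊇ᵈ? la = DecSubset._⊆?_ (≡-dec _≟_ _≟_) (cells la) (cells nu)

-- Searching among the partitions of |la| + r loses nothing, see
-- ∈-horizontalExtensions.

horizontalExtensions : ℕ → List ℕ → List (List ℕ)
horizontalExtensions r la =
  filter (λ nu → nu ⊇ᵈ? la ×-dec isHorizontalStrip? r (nu ∖ la))
         (partitions (sum la ℕ.+ r))

private
  [1‥]-unique : ∀ n → Unique [1‥ n ]
  [1‥]-unique n = Unique.applyUpTo⁺₁ suc n λ i<j _ → ℕ.<⇒≢ i<j ∘ suc-injective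

  unique∧set⇒↭ : ∀ {A : Set} {xs ys : List A} →
                 Unique xs → Unique ys → xs ⊆ ys → ys ⊆ xs → xs ↭ ys
  unique∧set⇒↭ u v xs⊆ys ys⊆xs = ∼bag⇒↭ (unique∧set⇒bag u v (mk⇔ xs⊆ys ys⊆xs))

_↭[1‥_]? : ∀ xs n → Dec (xs ↭ [1‥ n ])
xs ↭[1‥ n ]? = map′ to from
  (DecUnique.unique? _≟_ xs
    ×-dec DecSubset._⊆?_ _≟_ xs [1‥ n ]
    ×-dec DecSubset._⊆?_ _≟_ [1‥ n ] xs)
  where
  to : Unique xs × xs ⊆ [1‥ n ] × [1‥ n ] ⊆ xs → xs ↭ [1‥ n ]
  to (u , p , q) = unique∧set⇒↭ u ([1‥]-unique n) p q

  from : xs ↭ [1‥ n ] → Unique xs × xs ⊆ [1‥ n ] × [1‥ n ] ⊆ xs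
  from p = PermutationSetoid.Unique-resp-↭ (setoid ℕ) (↭⇒↭ₛ (↭-sym p)) ([1‥]-unique n)
         , ∈-resp-↭ p , ∈-resp-↭ (↭-sym p)

isSYT? : ∀ la T → Dec (IsSYT la T)
isSYT? la T = map′
  (λ (s , e , r , c) → isSYT s e r c)
  (λ (isSYT s e r c) → s , e , r , c)
  (≡-decᴸ _≟_ (map length T) la
    ×-dec concat T ↭[1‥ sum la ]?
    ×-dec all? (linked? _<?_) T
    ×-dec linked? (λ upper lower → prefix? _>?_ lower upper) T)

SYT : List ℕ → List Filling
SYT la = filter (isSYT? la) (choices (map (words [1‥ sum la ]) la))

-- A descent set has at most |la| elements, so ∸ is genuine subtraction.

Y : List ℕ → Poly
Y la = Σₚ (map (λ T → mono 1ℚ (length (Des T) ℕ.+ 1) (sum la ∸ length (Des T))) (SYT la))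

∈-choices : ∀ {A : Set} {ys : List A} xss → ys ∈ choices xss ⇔ Pointwise _∈_ ys xss
∈-choices xss = mk⇔ (to xss) from
  where
  to : ∀ {A : Set} {ys : List A} xss → ys ∈ choices xss → Pointwise _∈_ ys xss
  to []         (here refl) = []
  to (xs ∷ xss) p with ∈-cartesianProductWith⁻ _∷_ xs (choices xss) p
  ... | _ , _ , q , r , refl = q ∷ to xss r

  from : ∀ {A : Set} {ys : List A} {xss} → Pointwise _∈_ ys xss → ys ∈ choices xss
  from []       = here refl
  from (p ∷ ps) = ∈-cartesianProductWith⁺ _∷_ p (from ps)

choices-unique : ∀ {A : Set} {xss : List (List A)} → All Unique xss → Unique (choices xss)
choices-unique []       = [] ∷ []
choices-unique (u ∷ us) = Unique.cartesianProductWith⁺ _∷_ ∷-injective u (choices-unique us)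

∈-words : ∀ {A : Set} {ys xs : List A} n → ys ∈ words xs n ⇔ (length ys ≡ n × ys ⊆ xs)
∈-words n = mk⇔ (λ p → to n (Equivalence.to (∈-choices _) p))
                (λ (eq , ys⊆xs) → Equivalence.from (∈-choices _) (from n eq ys⊆xs))
  where
  to : ∀ {A : Set} {ys xs : List A} n → Pointwise _∈_ ys (replicate n xs) →
       length ys ≡ n × ys ⊆ xs
  to zero    []       = refl , λ ()
  to (suc n) (p ∷ ps) with to n ps
  ... | eq , ys⊆xs = cong suc eq , λ { (here refl) → p ; (there q) → ys⊆xs q }

  from : ∀ {A : Set} {ys xs : List A} n → length ys ≡ n → ys ⊆ xs →
         Pointwise _∈_ ys (replicate n xs)
  from {ys = []}    zero    _  _     = []
  from {ys = _ ∷ _} (suc n) eq ys⊆xs =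
    ys⊆xs (here refl) ∷ from n (suc-injective eq) (ys⊆xs ∘ there)

words-unique : ∀ {A : Set} {xs : List A} n → Unique xs → Unique (words xs n)
words-unique n u = choices-unique (All.replicate⁺ n u)

∈-partitions : ∀ {la} n → la ∈ partitions n ⇔ la ⊢ n
∈-partitions n = mk⇔
  (λ p → proj₂ (∈-filter⁻ (_⊢? n) {xs = candidates} p))
  (λ p → ∈-filter⁺ (_⊢? n) (candidate p) p)
  where
  candidates : List (List ℕ)
  candidates = concatMap (words [1‥ n ]) (upTo (suc n))

  length≤sum : ∀ {la} → All (0 <_) la → length la ≤ sum la
  length≤sum []       = z≤n
  length≤sum (p ∷ ps) = ℕ.+-mono-≤ p (length≤sum ps)

  part≤sum : ∀ {l la} → l ∈ la → l ≤ sum la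
  part≤sum (here refl) = ℕ.m≤m+n _ _
  part≤sum (there p)   = ℕ.≤-trans (part≤sum p) (ℕ.m≤n+m _ _)

  part∈ : ∀ {l} → 0 < l → l ≤ n → l ∈ [1‥ n ]
  part∈ {suc l} _ l<n = ∈-applyUpTo⁺ suc l<n

  candidate : ∀ {la} → la ⊢ n → la ∈ candidates
  candidate {la} (isPartition pos _ , refl) = ∈-concatMap⁺ (words [1‥ n ])
    (Any.applyUpTo⁺ (λ k → k) (Equivalence.from (∈-words (length la))
                        (refl , λ p → part∈ (All.lookup pos p) (part≤sum p)))
                      (s≤s (length≤sum pos)))

partitions-unique : ∀ n → Unique (partitions n)
partitions-unique n = Unique.filter⁺ (_⊢? n) (Unique.concat⁺ {xss = map (words [1‥ n ]) (upTo (suc n))}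
  (All.map⁺ (All.universal (λ k → words-unique k ([1‥]-unique n)) (upTo (suc n))))
  (AllPairs.map⁺ (AllPairs.map disjoint (Unique.upTo⁺ (suc n)))))
  where
  disjoint : ∀ {i j} → i ≢ j → Disjoint (words [1‥ n ] i) (words [1‥ n ] j)
  disjoint {i} {j} i≢j (p , q) =
    i≢j (trans (sym (proj₁ (Equivalence.to (∈-words i) p)))
               (proj₁ (Equivalence.to (∈-words j) q)))

∈-SYT : ∀ {la T} → T ∈ SYT la ⇔ IsSYT la T
∈-SYT {la} = mk⇔
  (λ p → proj₂ (∈-filter⁻ (isSYT? la) {xs = choices (map (words [1‥ sum la ]) la)} p))
  (λ p → ∈-filter⁺ (isSYT? la) (candidate p) p)
  where
  filling : ∀ T {xs} → concat T ⊆ xs → T ∈ choices (map (words xs) (map length T))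
  filling T T⊆xs = Equivalence.from (∈-choices _) (rows T T⊆xs)
    where
    rows : ∀ T {xs} → concat T ⊆ xs → Pointwise _∈_ T (map (words xs) (map length T))
    rows []      _    = []
    rows (t ∷ T) T⊆xs =
      Equivalence.from (∈-words (length t)) (refl , T⊆xs ∘ ∈-++⁺ˡ)
      ∷ rows T (T⊆xs ∘ ∈-++⁺ʳ t)

  candidate : ∀ {T} → IsSYT la T → T ∈ choices (map (words [1‥ sum la ]) la)
  candidate {T} (isSYT refl e _ _) = filling T (∈-resp-↭ e)

SYT-unique : ∀ la → Unique (SYT la)
SYT-unique la = Unique.filter⁺ (isSYT? la) (choices-unique
  (All.map⁺ (All.universal (λ k → words-unique k ([1‥]-unique (sum la))) la)))

private
  cellsFrom-row : ∀ i la {c} → c ∈ cellsFrom i la → i ≤ proj₁ c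
  cellsFrom-row i (l ∷ la) p with ∈-++⁻ (map (i ,_) (upTo l)) p
  ... | inj₂ q = ℕ.<⇒≤ (cellsFrom-row (suc i) la q)
  ... | inj₁ q with ∈-map⁻ (i ,_) q
  ...   | _ , _ , refl = ℕ.≤-refl

  cellsFrom-unique : ∀ i la → Unique (cellsFrom i la)
  cellsFrom-unique i []       = []
  cellsFrom-unique i (l ∷ la) = Unique.++⁺
    (Unique.map⁺ (cong proj₂) (Unique.upTo⁺ l))
    (cellsFrom-unique (suc i) la)
    λ (p , q) → case-row (∈-map⁻ (i ,_) p) (cellsFrom-row (suc i) la q)
    where
    case-row : ∀ {c xs} → ∃ (λ j → j ∈ xs × c ≡ (i , j)) → suc i ≤ proj₁ c → ⊥
    case-row (_ , _ , refl) = ℕ.<-irrefl refl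

  length-cellsFrom : ∀ i la → length (cellsFrom i la) ≡ sum la
  length-cellsFrom i []       = refl
  length-cellsFrom i (l ∷ la) = trans
    (length-++ (map (i ,_) (upTo l)))
    (cong₂ ℕ._+_ (trans (length-map (i ,_) (upTo l)) (length-applyUpTo _ l))
                 (length-cellsFrom (suc i) la))

∖-size : ∀ {nu la} → nu ⊇ᵈ la → sum nu ≡ sum la ℕ.+ length (nu ∖ la)
∖-size {nu} {la} nu⊇la = trans (sym (length-cellsFrom 0 nu)) (trans
  (↭-length (unique∧set⇒↭ (cellsFrom-unique 0 nu)
    (Unique.++⁺ (cellsFrom-unique 0 la)
                (Unique.filter⁺ (_∉ᶜ? cells la) (cellsFrom-unique 0 nu))
                λ (p , q) → proj₂ (∈-∖⁻ q) p)
    split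
    (λ p → [ nu⊇la , proj₁ ∘ ∈-∖⁻ ]′ (∈-++⁻ (cells la) p))))
  (trans (length-++ (cells la)) (cong (ℕ._+ length (nu ∖ la)) (length-cellsFrom 0 la))))
  where
  ∈-∖⁻ : ∀ {c} → c ∈ nu ∖ la → c ∈ cells nu × c ∉ cells la
  ∈-∖⁻ = ∈-filter⁻ (_∉ᶜ? cells la) {xs = cells nu}

  split : cells nu ⊆ cells la ++ (nu ∖ la)
  split {c} p with c ∈ᶜ? cells la
  ... | yes q = ∈-++⁺ˡ q
  ... | no ¬q = ∈-++⁺ʳ (cells la) (∈-filter⁺ (_∉ᶜ? cells la) p ¬q)

∈-horizontalExtensions : ∀ {r la nu} →
  nu ∈ horizontalExtensions r la ⇔
  (IsPartition nu × nu ⊇ᵈ la × IsHorizontalStrip r (nu ∖ la))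
∈-horizontalExtensions {r} {la} {nu} = mk⇔ to from
  where
  P? = λ nu → nu ⊇ᵈ? la ×-dec isHorizontalStrip? r (nu ∖ la)

  to : nu ∈ horizontalExtensions r la →
       IsPartition nu × nu ⊇ᵈ la × IsHorizontalStrip r (nu ∖ la)
  to p with ∈-filter⁻ P? {xs = partitions (sum la ℕ.+ r)} p
  ... | q , ext = proj₁ (Equivalence.to (∈-partitions (sum la ℕ.+ r)) q) , ext

  from : IsPartition nu × nu ⊇ᵈ la × IsHorizontalStrip r (nu ∖ la) →
         nu ∈ horizontalExtensions r la
  from (part , nu⊇la , strip) = ∈-filter⁺ P?
    (Equivalence.from (∈-partitions (sum la ℕ.+ r))
      (part , trans (∖-size {nu} {la} nu⊇la)
                    (cong (sum la ℕ.+_) (IsHorizontalStrip.size strip))))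
    ((λ {c} → nu⊇la {c}) , strip)

horizontalExtensions-unique : ∀ r la → Unique (horizontalExtensions r la)
horizontalExtensions-unique r la = Unique.filter⁺
  (λ nu → nu ⊇ᵈ? la ×-dec isHorizontalStrip? r (nu ∖ la))
  (partitions-unique (sum la ℕ.+ r))

{-# OPTIONS --safe #-}
module Submission where

-- Record a homogeneous polynomial Σ α(d) x^(d+1) y^(N-d) by its sequence α.
-- With S the operator of partial sums, the entry at k of S^(N+1) applied to
-- the sequence of Y_λ is the number s_λ(1^(k+1)) of semistandard tableaux of
-- shape λ in k+1 letters: this follows by deleting the largest entry of a
-- standard tableau row by row.  A Bender–Knuth reflection gives the Pieri rule
-- for these numbers, Σ_ν s_ν(1^(k+1)) = h_r(1^(k+1)) s_λ(1^(k+1)).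
--
-- On the other side, Vandermonde's identity turns the definition of 𝒢_r into
--   𝒢_r (x^(d+1) y^b) = Σ_m C(b,m) C(d+r,d+m) x^(d+1+m) y^(b+r-m),
-- and a recursion in r shows that S^(N+r+1) of the right-hand side, where
-- N = b+d, is h_r(1^(k+1)) times S^(N+1) of x^(d+1) y^b.  As S is injective,
-- the theorem follows.

open import Defs
import Algebra.Properties.CommutativeSemigroup as CommutativeSemigroup
open import Algebra.Bundles using (CommutativeMonoid)
open import Data.Bool.Base using (if_then_else_; true; false)
open import Data.Empty using (⊥; ⊥-elim)
import Data.Integer.Base as ℤ
import Data.Integer.Properties as ℤ
open import Data.List.Base
  using (List; []; _∷_; _++_; _∷ʳ_; [_]; map; applyUpTo; upTo; cartesianProductWith; concat; length; filter)
open import Data.List.Properties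
  using (++-identityʳ; ++-assoc; length-++; length-map; length-filter; applyUpTo-∷ʳ; length-applyUpTo;
         upTo-∷ʳ; map-∘; ∷-injective; ∷-injectiveˡ; ∷-injectiveʳ; ∷ʳ-injectiveˡ)
import Data.List.Membership.DecPropositional as DecMembership
open import Data.List.Membership.Propositional using (_∈_; _∉_)
open import Data.List.Membership.Propositional.Properties
  using (∈-filter⁺; ∈-filter⁻; ∈-map⁺; ∈-map⁻; ∈-++⁺ˡ; ∈-++⁺ʳ; ∈-++⁻; ∈-applyUpTo⁺; ∈-applyUpTo⁻;
         ∈-upTo⁺; ∈-upTo⁻; ∈-cartesianProductWith⁺; ∈-cartesianProductWith⁻)
open import Data.List.Membership.Propositional.Properties.WithK using (unique∧set⇒bag)
open import Data.List.Relation.Binary.BagAndSetEquality using (∼bag⇒↭)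
open import Data.List.Relation.Binary.Permutation.Propositional as ↭
  using (_↭_; ↭-sym; ↭-trans; ↭-reflexive)
open import Data.List.Relation.Binary.Permutation.Propositional.Properties as ↭
  using (∈-resp-↭; ↭-length; drop-∷; ∷↭∷ʳ)
open import Data.List.Relation.Binary.Prefix.Heterogeneous as Prefix using ([]; _∷_)
open import Data.List.Relation.Binary.Subset.Propositional using (_⊆_)
open import Data.List.Relation.Unary.All as All using (All; []; _∷_)
import Data.List.Relation.Unary.All.Properties as All
open import Data.List.Relation.Unary.Any using (here; there)
open import Data.List.Relation.Unary.Linked using (Linked; []; [-]; _∷_)
import Data.List.Relation.Unary.Linked.Properties as Linked
open import Data.List.Relation.Unary.Unique.Propositional using (Unique; []; _∷_)
import Data.List.Relation.Unary.Unique.Propositional.Properties as Unique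
open import Data.Nat.Base
open import Data.Nat.Combinatorics using (_C_; nCk+nC[k+1]≡[n+1]C[k+1]; nCn≡1; k>n⇒nCk≡0)
open import Data.Nat.GeneralisedArithmetic using (iterate)
open import Data.Nat.ListAction using (sum)
open import Data.Nat.ListAction.Properties using (sum-↭)
open import Data.Nat.Properties
open import Data.Nat.Tactic.RingSolver using (solve-∀)
open import Data.Product.Base using (_×_; _,_; proj₁; proj₂; ∃)
open import Data.Product.Properties using (≡-dec)
open import Data.Rational.Base as ℚ using (ℚ; 0ℚ; 1ℚ)
import Data.Rational.Properties as ℚ
import Data.Rational.Unnormalised.Base as ℚᵘ
import Data.Rational.Unnormalised.Properties as ℚᵘ
open import Data.Sum.Base using (inj₁; inj₂)
open import Data.Unit.Base using (⊤; tt)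
open import Function.Base using (_∘_)
open import Function.Bundles using (mk⇔; Equivalence)
open import Relation.Binary.Definitions using (tri<; tri≈; tri>)
open import Relation.Binary.PropositionalEquality hiding ([_])
open import Relation.Nullary using (¬_; Dec; yes; no; does)
open import Relation.Nullary.Decidable using (_×-dec_; dec-true; dec-false)
open import Relation.Unary using (Decidable)

open CommutativeSemigroup +-commutativeSemigroup
  using () renaming (interchange to +-interchange)
open CommutativeSemigroup (CommutativeMonoid.commutativeSemigroup ℚ.+-0-commutativeMonoid)
  using () renaming (interchange to ℚ-+-interchange)
open DecMembership _≟_ using (_∈?_)
open DecMembership (≡-dec _≟_ _≟_) using () renaming (_∉?_ to _∉ᶜ?_)

-- With sequences read as power series, `S` is division by 1 - t, and the link with tableaux is the
-- P-partition identity Σ_k s_λ(1^(k+1)) t^k = Σ_T t^(des T) / (1-t)^(N+1). This explains the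
-- exponent N + 1; and as every ν has size N + r, one power of `S` serves all of them.
--
-- The obstacle is that deleting the largest entry changes the descents in a way that depends on the
-- row of the next largest. The induction therefore carries the row of a hypothetical further box.
-- Moving that box from the top row to below the bottom row costs, row by row, the removal of a
-- horizontal strip, which is the branching rule of semistandard tableaux.
--
-- Apart from the coefficients of the polynomials, everything takes place in the natural numbers:
-- identities with negative terms are stated with these moved across, and polynomials are tested
-- against functionals with natural values, on which 𝒢_r acts by its transpose.

⟦_⟧ : ∀ {P : Set} → Dec P → ℕ
⟦ d ⟧ = if does d then 1 else 0

⟦⟧-yes : ∀ {P : Set} (d : Dec P) → P → ⟦ d ⟧ ≡ 1
⟦⟧-yes (yes _) _ = refl
⟦⟧-yes (no ¬p) p = ⊥-elim (¬p p)

⟦⟧-no : ∀ {P : Set} (d : Dec P) → ¬ P → ⟦ d ⟧ ≡ 0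
⟦⟧-no (yes p) ¬p = ⊥-elim (¬p p)
⟦⟧-no (no _)  _  = refl

⟦⟧-cong : ∀ {P Q : Set} (d : Dec P) (e : Dec Q) → (P → Q) → (Q → P) → ⟦ d ⟧ ≡ ⟦ e ⟧
⟦⟧-cong (yes p) e f _ = sym (⟦⟧-yes e (f p))
⟦⟧-cong (no ¬p) e _ g = sym (⟦⟧-no e (¬p ∘ g))

⟦⟧-× : ∀ {P Q : Set} (d : Dec P) (e : Dec Q) → ⟦ d ×-dec e ⟧ ≡ ⟦ d ⟧ * ⟦ e ⟧
⟦⟧-× (yes _) (yes _) = refl
⟦⟧-× (yes _) (no _)  = refl
⟦⟧-× (no _)  _       = refl

⟦⟧*-cong : ∀ {P : Set} (d : Dec P) {x y} → (P → x ≡ y) → ⟦ d ⟧ * x ≡ ⟦ d ⟧ * y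
⟦⟧*-cong (yes p) x≡y = cong (1 *_) (x≡y p)
⟦⟧*-cong (no _)  _   = refl

-- Partial sums

S : (ℕ → ℕ) → ℕ → ℕ
S f zero    = f 0
S f (suc n) = S f n + f (suc n)

S-cong≤ : ∀ {f g} n → (∀ i → i ≤ n → f i ≡ g i) → S f n ≡ S g n
S-cong≤ zero    f≡g = f≡g 0 z≤n
S-cong≤ (suc n) f≡g =
  cong₂ _+_ (S-cong≤ n λ i i≤n → f≡g i (m≤n⇒m≤1+n i≤n)) (f≡g (suc n) ≤-refl)

S-cong : ∀ {f g} → f ≗ g → S f ≗ S g
S-cong f≗g n = S-cong≤ n λ i _ → f≗g i

S-0 : ∀ n → S (λ _ → 0) n ≡ 0
S-0 zero    = refl
S-0 (suc n) = trans (+-identityʳ _) (S-0 n)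

S-+ : ∀ f g n → S (λ i → f i + g i) n ≡ S f n + S g n
S-+ f g zero    = refl
S-+ f g (suc n) = trans (cong (_+ (f (suc n) + g (suc n))) (S-+ f g n))
                        (+-interchange (S f n) (S g n) _ _)

S-* : ∀ c f n → S (λ i → c * f i) n ≡ c * S f n
S-* c f zero    = refl
S-* c f (suc n) = trans (cong (_+ c * f (suc n)) (S-* c f n)) (sym (*-distribˡ-+ c _ _))

S-swap : ∀ (f : ℕ → ℕ → ℕ) m n → S (λ i → S (f i) n) m ≡ S (λ j → S (λ i → f i j) m) n
S-swap f zero    n = refl
S-swap f (suc m) n = trans (cong (_+ S (f (suc m)) n) (S-swap f m n)) (sym (S-+ _ _ n))

S-front : ∀ f n → S f (suc n) ≡ f 0 + S (f ∘ suc) n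
S-front f zero    = refl
S-front f (suc n) = trans (cong (_+ f (2 + n)) (S-front f n)) (+-assoc (f 0) _ _)

S-reverse : ∀ {f g} n → (∀ i j → i + j ≡ n → f i ≡ g j) → S f n ≡ S g n
S-reverse zero f≡g = f≡g 0 0 refl
S-reverse {f} {g} (suc n) f≡g = begin
  S f n + f (suc n)        ≡⟨ cong₂ _+_ (S-reverse n λ i j i+j≡n → f≡g i (suc j) (trans (+-suc i j) (cong suc i+j≡n))) (f≡g (suc n) 0 (+-identityʳ _)) ⟩
  S (g ∘ suc) n + g 0      ≡⟨ +-comm _ (g 0) ⟩
  g 0 + S (g ∘ suc) n      ≡⟨ S-front g n ⟨
  S g (suc n)              ∎
  where open ≡-Reasoning

S-clip : ∀ f {n m} → n ≤ m → S f n ≡ S (λ i → ⟦ i ≤? n ⟧ * f i) m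
S-clip f = go ∘ ≤⇒≤′
  where
  go : ∀ {n m} → n ≤′ m → S f n ≡ S (λ i → ⟦ i ≤? n ⟧ * f i) m
  go {n} (≤′-reflexive refl) = S-cong≤ n λ i i≤n →
    sym (trans (cong (_* f i) (⟦⟧-yes (i ≤? n) i≤n)) (*-identityˡ _))
  go {n} (≤′-step {m} n≤m) = trans (go n≤m) (sym (trans
    (cong (λ x → S _ m + x * f (suc m)) (⟦⟧-no (suc m ≤? n) (<⇒≱ (s≤s (≤′⇒≤ n≤m)))))
    (+-identityʳ _)))

-- The lower bound is an indicator and not a truncated difference: an interval with b < a then gives
-- 0, and exchanges of summation reduce to `S-swap`.
∑ : ℕ → ℕ → (ℕ → ℕ) → ℕ
∑ a b g = S (λ x → ⟦ a ≤? x ⟧ * g x) b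

∑-cong : ∀ {g h} a b → (∀ x → a ≤ x → x ≤ b → g x ≡ h x) → ∑ a b g ≡ ∑ a b h
∑-cong a b g≡h = S-cong≤ b λ x x≤b → ⟦⟧*-cong (a ≤? x) λ a≤x → g≡h x a≤x x≤b

∑-empty : ∀ {a b} g → b < a → ∑ a b g ≡ 0
∑-empty {a} {b} g b<a = trans
  (S-cong≤ b λ x x≤b → cong (_* g x) (⟦⟧-no (a ≤? x) (<⇒≱ (≤-<-trans x≤b b<a))))
  (S-0 b)

∑-shift : ∀ a n g → ∑ a (a + n) g ≡ S (λ y → g (a + y)) n
∑-shift zero    n g = S-cong (λ x → *-identityˡ (g x)) n
∑-shift (suc a) n g = trans (S-front _ (a + n)) (trans
  (S-cong (λ x → cong (_* g (suc x)) (⟦⟧-cong (suc a ≤? suc x) (a ≤? x) s≤s⁻¹ s≤s)) (a + n))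
  (∑-shift a n (g ∘ suc)))

∑-single : ∀ a g → ∑ a a g ≡ g a
∑-single a g = trans (cong (λ b → ∑ a b g) (sym (+-identityʳ a)))
                     (trans (∑-shift a 0 g) (cong g (+-identityʳ a)))

∑-suc : ∀ {a b} g → a ≤ suc b → ∑ a (suc b) g ≡ ∑ a b g + g (suc b)
∑-suc {a} {b} g a≤1+b = cong (λ x → ∑ a b g + x)
  (trans (cong (_* g (suc b)) (⟦⟧-yes (a ≤? suc b) a≤1+b)) (*-identityˡ _))

-- The reversal of an interval, given by pairs with x + y ≡ a + b so that nothing is subtracted.
-- Empty intervals are included because `down²-reflect` meets them.
∑-reflect : ∀ {g h} a b → (∀ x y → x + y ≡ a + b → g x ≡ h y) → ∑ a b g ≡ ∑ a b h
∑-reflect {g} {h} a b g≡h with a ≤? b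
... | no a≰b = trans (∑-empty g (≰⇒> a≰b)) (sym (∑-empty h (≰⇒> a≰b)))
... | yes a≤b with b ∸ a | m+[n∸m]≡n a≤b
...   | n | refl = trans (∑-shift a n g) (trans
  (S-reverse n λ i j i+j≡n → g≡h (a + i) (a + j) (trans (lemma a i j) (cong (λ k → a + (a + k)) i+j≡n)))
  (sym (∑-shift a n h)))
  where
  lemma : ∀ a i j → a + i + (a + j) ≡ a + (a + (i + j))
  lemma = solve-∀

-- On the power series Σ f(n) t^n, `t` is multiplication by the variable, `θ` below is the Euler
-- operator t d/dt, and `S` is division by 1 - t.
t : (ℕ → ℕ) → ℕ → ℕ
t f zero    = 0
t f (suc n) = f n

θ : (ℕ → ℕ) → ℕ → ℕ
θ f n = n * f n

S^ : ℕ → (ℕ → ℕ) → ℕ → ℕ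
S^ zero    f = f
S^ (suc m) f = S (S^ m f)

S-unfold : ∀ f n → S f n ≡ f n + t (S f) n
S-unfold f zero    = sym (+-identityʳ _)
S-unfold f (suc n) = +-comm (S f n) _

S-t : ∀ f → S (t f) ≗ t (S f)
S-t f zero          = refl
S-t f (suc zero)    = refl
S-t f (suc (suc n)) = cong (_+ f (suc n)) (S-t f (suc n))

S-injective : ∀ {f g} → S f ≗ S g → f ≗ g
S-injective Sf≗Sg zero    = Sf≗Sg 0
S-injective {f} {g} Sf≗Sg (suc n) = +-cancelˡ-≡ (S f n) _ _
  (trans (Sf≗Sg (suc n)) (cong (_+ g (suc n)) (sym (Sf≗Sg n))))

-- Leibniz' rule, since t d/dt sends 1/(1-t) to t/(1-t)².
S-θ : ∀ f n → θ (S f) n ≡ S (θ f) n + t (S (S f)) n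
S-θ f zero    = refl
S-θ f (suc n) = begin
  suc n * (S f n + f (suc n))
    ≡⟨ lemma₁ n (S f n) (f (suc n)) ⟩
  n * S f n + S f n + suc n * f (suc n)
    ≡⟨ cong (λ x → x + S f n + suc n * f (suc n)) (S-θ f n) ⟩
  S (θ f) n + t (S (S f)) n + S f n + suc n * f (suc n)
    ≡⟨ lemma₂ (S (θ f) n) (t (S (S f)) n) (S f n) (suc n * f (suc n)) ⟩
  S (θ f) n + suc n * f (suc n) + (S f n + t (S (S f)) n)
    ≡⟨ cong (S (θ f) n + suc n * f (suc n) +_) (S-unfold (S f) n) ⟨
  S (θ f) n + suc n * f (suc n) + S (S f) n ∎
  where
  open ≡-Reasoning
  lemma₁ : ∀ n a b → suc n * (a + b) ≡ n * a + a + suc n * b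
  lemma₁ = solve-∀
  lemma₂ : ∀ a b c d → a + b + c + d ≡ a + d + (c + b)
  lemma₂ = solve-∀

S^-cong : ∀ {f g} m → f ≗ g → S^ m f ≗ S^ m g
S^-cong zero    f≗g = f≗g
S^-cong (suc m) f≗g = S-cong (S^-cong m f≗g)

S^-+ : ∀ m f g n → S^ m (λ i → f i + g i) n ≡ S^ m f n + S^ m g n
S^-+ zero    f g n = refl
S^-+ (suc m) f g n = trans (S-cong (S^-+ m f g) n) (S-+ _ _ n)

S^-* : ∀ m c f n → S^ m (λ i → c * f i) n ≡ c * S^ m f n
S^-* zero    c f n = refl
S^-* (suc m) c f n = trans (S-cong (S^-* m c f) n) (S-* c _ n)

S^-0 : ∀ m n → S^ m (λ _ → 0) n ≡ 0
S^-0 zero    n = refl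
S^-0 (suc m) n = trans (S-cong (S^-0 m) n) (S-0 n)

S^-at-0 : ∀ m f → S^ m f 0 ≡ f 0
S^-at-0 zero    f = refl
S^-at-0 (suc m) f = S^-at-0 m f

S^-t : ∀ m f → S^ m (t f) ≗ t (S^ m f)
S^-t zero    f n = refl
S^-t (suc m) f n = trans (S-cong (S^-t m f) n) (S-t _ n)

S^-injective : ∀ {f g} m → S^ m f ≗ S^ m g → f ≗ g
S^-injective zero    eq = eq
S^-injective (suc m) eq = S^-injective m (S-injective eq)

S^-θ : ∀ m f n → θ (S^ m f) n ≡ S^ m (θ f) n + m * t (S^ (suc m) f) n
S^-θ zero    f n = sym (+-identityʳ _)
S^-θ (suc m) f n = begin
  θ (S (S^ m f)) n
    ≡⟨ S-θ (S^ m f) n ⟩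
  S (θ (S^ m f)) n + t (S^ (2 + m) f) n
    ≡⟨ cong (_+ t (S^ (2 + m) f) n) (trans (S-cong (S^-θ m f) n) (trans (S-+ _ _ n)
         (cong (S^ (suc m) (θ f) n +_) (trans (S-* m _ n) (cong (m *_) (S-t _ n)))))) ⟩
  S^ (suc m) (θ f) n + m * t (S^ (2 + m) f) n + t (S^ (2 + m) f) n
    ≡⟨ lemma (S^ (suc m) (θ f) n) m (t (S^ (2 + m) f) n) ⟩
  S^ (suc m) (θ f) n + suc m * t (S^ (2 + m) f) n ∎
  where
  open ≡-Reasoning
  lemma : ∀ a m b → a + m * b + b ≡ a + suc m * b
  lemma = solve-∀

-- With S = 1/(1-t) this is the commutation rule θ S = S θ + t S², moved so that
-- no subtraction occurs.

S^-absorb : ∀ N r (γ γ′ : ℕ → ℕ) →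
  (∀ e → suc r * γ′ e + t (θ γ) e ≡ (suc r + e) * γ e + N * t γ e) →
  ∀ k → suc r * S^ (2 + (N + r)) γ′ k ≡ (suc r + k) * S^ (1 + (N + r)) γ k
S^-absorb N r γ γ′ rec k = +-cancelʳ-≡ (t (S^ (suc m) (θ γ)) k) _ _ (begin
  suc r * S^ (suc m) γ′ k + t (S^ (suc m) (θ γ)) k
    ≡⟨ cong₂ _+_ (S^-* (suc m) (suc r) γ′ k) (S^-t (suc m) (θ γ) k) ⟨
  S^ (suc m) (λ e → suc r * γ′ e) k + S^ (suc m) (t (θ γ)) k
    ≡⟨ S^-+ (suc m) _ _ k ⟨
  S^ (suc m) (λ e → suc r * γ′ e + t (θ γ) e) k
    ≡⟨ S^-cong (suc m) (λ e → trans (rec e) (cong (_+ N * t γ e) (*-distribʳ-+ (γ e) (suc r) e))) k ⟩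
  S^ (suc m) (λ e → suc r * γ e + θ γ e + N * t γ e) k
    ≡⟨ trans (S^-+ (suc m) _ _ k) (cong₂ _+_
         (trans (S^-+ (suc m) _ _ k) (cong (_+ S^ (suc m) (θ γ) k) (S^-* (suc m) (suc r) γ k)))
         (trans (S^-* (suc m) N _ k) (cong (N *_) (S^-t (suc m) γ k)))) ⟩
  suc r * S^ (suc m) γ k + S^ (suc m) (θ γ) k + N * t (S^ (suc m) γ) k
    ≡⟨ cong₂ (λ x y → suc r * x + y + N * t (S^ (suc m) γ) k)
         (S-unfold (S^ m γ) k) (S-unfold (S^ m (θ γ)) k) ⟩
  suc r * (S^ m γ k + T) + (S^ m (θ γ) k + t (S^ (suc m) (θ γ)) k) + N * T
    -- There are `suc r` + `N` = `m` copies of `T`, exactly the number with which `S^-θ` turns S^m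
    -- (θ γ) into k times S^m γ. This fixes the power of `S` in the statement.
    ≡⟨ lemma₁ r N (S^ m γ k) T (S^ m (θ γ) k) (t (S^ (suc m) (θ γ)) k) ⟩
  suc r * S^ m γ k + (S^ m (θ γ) k + m * T) + t (S^ (suc m) (θ γ)) k
    ≡⟨ cong (λ x → suc r * S^ m γ k + x + t (S^ (suc m) (θ γ)) k) (S^-θ m γ k) ⟨
  suc r * S^ m γ k + k * S^ m γ k + t (S^ (suc m) (θ γ)) k
    ≡⟨ cong (_+ t (S^ (suc m) (θ γ)) k) (*-distribʳ-+ (S^ m γ k) (suc r) k) ⟨
  (suc r + k) * S^ m γ k + t (S^ (suc m) (θ γ)) k ∎)
  where
  open ≡-Reasoning
  m T : ℕ
  m = suc (N + r)
  T = t (S^ (suc m) γ) k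
  lemma₁ : ∀ r N a T b c →
    suc r * (a + T) + (b + c) + N * T ≡ suc r * a + (b + suc (N + r) * T) + c
  lemma₁ = solve-∀

-- In the reflection below, a maximum and a minimum of the same two parts bound neighbouring parts
-- of the middle shape. This identity makes the ends of all intervals add up to the outer size plus
-- the inner size.
⊔+⊓ : ∀ m n → (m ⊔ n) + (m ⊓ n) ≡ m + n
⊔+⊓ m n with ≤-total m n
... | inj₁ m≤n = trans (cong₂ _+_ (m≤n⇒m⊔n≡n m≤n) (m≤n⇒m⊓n≡m m≤n)) (+-comm n m)
... | inj₂ n≤m = cong₂ _+_ (m≥n⇒m⊔n≡m n≤m) (m≥n⇒m⊓n≡n n≤m)

∑-* : ∀ a b c g → ∑ a b (λ x → c * g x) ≡ c * ∑ a b g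
∑-* a b c g = trans (S-cong (λ x → lemma ⟦ a ≤? x ⟧ c (g x)) b) (S-* c _ b)
  where
  lemma : ∀ a b c → a * (b * c) ≡ b * (a * c)
  lemma = solve-∀

∑-S : ∀ a b n (f : ℕ → ℕ → ℕ) → ∑ a b (λ x → S (f x) n) ≡ S (λ y → ∑ a b (λ x → f x y)) n
∑-S a b n f = trans (S-cong (λ x → sym (S-* ⟦ a ≤? x ⟧ (f x) n)) b) (S-swap _ b n)

∑-clip : ∀ a b y (f : ℕ → ℕ) → ∑ a b (λ x → ⟦ x ≤? y ⟧ * f x) ≡ ∑ a (b ⊓ y) f
∑-clip a b y f = sym (trans (S-clip _ (m⊓n≤m b y)) (S-cong≤ b λ x x≤b → trans
  (cong (_* (⟦ a ≤? x ⟧ * f x))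
    (⟦⟧-cong (x ≤? b ⊓ y) (x ≤? y) (λ p → ≤-trans p (m⊓n≤n b y)) (⊓-glb x≤b)))
  (lemma ⟦ x ≤? y ⟧ ⟦ a ≤? x ⟧ (f x))))
  where
  lemma : ∀ a b c → a * (b * c) ≡ b * (a * c)
  lemma = solve-∀

∑-trim : ∀ {a c} b g → a ≤ c → (∀ x → x < c → g x ≡ 0) → ∑ a b g ≡ ∑ c b g
∑-trim {a} {c} b g a≤c g≡0 = S-cong (λ x → term x (c ≤? x)) b
  where
  term : ∀ x (d : Dec (c ≤ x)) → ⟦ a ≤? x ⟧ * g x ≡ ⟦ d ⟧ * g x
  term x (yes c≤x) = cong (_* g x) (⟦⟧-yes (a ≤? x) (≤-trans a≤c c≤x))
  term x (no c≰x)  = trans (cong (⟦ a ≤? x ⟧ *_) (g≡0 x (≰⇒> c≰x))) (*-zeroʳ ⟦ a ≤? x ⟧)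

∑-triangle : ∀ a b (f : ℕ → ℕ → ℕ) → ∑ a b (λ x → S (f x) x) ≡ S (λ y → ∑ (a ⊔ y) b (λ x → f x y)) b
∑-triangle a b f = begin
  ∑ a b (λ x → S (f x) x)
    ≡⟨ ∑-cong a b (λ x _ x≤b → S-clip (f x) x≤b) ⟩
  ∑ a b (λ x → S (λ y → ⟦ y ≤? x ⟧ * f x y) b)
    ≡⟨ ∑-S a b b (λ x y → ⟦ y ≤? x ⟧ * f x y) ⟩
  S (λ y → ∑ a b (λ x → ⟦ y ≤? x ⟧ * f x y)) b
    ≡⟨ S-cong (λ y → S-cong (λ x → trans (sym (*-assoc ⟦ a ≤? x ⟧ _ _))
         (cong (_* f x y) (both y x))) b) b ⟩
  S (λ y → ∑ (a ⊔ y) b (λ x → f x y)) b ∎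
  where
  open ≡-Reasoning
  both : ∀ y x → ⟦ a ≤? x ⟧ * ⟦ y ≤? x ⟧ ≡ ⟦ a ⊔ y ≤? x ⟧
  both y x = trans (sym (⟦⟧-× (a ≤? x) (y ≤? x))) (⟦⟧-cong ((a ≤? x) ×-dec (y ≤? x)) (a ⊔ y ≤? x)
    (λ (p , q) → ⊔-lub p q) (λ p → m⊔n≤o⇒m≤o a y p , m⊔n≤o⇒n≤o a y p))

-- Interlacing and the Pieri rule

hd : List ℕ → ℕ
hd []      = 0
hd (l ∷ _) = l

-- The branching sum, over all shapes left by the removal of a horizontal strip: a part may shrink
-- to the length of the next one, the last part to `hd []`, that is, to 0.
down : (List ℕ → ℕ) → List ℕ → ℕ
down g []      = g []
down g (l ∷ L) = ∑ (hd L) l λ x → down (g ∘ (x ∷_)) L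

-- M ≺ L: the skew diagram L/M is a horizontal strip.  Shapes may end in zeros,
-- and M has as many parts as L.

infix 4 _≺_
data _≺_ : List ℕ → List ℕ → Set where
  []  : [] ≺ []
  _∷_ : ∀ {x M l L} → hd L ≤ x × x ≤ l → M ≺ L → x ∷ M ≺ l ∷ L

hd-≺ : ∀ {M L} → M ≺ L → hd M ≤ hd L
hd-≺ []            = z≤n
hd-≺ ((_ , q) ∷ _) = q

sum-tail-≺ : ∀ {M l L} → M ≺ l ∷ L → sum L ≤ sum M
sum-tail-≺ {L = []}    _             = z≤n
sum-tail-≺ {L = _ ∷ _} ((p , _) ∷ i) = +-mono-≤ p (sum-tail-≺ i)

down-cong≺ : ∀ {g h} L → (∀ M → M ≺ L → g M ≡ h M) → down g L ≡ down h L
down-cong≺ []      g≡h = g≡h [] []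
down-cong≺ (l ∷ L) g≡h = ∑-cong (hd L) l λ x p q →
  down-cong≺ L λ M i → g≡h (x ∷ M) ((p , q) ∷ i)

down-cong : ∀ {g h} → g ≗ h → down g ≗ down h
down-cong g≗h L = down-cong≺ L λ M _ → g≗h M

down-* : ∀ c g L → down (λ M → c * g M) L ≡ c * down g L
down-* c g []      = refl
down-* c g (l ∷ L) = trans (∑-cong (hd L) l λ x _ _ → down-* c (g ∘ (x ∷_)) L) (∑-* (hd L) l c _)

down-0 : ∀ L → down (λ _ → 0) L ≡ 0
down-0 L = down-* 0 (λ _ → 0) L

down-S : ∀ n (f : ℕ → List ℕ → ℕ) L → down (λ M → S (λ y → f y M) n) L ≡ S (λ y → down (f y) L) n
down-S n f []      = refl
down-S n f (l ∷ L) = trans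
  (∑-cong (hd L) l λ x _ _ → down-S n (λ y → f y ∘ (x ∷_)) L)
  (∑-S (hd L) l n λ x y → down (f y ∘ (x ∷_)) L)

down-clip : ∀ y g l L → down (λ M → ⟦ hd M ≤? y ⟧ * g M) (l ∷ L) ≡ down g (l ⊓ y ∷ L)
down-clip y g l L = trans
  (∑-cong (hd L) l λ x _ _ → down-* ⟦ x ≤? y ⟧ (g ∘ (x ∷_)) L)
  (∑-clip (hd L) l y _)

-- The summand sees the middle shape only through its size; hence the middle shape may be reflected
-- while the inner one stays fixed.
down² : (ℕ → List ℕ → ℕ) → List ℕ → ℕ
down² g = down λ M → down (g (sum M)) M

down²-[] : ∀ g c → down² g (c ∷ []) ≡ S (λ y → ∑ y c λ x → g (x + 0) (y ∷ [])) c
down²-[] g c = trans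
  (∑-cong 0 c λ x _ _ → S-cong (λ y → *-identityˡ (g (x + 0) (y ∷ []))) x)
  (∑-triangle 0 c λ x y → g (x + 0) (y ∷ []))

-- Once the first inner part y is fixed, the conditions decouple: the first middle part lies between
-- l ⊔ y and c, and the demand that the second middle part be at most y caps the outer part l at l ⊓
-- y. The rest is a sum of the same kind.
down²-∷ : ∀ g c l L → down² g (c ∷ l ∷ L) ≡
  S (λ y → ∑ (l ⊔ y) c λ x → down² (λ s M → g (x + s) (y ∷ M)) (l ⊓ y ∷ L)) c
down²-∷ g c l L = trans
  (∑-cong l c λ x _ _ → trans
    (down-S x (λ y N → ⟦ hd N ≤? y ⟧ * down (λ M → g (x + sum N) (y ∷ M)) N) (l ∷ L))
    (S-cong (λ y → down-clip y (λ N → down (λ M → g (x + sum N) (y ∷ M)) N) l L) x))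
  (∑-triangle l c λ x y → down² (λ s M → g (x + s) (y ∷ M)) (l ⊓ y ∷ L))

-- The Bender–Knuth reflection: with the outer and the inner partition fixed,
-- each part of the middle one ranges over an interval, and all these
-- intervals are reversed at once.

down²-reflect : ∀ L c {g h} → (∀ s s′ M → s + s′ ≡ c + sum L + sum M → g s M ≡ h s′ M) →
                down² g (c ∷ L) ≡ down² h (c ∷ L)
down²-reflect [] c {g} {h} g≡h = trans (down²-[] g c) (trans
  (S-cong (λ y → ∑-reflect y c λ x x′ eq → g≡h (x + 0) (x′ + 0) (y ∷ [])
    (trans (lemma₁ x x′) (trans eq (lemma₂ y c)))) c)
  (sym (down²-[] h c)))
  where
  lemma₁ : ∀ x y → x + 0 + (y + 0) ≡ x + y
  lemma₁ = solve-∀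
  lemma₂ : ∀ y c → y + c ≡ c + 0 + (y + 0)
  lemma₂ = solve-∀
down²-reflect (l ∷ L) c {g} {h} g≡h = trans (down²-∷ g c l L) (trans
  (S-cong (λ y → ∑-reflect (l ⊔ y) c λ x x′ eq →
    down²-reflect L (l ⊓ y) λ s s′ M eq′ → g≡h (x + s) (x′ + s′) (y ∷ M)
      (trans (lemma₁ x s x′ s′) (trans (cong₂ _+_ eq eq′)
        (trans (lemma₂ (l ⊔ y) c (l ⊓ y) (sum L) (sum M))
        (trans (cong (λ z → c + (z + sum L) + sum M) (⊔+⊓ l y)) (lemma₃ c l y (sum L) (sum M)))))))
    c)
  (sym (down²-∷ h c l L)))
  where
  lemma₁ : ∀ x s y u → x + s + (y + u) ≡ x + y + (s + u)
  lemma₁ = solve-∀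
  lemma₂ : ∀ p c q a b → p + c + (q + a + b) ≡ c + (p + q + a) + b
  lemma₂ = solve-∀
  lemma₃ : ∀ c l y a b → c + (l + y + a) + b ≡ c + (l + a) + (y + b)
  lemma₃ = solve-∀

-- The number of semistandard tableaux of shape L in K letters; removing the
-- largest letter removes a horizontal strip.

ssyt : ℕ → List ℕ → ℕ
ssyt zero    L = ⟦ sum L ≟ 0 ⟧
ssyt (suc K) L = down (ssyt K) L

-- h_r(1^K), sorted by the multiplicity of the last letter.

multisets : ℕ → ℕ → ℕ
multisets zero    r = ⟦ r ≟ 0 ⟧
multisets (suc K)   = S (multisets K)

hd≤sum : ∀ L → hd L ≤ sum L
hd≤sum []      = z≤n
hd≤sum (l ∷ L) = m≤m+n l (sum L)

sum≡0⇒hd≡0 : ∀ L → sum L ≡ 0 → hd L ≡ 0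
sum≡0⇒hd≡0 L p = n≤0⇒n≡0 (subst (hd L ≤_) p (hd≤sum L))

down-sum-0 : ∀ (F : ℕ → ℕ) L → sum L ≡ 0 → down (F ∘ sum) L ≡ F 0
down-sum-0 F []         _ = refl
down-sum-0 F (zero ∷ L) p = trans
  (∑-cong {λ x → down (F ∘ sum ∘ (x ∷_)) L} {λ _ → F 0} (hd L) 0
    λ { zero _ _ → down-sum-0 F L p ; (suc _) _ () })
  (trans (cong (λ a → ∑ a 0 λ _ → F 0) (sum≡0⇒hd≡0 L p)) (∑-single 0 (λ _ → F 0)))

S-δ0 : ∀ b → S (λ x → ⟦ x ≟ 0 ⟧) b ≡ 1
S-δ0 zero    = refl
S-δ0 (suc b) = trans (+-identityʳ _) (S-δ0 b)

-- Adding a horizontal strip to L means choosing M ≺ b ∷ L, for any large b.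

pieri : ∀ K L b r → hd L + r ≤ b →
        down (λ M → ⟦ sum M ≟ sum L + r ⟧ * ssyt K M) (b ∷ L) ≡ multisets K r * ssyt K L
pieri zero L b r _ with sum L + r ≟ 0
... | no L+r≢0 = trans
  (trans (down-cong (λ M → vanish M (sum M ≟ 0)) (b ∷ L)) (down-0 (b ∷ L)))
  (sym (vanish′ (r ≟ 0) (sum L ≟ 0)))
  where
  vanish : ∀ M → (d : Dec (sum M ≡ 0)) → ⟦ sum M ≟ sum L + r ⟧ * ⟦ d ⟧ ≡ 0
  vanish M (no _)  = *-zeroʳ ⟦ sum M ≟ sum L + r ⟧
  vanish M (yes p) = cong (_* 1) (⟦⟧-no (sum M ≟ sum L + r) λ q → L+r≢0 (trans (sym q) p))
  vanish′ : (d : Dec (r ≡ 0)) (e : Dec (sum L ≡ 0)) → ⟦ d ⟧ * ⟦ e ⟧ ≡ 0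
  vanish′ (no _)  _       = refl
  vanish′ (yes _) (no _)  = refl
  vanish′ (yes p) (yes q) = ⊥-elim (L+r≢0 (cong₂ _+_ q p))
... | yes L+r≡0 = begin
  down (λ M → ⟦ sum M ≟ sum L + r ⟧ * ⟦ sum M ≟ 0 ⟧) (b ∷ L)
    ≡⟨ down-cong (λ M → cong (λ z → ⟦ sum M ≟ z ⟧ * ⟦ sum M ≟ 0 ⟧) L+r≡0) (b ∷ L) ⟩
  down (λ M → ⟦ sum M ≟ 0 ⟧ * ⟦ sum M ≟ 0 ⟧) (b ∷ L)
    ≡⟨ down-cong (λ M → idem (sum M ≟ 0)) (b ∷ L) ⟩
  ∑ (hd L) b (λ x → down (λ M → ⟦ x + sum M ≟ 0 ⟧) L)
    ≡⟨ ∑-cong (hd L) b (λ x _ _ → down-sum-0 (λ s → ⟦ x + s ≟ 0 ⟧) L L≡0) ⟩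
  ∑ (hd L) b (λ x → ⟦ x + 0 ≟ 0 ⟧)
    ≡⟨ S-cong (λ x → trans (cong₂ _*_ (⟦⟧-yes (hd L ≤? x) (subst (_≤ x) (sym (sum≡0⇒hd≡0 L L≡0)) z≤n))
         (cong (λ z → ⟦ z ≟ 0 ⟧) (+-identityʳ x))) (*-identityˡ _)) b ⟩
  S (λ x → ⟦ x ≟ 0 ⟧) b
    ≡⟨ S-δ0 b ⟩
  1
    ≡⟨ cong₂ _*_ (⟦⟧-yes (r ≟ 0) (m+n≡0⇒n≡0 (sum L) L+r≡0)) (⟦⟧-yes (sum L ≟ 0) L≡0) ⟨
  ⟦ r ≟ 0 ⟧ * ⟦ sum L ≟ 0 ⟧ ∎
  where
  open ≡-Reasoning
  L≡0 : sum L ≡ 0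
  L≡0 = m+n≡0⇒m≡0 (sum L) L+r≡0
  idem : ∀ {P : Set} (d : Dec P) → ⟦ d ⟧ * ⟦ d ⟧ ≡ ⟦ d ⟧
  idem (yes _) = refl
  idem (no _)  = refl
pieri (suc K) L b r L+r≤b with b ∸ r | m∸n+n≡m (m+n≤o⇒n≤o (hd L) L+r≤b)
... | c | refl = begin
  down (λ M → ⟦ sum M ≟ sum L + r ⟧ * down (ssyt K) M) (c + r ∷ L)
    ≡⟨ down-cong (λ M → down-* ⟦ sum M ≟ sum L + r ⟧ (ssyt K) M) (c + r ∷ L) ⟨
  down² (λ s M → ⟦ s ≟ sum L + r ⟧ * ssyt K M) (c + r ∷ L)
    -- The outer shape has c cells more than a middle shape of size `sum L + r`. After reflection it
    -- is the middle shape that has c cells more than the inner one.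
    ≡⟨ down²-reflect L (c + r) (λ s s′ M eq → cong (_* ssyt K M)
         (⟦⟧-cong (s ≟ sum L + r) (s′ + r ≟ c + r + sum M) (to s s′ (sum M) eq) (from s s′ (sum M) eq))) ⟩
  down² (λ s M → ⟦ s + r ≟ c + r + sum M ⟧ * ssyt K M) (c + r ∷ L)
    ≡⟨⟩
  ∑ (hd L) (c + r) X
    -- A first middle part x < c is impossible: `M ≺ x ∷ N` forces `sum N ≤ sum M`, and x + `sum N`
    -- would fall short of c + `sum M`.
    ≡⟨ ∑-trim (c + r) X (+-cancelʳ-≤ r (hd L) c L+r≤b) X≡0 ⟩
  ∑ c (c + r) X
    ≡⟨ ∑-shift c r X ⟩
  S (λ s → X (c + s)) r
    -- With first middle part c + s the condition becomes `sum M ≡ sum N + s`, the induction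
    -- hypothesis for `N` and one letter fewer. Its bound holds because `hd N ≤ hd L ≤ c`.
    ≡⟨ S-cong X≡ r ⟩
  S (λ s → multisets K s * down (ssyt K) L) r
    ≡⟨ trans (S-cong (λ s → *-comm (multisets K s) _) r) (trans (S-* (down (ssyt K) L) (multisets K) r) (*-comm _ (S (multisets K) r))) ⟩
  S (multisets K) r * down (ssyt K) L ∎
  where
  open ≡-Reasoning
  X : ℕ → ℕ
  X x = down (λ N → down (λ M → ⟦ x + sum N + r ≟ c + r + sum M ⟧ * ssyt K M) (x ∷ N)) L

  to : ∀ s s′ m → s + s′ ≡ c + r + sum L + m → s ≡ sum L + r → s′ + r ≡ c + r + m
  to s s′ m eq refl = +-cancelˡ-≡ (sum L) _ _ (trans (lemma₁ (sum L) s′ r) (trans eq (lemma₂ c r (sum L) m)))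
    where
    lemma₁ : ∀ a s r → a + (s + r) ≡ a + r + s
    lemma₁ = solve-∀
    lemma₂ : ∀ c r a m → c + r + a + m ≡ a + (c + r + m)
    lemma₂ = solve-∀
  from : ∀ s s′ m → s + s′ ≡ c + r + sum L + m → s′ + r ≡ c + r + m → s ≡ sum L + r
  from s s′ m eq eq′ = +-cancelʳ-≡ s′ _ _ (trans eq (trans (lemma₁ c r (sum L) m)
    (trans (cong (sum L +_) (sym eq′)) (lemma₂ (sum L) s′ r))))
    where
    lemma₁ : ∀ c r a m → c + r + a + m ≡ a + (c + r + m)
    lemma₁ = solve-∀
    lemma₂ : ∀ a s r → a + (s + r) ≡ a + r + s
    lemma₂ = solve-∀

  X≡0 : ∀ x → x < c → X x ≡ 0
  X≡0 x x<c = trans (down-cong (λ N → trans (down-cong≺ (x ∷ N) λ M i → cong (_* ssyt K M)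
      (⟦⟧-no (x + sum N + r ≟ c + r + sum M) (λ eq → <-irrefl eq (small (sum-tail-≺ i)))))
      (down-0 (x ∷ N))) L) (down-0 L)
    where
    small : ∀ {n m} → n ≤ m → x + n + r < c + r + m
    small {n} {m} n≤m = subst (x + n + r <_) (lemma c m r) (+-monoˡ-< r (+-mono-<-≤ x<c n≤m))
      where
      lemma : ∀ c m r → c + m + r ≡ c + r + m
      lemma = solve-∀

  X≡ : ∀ s → X (c + s) ≡ multisets K s * down (ssyt K) L
  X≡ s = trans
    (down-cong≺ L λ N i → trans
      (down-cong (λ M → cong (_* ssyt K M) (⟦⟧-cong (c + s + sum N + r ≟ c + r + sum M) (sum M ≟ sum N + s)
        (λ eq → sym (+-cancelˡ-≡ (c + r) _ _ (trans (lemma c r (sum N) s) eq)))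
        (λ eq → trans (sym (lemma c r (sum N) s)) (cong (c + r +_) (sym eq))))) (c + s ∷ N))
      (pieri K N (c + s) s (+-monoˡ-≤ s (≤-trans (hd-≺ i) (+-cancelʳ-≤ r (hd L) c L+r≤b)))))
    (down-* (multisets K s) (ssyt K) L)
    where
    lemma : ∀ c r n s → c + r + (n + s) ≡ c + s + n + r
    lemma = solve-∀

-- Binomial coefficients

C-pascal : ∀ n k → suc n C suc k ≡ n C k + n C suc k
C-pascal n k = sym (nCk+nC[k+1]≡[n+1]C[k+1] n k)

-- The form without subtraction of (k+1) C(n,k+1) = (n-k) C(n,k).
C-absorb : ∀ n k → suc k * (n C suc k) + k * (n C k) ≡ n * (n C k)
C-absorb zero    zero    = refl
C-absorb zero    (suc k) = cong₂ _+_ (*-zeroʳ (2 + k)) (*-zeroʳ (suc k))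
C-absorb (suc n) zero    = trans (cong (λ x → 1 * x + 0) (C-pascal n 0))
  (trans (lemma (n C 1)) (cong (1 +_) (C-absorb n 0)))
  where
  lemma : ∀ a → 1 * (1 + a) + 0 ≡ 1 + (1 * a + 0)
  lemma = solve-∀
C-absorb (suc n) (suc k) = begin
  (2 + k) * (suc n C (2 + k)) + suc k * (suc n C suc k)
    ≡⟨ cong₂ (λ x y → (2 + k) * x + suc k * y) (C-pascal n (suc k)) (C-pascal n k) ⟩
  (2 + k) * (c₁ + c₂) + suc k * (c₀ + c₁)
    ≡⟨ lemma₁ k c₀ c₁ c₂ ⟩
  ((2 + k) * c₂ + suc k * c₁) + (suc k * c₁ + k * c₀) + (c₀ + c₁)
    ≡⟨ cong₂ (λ x y → x + y + (c₀ + c₁)) (C-absorb n (suc k)) (C-absorb n k) ⟩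
  n * c₁ + n * c₀ + (c₀ + c₁)
    ≡⟨ lemma₂ n c₀ c₁ ⟩
  suc n * (c₀ + c₁)
    ≡⟨ cong (suc n *_) (C-pascal n k) ⟨
  suc n * (suc n C suc k) ∎
  where
  open ≡-Reasoning
  c₀ = n C k
  c₁ = n C suc k
  c₂ = n C (2 + k)
  lemma₁ : ∀ k c₀ c₁ c₂ → (2 + k) * (c₁ + c₂) + suc k * (c₀ + c₁) ≡
           ((2 + k) * c₂ + suc k * c₁) + (suc k * c₁ + k * c₀) + (c₀ + c₁)
  lemma₁ = solve-∀
  lemma₂ : ∀ n c₀ c₁ → n * c₁ + n * c₀ + (c₀ + c₁) ≡ suc n * (c₀ + c₁)
  lemma₂ = solve-∀

C-suc : ∀ n k → n * ((n ∸ 1) C k) ≡ suc k * (n C suc k)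
C-suc zero    k = sym (*-zeroʳ (suc k))
C-suc (suc n) k = sym (begin
  suc k * (suc n C suc k)                       ≡⟨ cong (suc k *_) (C-pascal n k) ⟩
  suc k * (n C k + n C suc k)                   ≡⟨ lemma k (n C k) (n C suc k) ⟩
  n C k + (suc k * (n C suc k) + k * (n C k))   ≡⟨ cong (n C k +_) (C-absorb n k) ⟩
  suc n * (n C k)                               ∎)
  where
  open ≡-Reasoning
  lemma : ∀ k a b → suc k * (a + b) ≡ a + (suc k * b + k * a)
  lemma = solve-∀

-- C₋ n k is C(n, k-1), with value 0 at k = 0.

C₋ : ℕ → ℕ → ℕ
C₋ n zero    = 0
C₋ n (suc k) = n C k

C₋-pascal : ∀ n k → C₋ (suc n) (suc k) ≡ C₋ n k + C₋ n (suc k)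
C₋-pascal n zero    = refl
C₋-pascal n (suc k) = C-pascal n k

C₋-0 : ∀ {n k} → suc n < k → C₋ n k ≡ 0
C₋-0 {k = suc k} (s≤s n<k) = k>n⇒nCk≡0 n<k

C-as-t : ∀ n i → suc n C i ≡ n C i + t (n C_) i
C-as-t n zero    = refl
C-as-t n (suc i) = trans (C-pascal n i) (+-comm (n C i) _)

S-t-* : ∀ (f g : ℕ → ℕ) n → S (λ i → t f i * g i) n + f n * g (suc n) ≡ S (λ i → f i * g (suc i)) n
S-t-* f g zero    = refl
S-t-* f g (suc n) = cong (_+ f (suc n) * g (2 + n)) (S-t-* f g n)

-- The hypothesis says that the sum is complete: C(r, k+i-1) = 0 for i > n. In the induction on `a`
-- by Pascal's rule it also disposes of the extra term which shifting the index creates.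
vandermonde : ∀ a r k n → r < k + n → S (λ i → (a C i) * C₋ r (k + i)) n ≡ C₋ (a + r) (a + k)
vandermonde zero r k n _ = trans (S-cong (λ { zero → refl ; (suc i) → refl }) n)
  (trans (first n) (cong (C₋ r) (+-identityʳ k)))
  where
  first : ∀ n → S (λ i → (0 C i) * C₋ r (k + i)) n ≡ C₋ r (k + 0)
  first zero    = *-identityˡ _
  first (suc n) = trans (+-identityʳ _) (first n)
vandermonde (suc a) r k n r<k+n = begin
  S (λ i → (suc a C i) * C₋ r (k + i)) n
    ≡⟨ S-cong (λ i → trans (cong (_* C₋ r (k + i)) (C-as-t a i)) (*-distribʳ-+ (C₋ r (k + i)) (a C i) _)) n ⟩
  S (λ i → (a C i) * C₋ r (k + i) + t (a C_) i * C₋ r (k + i)) n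
    ≡⟨ S-+ _ _ n ⟩
  S (λ i → (a C i) * C₋ r (k + i)) n + S (λ i → t (a C_) i * C₋ r (k + i)) n
    ≡⟨ cong₂ _+_ (vandermonde a r k n r<k+n) (begin
         S (λ i → t (a C_) i * C₋ r (k + i)) n
           ≡⟨ trans (cong (S (λ i → t (a C_) i * C₋ r (k + i)) n +_)
                (trans (cong ((a C n) *_) (C₋-0 (subst (suc r <_) (sym (+-suc k n)) (s≤s r<k+n)))) (*-zeroʳ (a C n))))
                (+-identityʳ _) ⟨
         S (λ i → t (a C_) i * C₋ r (k + i)) n + (a C n) * C₋ r (k + suc n)
           ≡⟨ S-t-* (a C_) (λ i → C₋ r (k + i)) n ⟩
         S (λ i → (a C i) * C₋ r (k + suc i)) n
           ≡⟨ S-cong (λ i → cong (λ z → (a C i) * C₋ r z) (+-suc k i)) n ⟩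
         S (λ i → (a C i) * C₋ r (suc k + i)) n
           ≡⟨ vandermonde a r (suc k) n (m≤n⇒m≤1+n r<k+n) ⟩
         C₋ (a + r) (a + suc k)
           ≡⟨ cong (C₋ (a + r)) (+-suc a k) ⟩
         C₋ (a + r) (suc (a + k)) ∎) ⟩
  C₋ (a + r) (a + k) + C₋ (a + r) (suc (a + k))
    ≡⟨ C₋-pascal (a + r) (a + k) ⟨
  C₋ (suc a + r) (suc a + k) ∎
  where open ≡-Reasoning

-- `t^ d (b C_) e` is C(b, e-d) with value 0 for e < d, where a truncated difference would give
-- C(b,0) = 1.
t^ : ℕ → (ℕ → ℕ) → ℕ → ℕ
t^ zero    f = f
t^ (suc d) f = t (t^ d f)

-- `C-absorb` at k = e - d, with the multiples of d moved across.
t^-C-absorb : ∀ b d e → suc e * t^ d (b C_) (suc e) + e * t^ d (b C_) e ≡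
                        (b + d) * t^ d (b C_) e + d * t^ d (b C_) (suc e)
t^-C-absorb b zero    e = trans (C-absorb b e)
  (trans (cong (_* (b C e)) (sym (+-identityʳ b))) (sym (+-identityʳ _)))
t^-C-absorb b (suc d) (suc e) = begin
  (2 + e) * x′ + suc e * x            ≡⟨ lemma₁ e x x′ ⟩
  (suc e * x′ + e * x) + (x + x′)     ≡⟨ cong (_+ (x + x′)) (t^-C-absorb b d e) ⟩
  (b + d) * x + d * x′ + (x + x′)     ≡⟨ lemma₂ b d x x′ ⟩
  (b + suc d) * x + suc d * x′        ∎
  where
  open ≡-Reasoning
  x x′ : ℕ
  x  = t^ d (b C_) e
  x′ = t^ d (b C_) (suc e)
  lemma₁ : ∀ e x x′ → (2 + e) * x′ + suc e * x ≡ (suc e * x′ + e * x) + (x + x′)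
  lemma₁ = solve-∀
  lemma₂ : ∀ b d x x′ → (b + d) * x + d * x′ + (x + x′) ≡ (b + suc d) * x + suc d * x′
  lemma₂ = solve-∀
t^-C-absorb b (suc zero)    zero = cong (λ x → x + 1) (sym (*-zeroʳ (b + 1)))
t^-C-absorb b (suc (suc d)) zero = sym (cong₂ _+_ (*-zeroʳ (b + (2 + d))) (*-zeroʳ d))

-- The coefficients of 𝒢 r applied to x^(d+1) y^b, listed by the exponent of
-- x minus one.

γ : ℕ → ℕ → ℕ → ℕ → ℕ
γ b d r e = t^ d (b C_) e * ((d + r) C e)

-- The relation that `S^-absorb` requires, for `N` = b + d. It comes from Pascal's rule for C(d+r+1,
-- e) and the absorption identities of both binomial factors.
γ-rec : ∀ b d r e →
  suc r * γ b d (suc r) e + t (θ (γ b d r)) e ≡ (suc r + e) * γ b d r e + (b + d) * t (γ b d r) e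
γ-rec b d r zero    = cong₂ _+_
  (cong (_* (t^ d (b C_) 0 * 1)) (sym (+-identityʳ (suc r))))
  (sym (*-zeroʳ (b + d)))
-- The cancelled summand supplies the terms that the two absorption identities carry on their
-- positive sides.
γ-rec b d r (suc e) = +-cancelʳ-≡ (d * (x′ * y) + x′ * (e * y)) _ _ (begin
  suc r * (x′ * ((d + suc r) C suc e)) + e * (x * y) + (d * (x′ * y) + x′ * (e * y))
    ≡⟨ cong (λ z → suc r * (x′ * z) + e * (x * y) + (d * (x′ * y) + x′ * (e * y)))
         (trans (cong (_C suc e) (+-suc d r)) (C-pascal (d + r) e)) ⟩
  suc r * (x′ * (y + y′)) + e * (x * y) + (d * (x′ * y) + x′ * (e * y))
    ≡⟨ lemma₁ r e d x x′ y y′ ⟩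
  suc r * (x′ * y′) + x′ * ((d + r) * y) + (suc e * x′ + e * x) * y
    ≡⟨ cong₂ (λ u v → suc r * (x′ * y′) + x′ * u + v * y) (sym (C-absorb (d + r) e)) (t^-C-absorb b d e) ⟩
  suc r * (x′ * y′) + x′ * (suc e * y′ + e * y) + ((b + d) * x + d * x′) * y
    ≡⟨ lemma₂ r e d (b + d) x x′ y y′ ⟩
  (suc r + suc e) * (x′ * y′) + (b + d) * (x * y) + (d * (x′ * y) + x′ * (e * y)) ∎)
  where
  open ≡-Reasoning
  x x′ y y′ : ℕ
  x  = t^ d (b C_) e
  x′ = t^ d (b C_) (suc e)
  y  = (d + r) C e
  y′ = (d + r) C suc e
  lemma₁ : ∀ r e d x x′ y y′ →
    suc r * (x′ * (y + y′)) + e * (x * y) + (d * (x′ * y) + x′ * (e * y)) ≡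
    suc r * (x′ * y′) + x′ * ((d + r) * y) + (suc e * x′ + e * x) * y
  lemma₁ = solve-∀
  lemma₂ : ∀ r e d n x x′ y y′ →
    suc r * (x′ * y′) + x′ * (suc e * y′ + e * y) + (n * x + d * x′) * y ≡
    (suc r + suc e) * (x′ * y′) + n * (x * y) + (d * (x′ * y) + x′ * (e * y))
  lemma₂ = solve-∀

γ-0 : ∀ b d e → γ b d 0 e ≡ ⟦ d ≟ e ⟧
γ-0 b d e rewrite +-identityʳ d = go d e
  where
  below : ∀ d e → e < d → t^ d (b C_) e ≡ 0
  below (suc d) zero    _         = refl
  below (suc d) (suc e) (s≤s e<d) = below d e e<d
  diagonal : ∀ d → t^ d (b C_) d ≡ 1
  diagonal zero    = refl
  diagonal (suc d) = diagonal d
  go : ∀ d e → t^ d (b C_) e * (d C e) ≡ ⟦ d ≟ e ⟧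
  go d e with <-cmp e d
  ... | tri< e<d e≢d _ = trans (cong (_* (d C e)) (below d e e<d)) (sym (⟦⟧-no (d ≟ e) (e≢d ∘ sym)))
  ... | tri> _ e≢d d<e = trans (cong (t^ d (b C_) e *_) (k>n⇒nCk≡0 d<e))
                               (trans (*-zeroʳ (t^ d (b C_) e)) (sym (⟦⟧-no (d ≟ e) (e≢d ∘ sym))))
  ... | tri≈ _ refl _  = trans (cong₂ _*_ (diagonal d) (nCn≡1 d)) (sym (⟦⟧-yes (d ≟ d) refl))

-- Multiset numbers, and the effect of 𝒢_r after iterated partial sums.

multisets-0 : ∀ k → multisets k 0 ≡ 1
multisets-0 zero    = refl
multisets-0 (suc k) = multisets-0 k

multisets-1 : ∀ r → multisets 1 r ≡ 1
multisets-1 = S-δ0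

mutual
  -- The two ratios of neighbouring values of h_r(1^(k+1)) = C(k+r, r). Each induction step adds two
  -- neighbours, and both identities at the smaller index bring them to a common multiple.
  multisets-suc-r : ∀ k r → suc r * multisets (suc k) (suc r) ≡ (suc r + k) * multisets (suc k) r
  multisets-suc-r zero    r = cong₂ _*_ (sym (+-identityʳ (suc r))) (trans (multisets-1 (suc r)) (sym (multisets-1 r)))
  multisets-suc-r (suc k) r = begin
    suc r * (multisets (2 + k) r + multisets (suc k) (suc r))
      ≡⟨ *-distribˡ-+ (suc r) (multisets (2 + k) r) _ ⟩
    suc r * multisets (2 + k) r + suc r * multisets (suc k) (suc r)
      ≡⟨ cong (suc r * multisets (2 + k) r +_) (trans (multisets-suc-r k r) (multisets-suc-k k r)) ⟩
    suc r * multisets (2 + k) r + suc k * multisets (2 + k) r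
      ≡⟨ *-distribʳ-+ (multisets (2 + k) r) (suc r) (suc k) ⟨
    (suc r + suc k) * multisets (2 + k) r ∎
    where open ≡-Reasoning

  multisets-suc-k : ∀ k r → (suc r + k) * multisets (suc k) r ≡ suc k * multisets (2 + k) r
  multisets-suc-k k zero    = refl
  multisets-suc-k k (suc r) = begin
    (2 + r + k) * multisets (suc k) (suc r)
      ≡⟨ lemma r k (multisets (suc k) (suc r)) ⟩
    suc r * multisets (suc k) (suc r) + suc k * multisets (suc k) (suc r)
      ≡⟨ cong (_+ suc k * multisets (suc k) (suc r)) (trans (multisets-suc-r k r) (multisets-suc-k k r)) ⟩
    suc k * multisets (2 + k) r + suc k * multisets (suc k) (suc r)
      ≡⟨ *-distribˡ-+ (suc k) (multisets (2 + k) r) _ ⟨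
    suc k * multisets (2 + k) (suc r) ∎
    where
    open ≡-Reasoning
    lemma : ∀ r k a → (2 + r + k) * a ≡ suc r * a + suc k * a
    lemma = solve-∀

-- Both sides obey one first-order recursion in r, with ratio (r+1+k)/(r+1): `S^-absorb` gives it on
-- the left, `multisets-suc-r` on the right. Partial sums are what make this ratio free of b and d.
S^-γ : ∀ b d r k → S^ (1 + (b + d + r)) (γ b d r) k ≡ multisets (suc k) r * S^ (1 + (b + d)) (λ e → ⟦ d ≟ e ⟧) k
S^-γ b d zero    k = trans
  (cong (λ m → S^ (suc m) (γ b d 0) k) (+-identityʳ (b + d)))
  (trans (S^-cong (1 + (b + d)) (γ-0 b d) k)
  (trans (sym (*-identityˡ _)) (cong (_* S^ (1 + (b + d)) (λ e → ⟦ d ≟ e ⟧) k) (sym (multisets-0 (suc k))))))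
S^-γ b d (suc r) k = *-cancelˡ-≡ _ _ (suc r) (begin
  suc r * S^ (1 + (b + d + suc r)) (γ b d (suc r)) k
    ≡⟨ cong (λ m → suc r * S^ (suc m) (γ b d (suc r)) k) (+-suc (b + d) r) ⟩
  suc r * S^ (2 + (b + d + r)) (γ b d (suc r)) k
    ≡⟨ S^-absorb (b + d) r (γ b d r) (γ b d (suc r)) (γ-rec b d r) k ⟩
  (suc r + k) * S^ (1 + (b + d + r)) (γ b d r) k
    ≡⟨ cong ((suc r + k) *_) (S^-γ b d r k) ⟩
  (suc r + k) * (multisets (suc k) r * X)
    ≡⟨ *-assoc (suc r + k) (multisets (suc k) r) X ⟨
  (suc r + k) * multisets (suc k) r * X
    ≡⟨ cong (_* X) (multisets-suc-r k r) ⟨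
  suc r * multisets (suc k) (suc r) * X
    ≡⟨ *-assoc (suc r) (multisets (suc k) (suc r)) X ⟩
  suc r * (multisets (suc k) (suc r) * X) ∎)
  where
  open ≡-Reasoning
  X : ℕ
  X = S^ (1 + (b + d)) (λ e → ⟦ d ≟ e ⟧) k

-- The transpose of 𝒢

conv : ℕ → (ℕ → ℕ → ℕ) → ℕ
conv zero    p = p 0 0
conv (suc n) p = p 0 (suc n) + conv n (p ∘ suc)

conv-cong : ∀ {p q} n → (∀ l i → l + i ≡ n → p l i ≡ q l i) → conv n p ≡ conv n q
conv-cong zero    p≡q = p≡q 0 0 refl
conv-cong (suc n) p≡q = cong₂ _+_ (p≡q 0 (suc n) refl)
  (conv-cong n λ l i l+i≡n → p≡q (suc l) i (cong suc l+i≡n))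

conv-+ : ∀ n p q → conv n (λ l i → p l i + q l i) ≡ conv n p + conv n q
conv-+ zero    p q = refl
conv-+ (suc n) p q = trans (cong (p 0 (suc n) + q 0 (suc n) +_) (conv-+ n (p ∘ suc) (q ∘ suc)))
                           (+-interchange (p 0 (suc n)) (q 0 (suc n)) _ _)

conv-* : ∀ n c p → conv n (λ l i → c * p l i) ≡ c * conv n p
conv-* zero    c p = refl
conv-* (suc n) c p = trans (cong (c * p 0 (suc n) +_) (conv-* n c (p ∘ suc)))
                           (sym (*-distribˡ-+ c _ _))

conv-back : ∀ n p → conv (suc n) p ≡ conv n (λ l i → p l (suc i)) + p (suc n) 0
conv-back zero    p = refl
conv-back (suc n) p = trans (cong (p 0 (2 + n) +_) (conv-back n (p ∘ suc))) (sym (+-assoc (p 0 (2 + n)) _ _))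

-- Every term of degree n + 1 is weighted by l + i. Terms with l = 0 in the one part and i = 0 in
-- the other have weight 0, which shortens both sums to degree n.
conv-euler : ∀ n q → conv n (λ l i → suc l * q (suc l) i) + conv n (λ l i → suc i * q l (suc i)) ≡
                     suc n * conv (suc n) q
conv-euler n q = begin
  conv n (λ l i → suc l * q (suc l) i) + conv n (λ l i → suc i * q l (suc i))
    ≡⟨ cong (conv n (λ l i → suc l * q (suc l) i) +_)
         (trans (conv-back n (λ l i → i * q l i)) (+-identityʳ _)) ⟨
  conv (suc n) (λ l i → l * q l i) + conv (suc n) (λ l i → i * q l i)
    ≡⟨ conv-+ (suc n) (λ l i → l * q l i) (λ l i → i * q l i) ⟨
  conv (suc n) (λ l i → l * q l i + i * q l i)
    ≡⟨ conv-cong (suc n) (λ l i l+i≡n → trans (sym (*-distribʳ-+ (q l i) l i)) (cong (_* q l i) l+i≡n)) ⟩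
  conv (suc n) (λ l i → suc n * q l i)
    ≡⟨ conv-* (suc n) (suc n) q ⟩
  suc n * conv (suc n) q ∎
  where open ≡-Reasoning

S-conv : ∀ n p → S (λ j → conv j p) n ≡ S (λ l → S (p l) (n ∸ l)) n
S-conv zero    p = refl
S-conv (suc n) p = begin
  S (λ j → conv j p) (suc n)
    ≡⟨ S-front (λ j → conv j p) n ⟩
  p 0 0 + S (λ j → p 0 (suc j) + conv j (p ∘ suc)) n
    ≡⟨ cong (p 0 0 +_) (S-+ (p 0 ∘ suc) (λ j → conv j (p ∘ suc)) n) ⟩
  p 0 0 + (S (p 0 ∘ suc) n + S (λ j → conv j (p ∘ suc)) n)
    ≡⟨ +-assoc (p 0 0) _ _ ⟨
  p 0 0 + S (p 0 ∘ suc) n + S (λ j → conv j (p ∘ suc)) n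
    ≡⟨ cong₂ _+_ (sym (S-front (p 0) n)) (S-conv n (p ∘ suc)) ⟩
  S (p 0) (suc n) + S (λ l → S (p (suc l)) (n ∸ l)) n
    ≡⟨ S-front (λ l → S (p l) (suc n ∸ l)) n ⟨
  S (λ l → S (p l) (suc n ∸ l)) (suc n) ∎
  where open ≡-Reasoning

Weight : Set
Weight = ℕ → ℕ → ℕ

-- A weight w stands for the linear functional x^a y^b ↦ w a b; starred operators
-- are the transposes of the operators on polynomials.

D* : Weight → Weight
D* w a b = a * w (a ∸ 1) b + b * w a (b ∸ 1)

-- The transpose of D^j / j!, expanded in the divided powers of ∂x and ∂y. These have binomial
-- coefficients, so weights remain natural numbers.
taylor : ℕ → Weight → Weight
taylor j w a b = conv j λ l i → (b C l) * ((a C i) * w (a ∸ i) (b ∸ l))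

D*-taylor : ∀ j w a b → D* (taylor j w) a b ≡ suc j * taylor (suc j) w a b
D*-taylor j w a b = begin
  a * taylor j w (a ∸ 1) b + b * taylor j w a (b ∸ 1)
    ≡⟨ +-comm (a * taylor j w (a ∸ 1) b) _ ⟩
  b * taylor j w a (b ∸ 1) + a * taylor j w (a ∸ 1) b
    ≡⟨ cong₂ _+_ (trans (sym (conv-* j b _)) (conv-cong j λ l i _ → step₁ l i))
                 (trans (sym (conv-* j a _)) (conv-cong j λ l i _ → step₂ l i)) ⟩
  conv j (λ l i → suc l * q (suc l) i) + conv j (λ l i → suc i * q l (suc i))
    ≡⟨ conv-euler j q ⟩
  suc j * taylor (suc j) w a b ∎
  where
  open ≡-Reasoning
  q : ℕ → ℕ → ℕ
  q l i = (b C l) * ((a C i) * w (a ∸ i) (b ∸ l))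
  step₁ : ∀ l i → b * (((b ∸ 1) C l) * ((a C i) * w (a ∸ i) (b ∸ 1 ∸ l))) ≡ suc l * q (suc l) i
  step₁ l i = begin
    b * (((b ∸ 1) C l) * X)        ≡⟨ *-assoc b _ X ⟨
    b * ((b ∸ 1) C l) * X          ≡⟨ cong₂ _*_ (C-suc b l) (cong (λ z → (a C i) * w (a ∸ i) z) (∸-+-assoc b 1 l)) ⟩
    suc l * (b C suc l) * X′       ≡⟨ *-assoc (suc l) (b C suc l) X′ ⟩
    suc l * q (suc l) i            ∎
    where
    X X′ : ℕ
    X  = (a C i) * w (a ∸ i) (b ∸ 1 ∸ l)
    X′ = (a C i) * w (a ∸ i) (b ∸ suc l)
  step₂ : ∀ l i → a * ((b C l) * (((a ∸ 1) C i) * w (a ∸ 1 ∸ i) (b ∸ l))) ≡ suc i * q l (suc i)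
  step₂ l i = begin
    a * ((b C l) * (((a ∸ 1) C i) * X))    ≡⟨ lemma₁ a (b C l) _ X ⟩
    (b C l) * (a * ((a ∸ 1) C i) * X)      ≡⟨ cong ((b C l) *_) (cong₂ _*_ (C-suc a i) (cong (λ z → w z (b ∸ l)) (∸-+-assoc a 1 i))) ⟩
    (b C l) * (suc i * (a C suc i) * X′)   ≡⟨ lemma₂ (b C l) (suc i) (a C suc i) X′ ⟩
    suc i * q l (suc i)                    ∎
    where
    X X′ : ℕ
    X  = w (a ∸ 1 ∸ i) (b ∸ l)
    X′ = w (a ∸ suc i) (b ∸ l)
    lemma₁ : ∀ a b c d → a * (b * (c * d)) ≡ b * (a * c * d)
    lemma₁ = solve-∀
    lemma₂ : ∀ a b c d → a * (b * c * d) ≡ b * (a * (c * d))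
    lemma₂ = solve-∀

D*^ : ℕ → Weight → Weight
D*^ zero    w = w
D*^ (suc j) w = D* (D*^ j w)

D*^-taylor : ∀ j w a b → D*^ j w a b ≡ j ! * taylor j w a b
D*^-taylor zero    w a b = lemma (w a b)
  where
  lemma : ∀ x → x ≡ 1 * (1 * (1 * x))
  lemma = solve-∀
D*^-taylor (suc j) w a b = begin
  a * D*^ j w (a ∸ 1) b + b * D*^ j w a (b ∸ 1)
    ≡⟨ cong₂ (λ x y → a * x + b * y) (D*^-taylor j w (a ∸ 1) b) (D*^-taylor j w a (b ∸ 1)) ⟩
  a * (j ! * taylor j w (a ∸ 1) b) + b * (j ! * taylor j w a (b ∸ 1))
    ≡⟨ lemma₁ a b (j !) _ _ ⟩
  j ! * (a * taylor j w (a ∸ 1) b + b * taylor j w a (b ∸ 1))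
    ≡⟨ cong (j ! *_) (D*-taylor j w a b) ⟩
  j ! * (suc j * taylor (suc j) w a b)
    ≡⟨ lemma₂ (j !) (suc j) _ ⟩
  suc j * j ! * taylor (suc j) w a b ∎
  where
  open ≡-Reasoning
  lemma₁ : ∀ a b c d e → a * (c * d) + b * (c * e) ≡ c * (a * d + b * e)
  lemma₁ = solve-∀
  lemma₂ : ∀ a b c → a * (b * c) ≡ b * a * c
  lemma₂ = solve-∀

translate : ℕ → ℕ → Weight → Weight
translate i j w a b = w (i + a) (j + b)

-- A term with l derivatives in y and i in x, where l + i = j + 1, ends at x-exponent d + 1 + l,
-- whatever i is. Collecting by l leaves the sum over i of C(d+1,i) C(r,l+i-1), which `vandermonde`
-- evaluates.
taylor-translate : ∀ r w d b → S (λ j → (r C j) * taylor (suc j) (translate (suc j) (suc r) w) (suc d) b) r ≡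
  S (λ l → (b C l) * (((d + suc r) C (d + l)) * w (suc (d + l)) (suc r + b ∸ l))) (suc r)
taylor-translate r w d b = begin
  S (λ j → (r C j) * taylor (suc j) (translate (suc j) (suc r) w) (suc d) b) r
    ≡⟨ S-cong (λ j → trans (sym (conv-* (suc j) (r C j)
         λ l i → (b C l) * ((suc d C i) * w (suc j + (suc d ∸ i)) (suc r + (b ∸ l))))) (conv-cong (suc j) λ l i l+i≡j → step j l i l+i≡j)) r ⟩
  S (λ j → conv (suc j) p) r
    -- The missing term of degree 0 is zero because `C₋ r 0` is; with it the index set is the full
    -- triangle of `S-conv`.
    ≡⟨ cong (_+ S (λ j → conv (suc j) p) r) (*-zeroʳ (q 0)) ⟨
  p 0 0 + S (λ j → conv (suc j) p) r
    ≡⟨ S-front (λ j → conv j p) r ⟨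
  S (λ j → conv j p) (suc r)
    ≡⟨ S-conv (suc r) p ⟩
  S (λ l → S (p l) (suc r ∸ l)) (suc r)
    ≡⟨ S-cong≤ (suc r) (λ l l≤r → trans (S-* (q l) _ (suc r ∸ l)) (trans
         (cong (q l *_) (trans (vandermonde (suc d) r l (suc r ∸ l) (≤-reflexive (sym (m+[n∸m]≡n l≤r))))
                               (cong (_C (d + l)) (sym (+-suc d r)))))
         (lemma (b C l) (w (suc (d + l)) (suc r + b ∸ l)) _))) ⟩
  S (λ l → (b C l) * (((d + suc r) C (d + l)) * w (suc (d + l)) (suc r + b ∸ l))) (suc r) ∎
  where
  open ≡-Reasoning
  q : ℕ → ℕ
  q l = (b C l) * w (suc (d + l)) (suc r + b ∸ l)
  p : ℕ → ℕ → ℕ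
  p l i = q l * ((suc d C i) * C₋ r (l + i))
  lemma : ∀ a b c → a * b * c ≡ a * (c * b)
  lemma = solve-∀
  -- A truncated exponent is wrong only for i > d + 1, or in `clip₂` for l > b, and there the
  -- binomial coefficient in front vanishes.
  clip₁ : ∀ j l i → l + i ≡ j → (suc d C i) * w (j + (suc d ∸ i)) (suc r + (b ∸ l)) ≡
                                (suc d C i) * w (suc (d + l)) (suc r + (b ∸ l))
  clip₁ j l i refl with i ≤? suc d
  ... | yes i≤d = cong (λ z → (suc d C i) * w z (suc r + (b ∸ l)))
                    (trans (+-assoc l i (suc d ∸ i)) (trans (cong (l +_) (m+[n∸m]≡n i≤d)) (+-comm l (suc d))))
  ... | no i≰d rewrite k>n⇒nCk≡0 (≰⇒> i≰d) = refl
  clip₂ : ∀ l → (b C l) * w (suc (d + l)) (suc r + (b ∸ l)) ≡ q l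
  clip₂ l with l ≤? b
  ... | yes l≤b = cong (λ z → (b C l) * w (suc (d + l)) z) (sym (+-∸-assoc (suc r) l≤b))
  ... | no l≰b rewrite k>n⇒nCk≡0 (≰⇒> l≰b) = refl
  step : ∀ j l i → l + i ≡ suc j →
         (r C j) * ((b C l) * ((suc d C i) * w (suc j + (suc d ∸ i)) (suc r + (b ∸ l)))) ≡ p l i
  step j l i l+i≡j = begin
    (r C j) * ((b C l) * ((suc d C i) * w (suc j + (suc d ∸ i)) (suc r + (b ∸ l))))
      ≡⟨ cong (λ z → (r C j) * ((b C l) * z)) (clip₁ (suc j) l i l+i≡j) ⟩
    (r C j) * ((b C l) * ((suc d C i) * w (suc (d + l)) (suc r + (b ∸ l))))
      ≡⟨ rearrange (r C j) (b C l) (suc d C i) _ ⟩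
    (b C l) * w (suc (d + l)) (suc r + (b ∸ l)) * ((suc d C i) * (r C j))
      ≡⟨ cong₂ (λ x k → x * ((suc d C i) * C₋ r k)) (clip₂ l) (sym l+i≡j) ⟩
    p l i ∎
    where
    rearrange : ∀ a b c d → a * (b * (c * d)) ≡ b * d * (c * a)
    rearrange = solve-∀

t^-S : ∀ d (f g : ℕ → ℕ) n → S (λ e → t^ d f e * g e) (d + n) ≡ S (λ l → f l * g (d + l)) n
t^-S zero    f g n = refl
t^-S (suc d) f g n = trans (S-front _ (d + n)) (t^-S d f (g ∘ suc) n)

-- The substitution e = d + l. Lengthening the range costs nothing, as C(d+r, e) = 0 for e > d + r,
-- and makes it depend on the total b + d + r only, which all tableaux of one shape share.
γ-S : ∀ b d r (u : ℕ → ℕ) → S (λ l → (b C l) * (((d + r) C (d + l)) * u (d + l))) r ≡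
                            S (λ e → γ b d r e * u e) (b + d + r)
γ-S b d r u = trans (sym (t^-S d (b C_) (λ e → ((d + r) C e) * u e) r)) (trans
  (S-clip _ (subst (d + r ≤_) (sym (+-assoc b d r)) (m≤n+m (d + r) b)))
  (S-cong (λ e → term e (e ≤? d + r)) (b + d + r)))
  where
  term : ∀ e (δ : Dec (e ≤ d + r)) → ⟦ δ ⟧ * (t^ d (b C_) e * (((d + r) C e) * u e)) ≡ γ b d r e * u e
  term e (yes _)  = trans (*-identityˡ _) (sym (*-assoc (t^ d (b C_) e) _ _))
  term e (no e≰) rewrite k>n⇒nCk≡0 (≰⇒> e≰) | *-zeroʳ (t^ d (b C_) e) = refl

-- Evaluation of polynomials on weights.

ι : ℕ → ℚ
ι n = (ℤ.+ n) ℚ./ 1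

toℚᵘ-ι : ∀ n → ℚ.toℚᵘ (ι n) ℚᵘ.≃ ℚᵘ.mkℚᵘ (ℤ.+ n) 0
toℚᵘ-ι n = ℚ.toℚᵘ-fromℚᵘ (ℚᵘ.mkℚᵘ (ℤ.+ n) 0)

ι-+ : ∀ m n → ι (m + n) ≡ ι m ℚ.+ ι n
ι-+ m n = ℚ.toℚᵘ-injective (ℚᵘ.≃-trans (toℚᵘ-ι (m + n)) (ℚᵘ.≃-trans
  (ℚᵘ.*≡* (cong (ℤ._* ℤ.1ℤ) (sym (trans (cong₂ ℤ._+_ (ℤ.*-identityʳ (ℤ.+ m)) (ℤ.*-identityʳ (ℤ.+ n))) refl))))
  (ℚᵘ.≃-sym (ℚᵘ.≃-trans (ℚ.toℚᵘ-homo-+ (ι m) (ι n)) (ℚᵘ.+-cong (toℚᵘ-ι m) (toℚᵘ-ι n))))))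

ι-* : ∀ m n → ι (m * n) ≡ ι m ℚ.* ι n
ι-* m n = ℚ.toℚᵘ-injective (ℚᵘ.≃-trans (toℚᵘ-ι (m * n)) (ℚᵘ.≃-trans
  (ℚᵘ.*≡* (cong (ℤ._* ℤ.1ℤ) (ℤ.pos-* m n)))
  (ℚᵘ.≃-sym (ℚᵘ.≃-trans (ℚ.toℚᵘ-homo-* (ι m) (ι n)) (ℚᵘ.*-cong (toℚᵘ-ι m) (toℚᵘ-ι n))))))

/-ι : ∀ m n .{{_ : NonZero n}} → ((ℤ.+ m) ℚ./ n) ℚ.* ι n ≡ ι m
/-ι m n@(suc _) = ℚ.toℚᵘ-injective (ℚᵘ.≃-trans (ℚ.toℚᵘ-homo-* ((ℤ.+ m) ℚ./ n) (ι n)) (ℚᵘ.≃-trans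
  (ℚᵘ.*-cong (ℚ.toℚᵘ-fromℚᵘ (ℚᵘ.mkℚᵘ (ℤ.+ m) (pred n))) (toℚᵘ-ι n)) (ℚᵘ.≃-trans
  (ℚᵘ.*≡* (trans (ℤ.*-identityʳ _) (cong (λ z → (ℤ.+ m) ℤ.* (ℤ.+ z)) (sym (*-identityʳ n)))))
  (ℚᵘ.≃-sym (toℚᵘ-ι m)))))

ev : Weight → Poly → ℚ
ev w []                = 0ℚ
ev w ((c , a , b) ∷ p) = c ℚ.* ι (w a b) ℚ.+ ev w p

ev-cong : ∀ {v w} → (∀ a b → v a b ≡ w a b) → ∀ p → ev v p ≡ ev w p
ev-cong v≡w []                = refl
ev-cong v≡w ((c , a , b) ∷ p) = cong₂ (λ x y → c ℚ.* ι x ℚ.+ y) (v≡w a b) (ev-cong v≡w p)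

δ : ℕ → ℕ → Weight
δ A B a b = ⟦ a ≟ A ×-dec b ≟ B ⟧

coeff-ev : ∀ p A B → coeff p A B ≡ ev (δ A B) p
coeff-ev []                A B = refl
coeff-ev ((c , a , b) ∷ p) A B = cong₂ ℚ._+_ (term (does (a ≟ A ×-dec b ≟ B))) (coeff-ev p A B)
  where
  term : ∀ β → (if β then c else 0ℚ) ≡ c ℚ.* ι (if β then 1 else 0)
  term true  = sym (ℚ.*-identityʳ c)
  term false = sym (ℚ.*-zeroʳ c)

ev-++ : ∀ w p q → ev w (p ++ q) ≡ ev w p ℚ.+ ev w q
ev-++ w []                q = sym (ℚ.+-identityˡ _)
ev-++ w ((c , a , b) ∷ p) q = trans (cong (c ℚ.* ι (w a b) ℚ.+_) (ev-++ w p q))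
                                    (sym (ℚ.+-assoc (c ℚ.* ι (w a b)) _ _))

ev-mono : ∀ w c i j p → ev w (mono c i j *ₚ p) ≡ c ℚ.* ev (translate i j w) p
ev-mono w c i j p = trans (cong (ev w) (++-identityʳ (map scale p))) (go p)
  where
  scale : Term → Term
  scale (c′ , a , b) = c ℚ.* c′ , i + a , j + b
  go : ∀ p → ev w (map scale p) ≡ c ℚ.* ev (translate i j w) p
  go []                 = sym (ℚ.*-zeroʳ c)
  go ((c′ , a , b) ∷ p) = trans
    (cong₂ ℚ._+_ (ℚ.*-assoc c c′ _) (go p))
    (sym (ℚ.*-distribˡ-+ c _ _))

ev-D : ∀ w p → ev w (D p) ≡ ev (D* w) p
ev-D w p = trans (ev-++ w (∂x p) (∂y p)) (go p)
  where
  go : ∀ p → ev w (∂x p) ℚ.+ ev w (∂y p) ≡ ev (D* w) p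
  go []                = ℚ.+-identityˡ 0ℚ
  go ((c , a , b) ∷ p) = begin
    (c ℚ.* ι a ℚ.* ι x ℚ.+ X) ℚ.+ (c ℚ.* ι b ℚ.* ι y ℚ.+ Y′)
      ≡⟨ ℚ-+-interchange (c ℚ.* ι a ℚ.* ι x) X (c ℚ.* ι b ℚ.* ι y) Y′ ⟩
    (c ℚ.* ι a ℚ.* ι x ℚ.+ c ℚ.* ι b ℚ.* ι y) ℚ.+ (X ℚ.+ Y′)
      ≡⟨ cong₂ ℚ._+_ (begin
           c ℚ.* ι a ℚ.* ι x ℚ.+ c ℚ.* ι b ℚ.* ι y
             ≡⟨ cong₂ ℚ._+_ (trans (ℚ.*-assoc c (ι a) (ι x)) (cong (c ℚ.*_) (sym (ι-* a x))))
                            (trans (ℚ.*-assoc c (ι b) (ι y)) (cong (c ℚ.*_) (sym (ι-* b y)))) ⟩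
           c ℚ.* ι (a * x) ℚ.+ c ℚ.* ι (b * y)
             ≡⟨ ℚ.*-distribˡ-+ c (ι (a * x)) (ι (b * y)) ⟨
           c ℚ.* (ι (a * x) ℚ.+ ι (b * y))
             ≡⟨ cong (c ℚ.*_) (ι-+ (a * x) (b * y)) ⟨
           c ℚ.* ι (a * x + b * y) ∎) (go p) ⟩
    c ℚ.* ι (a * x + b * y) ℚ.+ ev (D* w) p ∎
    where
    open ≡-Reasoning
    x y : ℕ
    x = w (a ∸ 1) b
    y = w a (b ∸ 1)
    X Y′ : ℚ
    X = ev w (∂x p)
    Y′ = ev w (∂y p)

ev-iterate-D : ∀ w p j → ev w (iterate D p j) ≡ ev (D*^ j w) p
ev-iterate-D w p zero    = refl
ev-iterate-D w p (suc j) = trans (ev-iterate-D w (D p) j) (ev-D (D*^ j w) p)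

ev-* : ∀ c w p → ev (λ a b → c * w a b) p ≡ ι c ℚ.* ev w p
ev-* c w []                  = sym (ℚ.*-zeroʳ (ι c))
ev-* c w ((c′ , a , b) ∷ p) = trans
  (cong₂ ℚ._+_ (trans (cong (c′ ℚ.*_) (ι-* c (w a b))) (swap c′ (ι c) (ι (w a b)))) (ev-* c w p))
  (sym (ℚ.*-distribˡ-+ (ι c) _ _))
  where
  swap : ∀ a b c → a ℚ.* (b ℚ.* c) ≡ b ℚ.* (a ℚ.* c)
  swap a b c = trans (sym (ℚ.*-assoc a b c)) (trans (cong (ℚ._* c) (ℚ.*-comm a b)) (ℚ.*-assoc b a c))

ev-+ : ∀ v w p → ev (λ a b → v a b + w a b) p ≡ ev v p ℚ.+ ev w p
ev-+ v w []                = sym (ℚ.+-identityˡ 0ℚ)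
ev-+ v w ((c , a , b) ∷ p) = trans
  (cong₂ ℚ._+_ (trans (cong (c ℚ.*_) (ι-+ (v a b) (w a b))) (ℚ.*-distribˡ-+ c _ _)) (ev-+ v w p))
  (ℚ-+-interchange (c ℚ.* ι (v a b)) (c ℚ.* ι (w a b)) (ev v p) (ev w p))

-- The denominator j! of 𝒢 has cancelled against the factor in `D*^-taylor`. The index is one less
-- than in the definition of 𝒢.
𝒢* : ℕ → Weight → Weight
𝒢* zero    w     = w
𝒢* (suc r) w a b = S (λ j → (r C j) * taylor (suc j) (translate (suc j) (suc r) w) a b) r

ev-𝒢 : ∀ r w p → ev w (𝒢 r p) ≡ ev (𝒢* r w) p
ev-𝒢 zero    w p = refl
ev-𝒢 (suc r) w p = trans (ev-mono w 1ℚ 0 (suc r) (Σₚ (map summand [1‥ suc r ])))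
  (trans (ℚ.*-identityˡ (ev w′ (Σₚ (map summand [1‥ suc r ])))) (terms r (λ j → j)))
  where
  w′ : Weight
  w′ = translate 0 (suc r) w
  open ≡-Reasoning
  c : ℕ → ℚ
  c j = ℚ._/_ (ℤ.+ (r C (j ∸ 1))) (j !) {{j !≢0}}
  summand : ℕ → Poly
  summand j = mono (c j) j 0 *ₚ iterate D p j
  term : ∀ j → ev w′ (summand (suc j)) ≡
               ev (λ a b → (r C j) * taylor (suc j) (translate (suc j) (suc r) w) a b) p
  term j = begin
    ev w′ (summand (suc j))
      ≡⟨ ev-mono w′ (c (suc j)) (suc j) 0 (iterate D p (suc j)) ⟩
    c (suc j) ℚ.* ev (translate (suc j) (suc r) w) (iterate D p (suc j))
      ≡⟨ cong (c (suc j) ℚ.*_) (trans (ev-iterate-D (translate (suc j) (suc r) w) p (suc j))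
           (trans (ev-cong (D*^-taylor (suc j) (translate (suc j) (suc r) w)) p) (ev-* (suc j !) _ p))) ⟩
    c (suc j) ℚ.* (ι (suc j !) ℚ.* X)
      ≡⟨ ℚ.*-assoc (c (suc j)) (ι (suc j !)) X ⟨
    c (suc j) ℚ.* ι (suc j !) ℚ.* X
      ≡⟨ cong (ℚ._* X) (/-ι (r C j) (suc j !) {{suc j !≢0}}) ⟩
    ι (r C j) ℚ.* X
      ≡⟨ ev-* (r C j) _ p ⟨
    ev (λ a b → (r C j) * taylor (suc j) (translate (suc j) (suc r) w) a b) p ∎
    where
    X : ℚ
    X = ev (taylor (suc j) (translate (suc j) (suc r) w)) p
  -- General in `g` because `applyUpTo` recurses by composing its function with `suc`.
  terms : ∀ n (g : ℕ → ℕ) →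
    ev w′ (Σₚ (map summand (applyUpTo (suc ∘ g) (suc n)))) ≡
    ev (λ a b → S (λ j → (r C g j) * taylor (suc (g j)) (translate (suc (g j)) (suc r) w) a b) n) p
  terms zero    g = trans (ev-++ w′ (summand (suc (g 0))) []) (trans (ℚ.+-identityʳ _) (term (g 0)))
  terms (suc n) g = trans (ev-++ w′ (summand (suc (g 0))) _)
    (trans (cong₂ ℚ._+_ (term (g 0)) (terms n (g ∘ suc)))
    (trans (sym (ev-+ _ _ p)) (ev-cong (λ a b → sym (S-front _ n)) p)))

-- Sums over lists.

Σᴸ : ∀ {A : Set} → (A → ℕ) → List A → ℕ
Σᴸ g xs = sum (map g xs)

Σᴸ-cong∈ : ∀ {A : Set} {g h : A → ℕ} xs → (∀ x → x ∈ xs → g x ≡ h x) → Σᴸ g xs ≡ Σᴸ h xs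
Σᴸ-cong∈ []       _   = refl
Σᴸ-cong∈ (x ∷ xs) g≡h = cong₂ _+_ (g≡h x (here refl)) (Σᴸ-cong∈ xs λ y → g≡h y ∘ there)

Σᴸ-+ : ∀ {A : Set} (g h : A → ℕ) xs → Σᴸ (λ x → g x + h x) xs ≡ Σᴸ g xs + Σᴸ h xs
Σᴸ-+ g h []       = refl
Σᴸ-+ g h (x ∷ xs) = trans (cong (g x + h x +_) (Σᴸ-+ g h xs)) (+-interchange (g x) (h x) _ _)

Σᴸ-++ : ∀ {A : Set} (g : A → ℕ) xs ys → Σᴸ g (xs ++ ys) ≡ Σᴸ g xs + Σᴸ g ys
Σᴸ-++ g []       ys = refl
Σᴸ-++ g (x ∷ xs) ys = trans (cong (g x +_) (Σᴸ-++ g xs ys)) (sym (+-assoc (g x) _ _))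

Σᴸ-↭ : ∀ {A : Set} (g : A → ℕ) {xs ys} → xs ↭ ys → Σᴸ g xs ≡ Σᴸ g ys
Σᴸ-↭ g p = sum-↭ (↭.map⁺ g p)

Σᴸ-map : ∀ {A B : Set} (g : B → ℕ) (φ : A → B) xs → Σᴸ g (map φ xs) ≡ Σᴸ (g ∘ φ) xs
Σᴸ-map g φ xs = cong sum (sym (map-∘ xs))

Σᴸ-filter : ∀ {A : Set} {P : A → Set} (P? : Decidable P) (g : A → ℕ) xs →
            Σᴸ g (filter P? xs) ≡ Σᴸ (λ x → ⟦ P? x ⟧ * g x) xs
Σᴸ-filter P? g []       = refl
Σᴸ-filter P? g (x ∷ xs) with does (P? x)
... | true  = cong₂ _+_ (sym (*-identityˡ (g x))) (Σᴸ-filter P? g xs)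
... | false = Σᴸ-filter P? g xs

length-filter≡Σᴸ : ∀ {A : Set} {P : A → Set} (P? : Decidable P) xs →
                length (filter P? xs) ≡ Σᴸ (λ x → ⟦ P? x ⟧) xs
length-filter≡Σᴸ P? []       = refl
length-filter≡Σᴸ P? (x ∷ xs) with does (P? x)
... | true  = cong suc (length-filter≡Σᴸ P? xs)
... | false = length-filter≡Σᴸ P? xs

unique∧⊆⊇⇒↭ : ∀ {A : Set} {xs ys : List A} → Unique xs → Unique ys → xs ⊆ ys → ys ⊆ xs → xs ↭ ys
unique∧⊆⊇⇒↭ u v xs⊆ys ys⊆xs = ∼bag⇒↭ (unique∧set⇒bag u v (mk⇔ xs⊆ys ys⊆xs))

∈[1‥]⇒≤ : ∀ {n k} → k ∈ [1‥ n ] → k ≤ n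
∈[1‥]⇒≤ p with ∈-applyUpTo⁻ suc p
... | _ , i<n , refl = i<n

[1‥]-suc : ∀ n → [1‥ suc n ] ↭ suc n ∷ [1‥ n ]
[1‥]-suc n = ↭-trans (↭-reflexive (sym (applyUpTo-∷ʳ suc n))) (↭-sym (∷↭∷ʳ (suc n) [1‥ n ]))

-- Removing the largest entry of a standard tableau

Decreasing : List ℕ → Set
Decreasing []      = ⊤
Decreasing (l ∷ L) = hd L ≤ l × Decreasing L

Linked⇒Decreasing : ∀ {L} → Linked _≥_ L → Decreasing L
Linked⇒Decreasing []          = tt
Linked⇒Decreasing [-]         = z≤n , tt
Linked⇒Decreasing (p ∷ rest)  = p , Linked⇒Decreasing rest

≺⇒Decreasing : ∀ {M L} → M ≺ L → Decreasing M
≺⇒Decreasing []            = tt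
≺⇒Decreasing ((p , _) ∷ i) = ≤-trans (hd-≺ i) p , ≺⇒Decreasing i

Decreasing-lower : ∀ P {l x L} → Decreasing (P ++ l ∷ L) → hd L ≤ x → x ≤ l → Decreasing (P ++ x ∷ L)
Decreasing-lower []          (_ , d) p q = p , d
Decreasing-lower (_ ∷ [])    (r , d) p q = ≤-trans q r , Decreasing-lower [] d p q
Decreasing-lower (_ ∷ m ∷ P) (r , d) p q = r , Decreasing-lower (m ∷ P) d p q

top : Filling → List ℕ
top []      = []
top (t ∷ _) = t

Columns : Filling → Set
Columns []      = ⊤
Columns (t ∷ T) = Above t (top T) × Columns T

Linked⇒Columns : ∀ {T} → Linked Above T → Columns T
Linked⇒Columns []         = tt
Linked⇒Columns [-]        = [] , tt
Linked⇒Columns (p ∷ rest) = p , Linked⇒Columns rest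

Columns⇒Linked : ∀ T → Columns T → Linked Above T
Columns⇒Linked []          _       = []
Columns⇒Linked (_ ∷ [])    _       = [-]
Columns⇒Linked (_ ∷ s ∷ T) (p , c) = p ∷ Columns⇒Linked (s ∷ T) c

row-here : ∀ {k} t T → k ∈ t → row k (t ∷ T) ≡ 0
row-here {k} t T k∈t = cong (λ β → if β then 0 else suc (row k T)) (dec-true (k ∈? t) k∈t)

row-there : ∀ {k} t T → k ∉ t → row k (t ∷ T) ≡ suc (row k T)
row-there {k} t T k∉t = cong (λ β → if β then 0 else suc (row k T)) (dec-false (k ∈? t) k∉t)

row-∉ : ∀ {k} T → k ∉ concat T → row k T ≡ length T
row-∉ []      _ = refl
row-∉ (t ∷ T) k∉ = trans (row-there t T (k∉ ∘ ∈-++⁺ˡ)) (cong suc (row-∉ T (k∉ ∘ ∈-++⁺ʳ t)))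

row-∈ : ∀ {k} T → k ∈ concat T → row k T < length T
row-∈ {k} (t ∷ T) k∈ = by (k ∈? t)
  where
  by : Dec (k ∈ t) → row k (t ∷ T) < suc (length T)
  by (yes k∈t) = subst (_< suc (length T)) (sym (row-here t T k∈t)) z<s
  by (no k∉t) with ∈-++⁻ t k∈
  ... | inj₁ k∈t = ⊥-elim (k∉t k∈t)
  ... | inj₂ k∈T = subst (_< suc (length T)) (sym (row-there t T k∉t)) (s<s (row-∈ T k∈T))

-- No row is ever created: shapes may contain zero parts, and a new row begins as an empty one. A
-- row index out of range leaves the filling unchanged, whence the hypotheses on `length T`.
insert : ℕ → ℕ → Filling → Filling
insert _       v []      = []
insert zero    v (t ∷ T) = (t ∷ʳ v) ∷ T
insert (suc i) v (t ∷ T) = t ∷ insert i v T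

insert-injective : ∀ i v {T U} → insert i v T ≡ insert i v U → T ≡ U
insert-injective i       v {[]}    {[]}    _  = refl
insert-injective zero    v {[]}    {_ ∷ _} ()
insert-injective (suc _) v {[]}    {_ ∷ _} ()
insert-injective zero    v {_ ∷ _} {[]}    ()
insert-injective (suc _) v {_ ∷ _} {[]}    ()
insert-injective zero    v {t ∷ T} {u ∷ U} eq =
  cong₂ _∷_ (∷ʳ-injectiveˡ t u (∷-injectiveˡ eq)) (∷-injectiveʳ eq)
insert-injective (suc i) v {t ∷ T} {u ∷ U} eq =
  cong₂ _∷_ (∷-injectiveˡ eq) (insert-injective i v (∷-injectiveʳ eq))

length-∷ʳ : ∀ {A : Set} (xs : List A) x → length (xs ∷ʳ x) ≡ suc (length xs)
length-∷ʳ xs x = trans (length-++ xs) (+-comm (length xs) 1)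

insert-shape : ∀ P {l L v} T → map length T ≡ P ++ l ∷ L → map length (insert (length P) v T) ≡ P ++ suc l ∷ L
insert-shape []      {v = v} (t ∷ T) refl = cong (_∷ map length T) (length-∷ʳ t v)
insert-shape (p ∷ P) (t ∷ T) eq = cong₂ _∷_ (∷-injectiveˡ eq) (insert-shape P T (∷-injectiveʳ eq))

insert-shape⁻ : ∀ P {l L v} T → length P < length T →
  map length (insert (length P) v T) ≡ P ++ suc l ∷ L → map length T ≡ P ++ l ∷ L
insert-shape⁻ []      {v = v} (t ∷ T) _ eq = cong₂ _∷_
  (suc-injective (trans (sym (length-∷ʳ t v)) (∷-injectiveˡ eq))) (∷-injectiveʳ eq)
insert-shape⁻ (p ∷ P) (t ∷ T) (s≤s lt) eq =
  cong₂ _∷_ (∷-injectiveˡ eq) (insert-shape⁻ P T lt (∷-injectiveʳ eq))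

shape-length : ∀ P {l L} (T : Filling) → map length T ≡ P ++ l ∷ L → length P < length T
shape-length P {l} {L} T eq = subst (length P <_) (trans (cong length (sym eq)) (length-map length T))
  (subst (length P <_) (sym (length-++ P)) (m<m+n (length P) z<s))

concat-insert : ∀ i v T → i < length T → concat (insert i v T) ↭ v ∷ concat T
concat-insert zero    v (t ∷ T) _        = ↭-trans (↭-reflexive (++-assoc t [ v ] (concat T))) (↭.shift v t (concat T))
concat-insert (suc i) v (t ∷ T) (s≤s lt) = ↭-trans (↭.++⁺ˡ t (concat-insert i v T lt)) (↭.shift v t (concat T))

Linked-∷ʳ : ∀ {v} t → Linked _<_ t → (∀ {k} → k ∈ t → k < v) → Linked _<_ (t ∷ʳ v)
Linked-∷ʳ []          _       _  = [-]
Linked-∷ʳ (x ∷ [])    _       lt = lt (here refl) ∷ [-]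
Linked-∷ʳ (x ∷ y ∷ t) (p ∷ l) lt = p ∷ Linked-∷ʳ (y ∷ t) l (lt ∘ there)

Linked-∷ʳ⁻ : ∀ {v} t → Linked _<_ (t ∷ʳ v) → Linked _<_ t
Linked-∷ʳ⁻ []          _       = []
Linked-∷ʳ⁻ (x ∷ [])    _       = [-]
Linked-∷ʳ⁻ (x ∷ y ∷ t) (p ∷ l) = p ∷ Linked-∷ʳ⁻ (y ∷ t) l

insert-rows : ∀ i v T → (∀ {k} → k ∈ concat T → k < v) → All (Linked _<_) T → All (Linked _<_) (insert i v T)
insert-rows i       v []      lt []       = []
insert-rows zero    v (t ∷ T) lt (l ∷ ls) = Linked-∷ʳ t l (lt ∘ ∈-++⁺ˡ) ∷ ls
insert-rows (suc i) v (t ∷ T) lt (l ∷ ls) = l ∷ insert-rows i v T (lt ∘ ∈-++⁺ʳ t) ls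

insert-rows⁻ : ∀ i v T → All (Linked _<_) (insert i v T) → All (Linked _<_) T
insert-rows⁻ i       v []      []       = []
insert-rows⁻ zero    v (t ∷ T) (l ∷ ls) = Linked-∷ʳ⁻ t l ∷ ls
insert-rows⁻ (suc i) v (t ∷ T) (l ∷ ls) = l ∷ insert-rows⁻ i v T ls

Above-∷ʳ : ∀ {v} u s → (∀ {k} → k ∈ u → k < v) → length s < length u → Above u s → Above u (s ∷ʳ v)
Above-∷ʳ (x ∷ u) []      lt _        []      = lt (here refl) ∷ []
Above-∷ʳ (x ∷ u) (y ∷ s) lt (s≤s le) (p ∷ a) = p ∷ Above-∷ʳ u s (lt ∘ there) le a

Above-∷ʳ⁻ : ∀ {v u} s → Above u (s ∷ʳ v) → Above u s
Above-∷ʳ⁻ []      _       = []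
Above-∷ʳ⁻ (y ∷ s) (p ∷ a) = p ∷ Above-∷ʳ⁻ s a

∷ʳ-Above⁻ : ∀ {v} u s → length s ≤ length u → Above (u ∷ʳ v) s → Above u s
∷ʳ-Above⁻ u       []      _        _       = []
∷ʳ-Above⁻ (x ∷ u) (y ∷ s) (s≤s le) (p ∷ a) = p ∷ ∷ʳ-Above⁻ u s le a

∷ʳ-Above-last : ∀ {v} u s → length u < length s → Above (u ∷ʳ v) s → ∃ λ k → k ∈ s × v < k
∷ʳ-Above-last []      (y ∷ s) _        (p ∷ _) = y , here refl , p
∷ʳ-Above-last (x ∷ u) (y ∷ s) (s≤s lt) (p ∷ a) with ∷ʳ-Above-last u s lt a
... | k , k∈s , v<k = k , there k∈s , v<k

length-top : ∀ T → length (top T) ≡ hd (map length T)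
length-top []      = refl
length-top (_ ∷ _) = refl

insert-columns : ∀ i v T → (∀ {k} → k ∈ concat T → k < v) → Decreasing (map length (insert i v T)) →
                 Columns T → Columns (insert i v T)
insert-columns i       v []          _  _       _       = tt
insert-columns zero    v (t ∷ T)     lt _       (a , c) = a Prefix.++ᵖ [ v ] , c
insert-columns (suc i) v (t ∷ [])    lt _       (a , c) = a , c
insert-columns (suc zero) v (t ∷ s ∷ T) lt (le , d) (a , c) =
  Above-∷ʳ t s (lt ∘ ∈-++⁺ˡ) (subst (_≤ length t) (length-∷ʳ s v) le) a ,
  insert-columns zero v (s ∷ T) (lt ∘ ∈-++⁺ʳ t) d c
insert-columns (suc (suc i)) v (t ∷ s ∷ T) lt (le , d) (a , c) =
  a , insert-columns (suc i) v (s ∷ T) (lt ∘ ∈-++⁺ʳ t) d c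

insert-columns⁻ : ∀ i v T → Decreasing (map length T) → Columns (insert i v T) → Columns T
insert-columns⁻ i       v []          _        _       = tt
insert-columns⁻ zero    v (t ∷ T)     (le , _) (a , c) =
  ∷ʳ-Above⁻ t (top T) (subst (_≤ length t) (sym (length-top T)) le) a , c
insert-columns⁻ (suc i) v (t ∷ [])    _        (a , c) = a , c
insert-columns⁻ (suc zero) v (t ∷ s ∷ T) (_ , d) (a , c) =
  Above-∷ʳ⁻ s a , insert-columns⁻ zero v (s ∷ T) d c
insert-columns⁻ (suc (suc i)) v (t ∷ s ∷ T) (_ , d) (a , c) =
  a , insert-columns⁻ (suc i) v (s ∷ T) d c

row-insert-≢ : ∀ {k} i v T → k ≢ v → row k (insert i v T) ≡ row k T
row-insert-≢ i v [] _ = refl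
row-insert-≢ {k} zero v (t ∷ T) k≢v = by (k ∈? t)
  where
  by : Dec (k ∈ t) → row k ((t ∷ʳ v) ∷ T) ≡ row k (t ∷ T)
  by (yes k∈t) = trans (row-here (t ∷ʳ v) T (∈-++⁺ˡ k∈t)) (sym (row-here t T k∈t))
  by (no k∉t)  = trans (row-there (t ∷ʳ v) T λ p → k∉t (back (∈-++⁻ t p))) (sym (row-there t T k∉t))
    where
    back : _ → k ∈ t
    back (inj₁ p)           = p
    back (inj₂ (here k≡v)) = ⊥-elim (k≢v k≡v)
row-insert-≢ {k} (suc i) v (t ∷ T) k≢v = cong (λ x → if does (k ∈? t) then 0 else suc x) (row-insert-≢ i v T k≢v)

row-insert-≡ : ∀ i v T → v ∉ concat T → i < length T → row v (insert i v T) ≡ i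
row-insert-≡ zero    v (t ∷ T) _  _        = row-here (t ∷ʳ v) T (∈-++⁺ʳ t (here refl))
row-insert-≡ (suc i) v (t ∷ T) v∉ (s≤s lt) = trans (row-there t (insert i v T) (v∉ ∘ ∈-++⁺ˡ))
  (cong suc (row-insert-≡ i v T (v∉ ∘ ∈-++⁺ʳ t) lt))

split-last : ∀ {v} t → Linked _<_ t → (∀ {k} → k ∈ t → k ≤ v) → v ∈ t → ∃ λ s → t ≡ s ∷ʳ v
split-last (x ∷ [])    _       _  (here refl) = [] , refl
split-last (x ∷ y ∷ t) (p ∷ _) le (here refl) = ⊥-elim (<⇒≱ p (le (there (here refl))))
split-last (x ∷ y ∷ t) (p ∷ l) le (there v∈)  with split-last (y ∷ t) l (le ∘ there) v∈
... | s , eq = x ∷ s , cong (x ∷_) eq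

insert-cover : ∀ {v} i T → All (Linked _<_) T → (∀ {k} → k ∈ concat T → k ≤ v) → row v T ≡ i → i < length T →
               ∃ λ U → T ≡ insert i v U × i < length U
insert-cover {v} zero (t ∷ T) (l ∷ ls) le eq _ = by (v ∈? t)
  where
  by : Dec (v ∈ t) → ∃ λ U → t ∷ T ≡ insert 0 v U × 0 < length U
  by (no v∉t)  = ⊥-elim (1+n≢0 (trans (sym (row-there t T v∉t)) eq))
  by (yes v∈t) with split-last t l (le ∘ ∈-++⁺ˡ) v∈t
  ... | s , refl = s ∷ T , refl , z<s
insert-cover {v} (suc i) (t ∷ T) (l ∷ ls) le eq (s≤s lt) = by (v ∈? t)
  where
  by : Dec (v ∈ t) → ∃ λ U → t ∷ T ≡ insert (suc i) v U × suc i < length U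
  by (yes v∈t) = ⊥-elim (1+n≢0 (trans (sym eq) (row-here t T v∈t)))
  by (no v∉t) with insert-cover i T ls (le ∘ ∈-++⁺ʳ t) (suc-injective (trans (sym (row-there t T v∉t)) eq)) lt
  ... | U , refl , lt′ = t ∷ U , refl , s<s lt′

SYT-entries-≤ : ∀ {L T k} → IsSYT L T → k ∈ concat T → k ≤ sum L
SYT-entries-≤ s k∈ = ∈[1‥]⇒≤ (∈-resp-↭ (IsSYT.entries s) k∈)

sum-mid : ∀ P l L → sum (P ++ suc l ∷ L) ≡ suc (sum (P ++ l ∷ L))
sum-mid []      l L = refl
sum-mid (p ∷ P) l L = trans (cong (p +_) (sum-mid P l L)) (+-suc p _)

module _ (P : List ℕ) (l : ℕ) (L : List ℕ)
         (outer : Decreasing (P ++ suc l ∷ L)) (inner : Decreasing (P ++ l ∷ L)) where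

  private
    i n : ℕ
    i = length P
    n = sum (P ++ l ∷ L)

  insert-SYT : ∀ {T} → IsSYT (P ++ l ∷ L) T → IsSYT (P ++ suc l ∷ L) (insert i (suc n) T)
  insert-SYT {T} s = isSYT
    shape′
    (subst (λ m → concat (insert i (suc n) T) ↭ [1‥ m ]) (sym (sum-mid P l L))
      (↭-trans (concat-insert i (suc n) T (shape-length P T (IsSYT.shape s)))
      (↭-trans (↭.prep (suc n) (IsSYT.entries s)) (↭-sym ([1‥]-suc n)))))
    (insert-rows i (suc n) T small (IsSYT.rowsIncreasing s))
    (Columns⇒Linked _ (insert-columns i (suc n) T small (subst Decreasing (sym shape′) outer)
      (Linked⇒Columns (IsSYT.columnsIncreasing s))))
    where
    shape′ : map length (insert i (suc n) T) ≡ P ++ suc l ∷ L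
    shape′ = insert-shape P T (IsSYT.shape s)
    small : ∀ {k} → k ∈ concat T → k < suc n
    small = s≤s ∘ SYT-entries-≤ s

  insert-SYT⁻ : ∀ {T} → i < length T → IsSYT (P ++ suc l ∷ L) (insert i (suc n) T) → IsSYT (P ++ l ∷ L) T
  insert-SYT⁻ {T} lt s = isSYT
    shape′
    (drop-∷ (↭-trans (↭-sym (concat-insert i (suc n) T lt)) (↭-trans
      (subst (λ m → concat (insert i (suc n) T) ↭ [1‥ m ]) (sum-mid P l L) (IsSYT.entries s))
      ([1‥]-suc n))))
    (insert-rows⁻ i (suc n) T (IsSYT.rowsIncreasing s))
    (Columns⇒Linked T (insert-columns⁻ i (suc n) T (subst Decreasing (sym shape′) inner)
      (Linked⇒Columns (IsSYT.columnsIncreasing s))))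
    where
    shape′ : map length T ≡ P ++ l ∷ L
    shape′ = insert-shape⁻ P T lt (IsSYT.shape s)

  row-max : ∀ {T} → IsSYT (P ++ l ∷ L) T → row (suc n) (insert i (suc n) T) ≡ i
  row-max {T} s = row-insert-≡ i (suc n) T (λ p → <-irrefl refl (SYT-entries-≤ s p))
                               (shape-length P T (IsSYT.shape s))

  -- As both shapes are decreasing, the last box of row `i` is a removable corner; deleting the
  -- largest entry from it is a bijection.
  SYT-by-row : filter (λ T → row (suc n) T ≟ i) (SYT (P ++ suc l ∷ L)) ↭ map (insert i (suc n)) (SYT (P ++ l ∷ L))
  SYT-by-row = unique∧⊆⊇⇒↭ 
    (Unique.filter⁺ row? (SYT-unique (P ++ suc l ∷ L)))
    (Unique.map⁺ (insert-injective i (suc n)) (SYT-unique (P ++ l ∷ L))) to from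
    where
    row? : Decidable (λ T → row (suc n) T ≡ i)
    row? T = row (suc n) T ≟ i
    to : filter row? (SYT (P ++ suc l ∷ L)) ⊆ map (insert i (suc n)) (SYT (P ++ l ∷ L))
    to {T} T∈ with ∈-filter⁻ row? {xs = SYT (P ++ suc l ∷ L)} T∈
    ... | T∈SYT , r with Equivalence.to (∈-SYT {P ++ suc l ∷ L}) T∈SYT
    ...   | s with insert-cover i T (IsSYT.rowsIncreasing s) (λ p → subst (_ ≤_) (sum-mid P l L) (SYT-entries-≤ s p))
                                r (shape-length P T (IsSYT.shape s))
    ...     | U , refl , lt = ∈-map⁺ (insert i (suc n)) (Equivalence.from (∈-SYT {P ++ l ∷ L}) (insert-SYT⁻ lt s))
    from : map (insert i (suc n)) (SYT (P ++ l ∷ L)) ⊆ filter row? (SYT (P ++ suc l ∷ L))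
    from p with ∈-map⁻ (insert i (suc n)) p
    ... | T , T∈ , refl = ∈-filter⁺ row? (Equivalence.from (∈-SYT {P ++ suc l ∷ L}) (insert-SYT (Equivalence.to (∈-SYT {P ++ l ∷ L}) T∈)))
                                         (row-max (Equivalence.to (∈-SYT {P ++ l ∷ L}) T∈))

-- A row no longer than the next has a box below its last one, and the entry there would exceed the
-- maximum.
row-max-≢ : ∀ P l L → l ≤ hd L → ∀ {T} → IsSYT (P ++ l ∷ L) T → row (sum (P ++ l ∷ L)) T ≢ length P
row-max-≢ P l L l≤ {T} s r with insert-cover (length P) T (IsSYT.rowsIncreasing s) (SYT-entries-≤ s)
                                             r (shape-length P T (IsSYT.shape s))
... | U , refl , lt with go P U lt (IsSYT.shape s) (Linked⇒Columns (IsSYT.columnsIncreasing s))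
  where
  v : ℕ
  v = sum (P ++ l ∷ L)
  top⊆ : ∀ T {k} → k ∈ top T → k ∈ concat T
  top⊆ (_ ∷ _) = ∈-++⁺ˡ
  go : ∀ Q U → length Q < length U → map length (insert (length Q) v U) ≡ Q ++ l ∷ L →
       Columns (insert (length Q) v U) → ∃ λ k → k ∈ concat (insert (length Q) v U) × v < k
  go []      (u ∷ U) _ eq (a , _) with ∷ʳ-Above-last u (top U)
    (≤-trans (≤-reflexive (trans (sym (length-∷ʳ u v)) (∷-injectiveˡ eq)))
      (subst (l ≤_) (trans (cong hd (sym (∷-injectiveʳ eq))) (sym (length-top U))) l≤)) a
  ... | k , k∈ , v<k = k , ∈-++⁺ʳ (u ∷ʳ v) (top⊆ U k∈) , v<k
  go (q ∷ Q) (u ∷ U) (s≤s lt) eq (_ , c) with go Q U lt (∷-injectiveʳ eq) c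
  ... | k , k∈ , v<k = k , ∈-++⁺ʳ u k∈ , v<k
...   | k , k∈ , v<k = <⇒≱ v<k (SYT-entries-≤ s k∈)

-- Descents under insertion.

des : Filling → ℕ
des T = length (Des T)

length-concat : ∀ {L T} → IsSYT L T → length (concat T) ≡ sum L
length-concat {L} s = trans (↭-length (IsSYT.entries s)) (length-applyUpTo suc (sum L))

des-by : ∀ {L T} → IsSYT L T → des T ≡ Σᴸ (λ j → ⟦ row j T <? row (suc j) T ⟧) [1‥ sum L ∸ 1 ]
des-by {L} {T} s = trans (length-filter≡Σᴸ (λ j → row j T <? row (suc j) T) [1‥ length (concat T) ∸ 1 ])
  (cong (λ n → Σᴸ (λ j → ⟦ row j T <? row (suc j) T ⟧) [1‥ n ∸ 1 ]) (length-concat s))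

module _ (P : List ℕ) (l : ℕ) (L : List ℕ)
         (outer : Decreasing (P ++ suc l ∷ L)) (inner : Decreasing (P ++ l ∷ L)) where

  private
    i n : ℕ
    i = length P
    n = sum (P ++ l ∷ L)

  -- Entries up to n keep their rows, so only the comparison of n with n + 1 is new.
  des-insert : ∀ {T} → IsSYT (P ++ l ∷ L) T → des (insert i (suc n) T) ≡ des T + ⟦ row n T <? i ⟧
  des-insert {T} s = trans
    (trans (des-by (insert-SYT P l L outer inner s))
           (cong (λ m → Σᴸ (λ j → ⟦ row j U <? row (suc j) U ⟧) [1‥ m ∸ 1 ]) (sum-mid P l L)))
    (trans (by n refl) (cong (_+ ⟦ row n T <? i ⟧) (sym (des-by s))))
    where
    U : Filling
    U = insert i (suc n) T
    by : ∀ m → m ≡ n → Σᴸ (λ j → ⟦ row j U <? row (suc j) U ⟧) [1‥ m ] ≡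
         Σᴸ (λ j → ⟦ row j T <? row (suc j) T ⟧) [1‥ m ∸ 1 ] + ⟦ row m T <? i ⟧
    -- For n = 0 there is no previous entry; `row 0 T` takes its default value `length T`, which
    -- exceeds `i`, so no descent is counted.
    by zero    eq = sym (⟦⟧-no (row 0 T <? i) λ lt → <⇒≱ (shape-length P T (IsSYT.shape s))
      (<⇒≤ (subst (_< i) (row-∉ T absent) lt)))
      where
      absent : 0 ∉ concat T
      absent p with ∈-applyUpTo⁻ suc (∈-resp-↭ (IsSYT.entries s) p)
      ... | _ , _ , ()
    by (suc m) eq = begin
      Σᴸ (λ j → ⟦ row j U <? row (suc j) U ⟧) [1‥ suc m ]
        ≡⟨ cong (Σᴸ _) (applyUpTo-∷ʳ suc m) ⟨
      Σᴸ (λ j → ⟦ row j U <? row (suc j) U ⟧) ([1‥ m ] ∷ʳ suc m)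
        ≡⟨ trans (Σᴸ-++ _ [1‥ m ] [ suc m ]) (cong (Σᴸ (λ j → ⟦ row j U <? row (suc j) U ⟧) [1‥ m ] +_) (+-identityʳ _)) ⟩
      Σᴸ (λ j → ⟦ row j U <? row (suc j) U ⟧) [1‥ m ] + ⟦ row (suc m) U <? row (2 + m) U ⟧
        ≡⟨ cong₂ _+_
             (Σᴸ-cong∈ [1‥ m ] λ j j∈ → cong₂ (λ x y → ⟦ x <? y ⟧)
               (row-insert-≢ i (suc n) T (small (m≤n⇒m≤1+n (∈[1‥]⇒≤ j∈))))
               (row-insert-≢ i (suc n) T (small (s≤s (∈[1‥]⇒≤ j∈)))))
             (cong₂ (λ x y → ⟦ x <? y ⟧)
               (row-insert-≢ i (suc n) T (small ≤-refl))
               (trans (cong (λ k → row (suc k) U) eq) (row-max P l L outer inner s))) ⟩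
      Σᴸ (λ j → ⟦ row j T <? row (suc j) T ⟧) [1‥ m ] + ⟦ row (suc m) T <? i ⟧ ∎
      where
      open ≡-Reasoning
      small : ∀ {k} → k ≤ suc m → k ≢ suc n
      small k≤ refl = <-irrefl refl (≤-trans k≤ (≤-reflexive eq))

-- The number of T of shape L such that T, followed by one more box in row i,
-- has e descents.

A : List ℕ → ℕ → ℕ → ℕ
A L i e = Σᴸ (λ T → ⟦ des T + ⟦ row (sum L) T <? i ⟧ ≟ e ⟧) (SYT L)

t-δ : ∀ d e → t (λ e → ⟦ d ≟ e ⟧) e ≡ ⟦ suc d ≟ e ⟧
t-δ d zero    = refl
t-δ d (suc e) = ⟦⟧-cong (d ≟ e) (suc d ≟ suc e) (cong suc) suc-injective

t-Σᴸ : ∀ {B : Set} (g : B → ℕ → ℕ) xs e → Σᴸ (λ x → t (g x) e) xs ≡ t (λ e → Σᴸ (λ x → g x e) xs) e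
t-Σᴸ g xs (suc e) = refl
t-Σᴸ g []       zero = refl
t-Σᴸ g (x ∷ xs) zero = t-Σᴸ g xs zero

S^-Σᴸ : ∀ {B : Set} m (g : B → ℕ → ℕ) xs k → S^ m (λ e → Σᴸ (λ x → g x e) xs) k ≡ Σᴸ (λ x → S^ m (g x) k) xs
S^-Σᴸ m g []       k = S^-0 m k
S^-Σᴸ m g (x ∷ xs) k = trans (S^-+ m (g x) _ k) (cong (S^ m (g x) k +_) (S^-Σᴸ m g xs k))

-- Moving the extra box from row i to row i + 1 matters only if the largest entry lies in row i, and
-- then creates one descent. Such tableaux are those of the inner shape with a box added in row i.
A-corner : ∀ P l L → Decreasing (P ++ suc l ∷ L) → Decreasing (P ++ l ∷ L) → ∀ e →
  A (P ++ suc l ∷ L) (length P) e + t (A (P ++ l ∷ L) (length P)) e ≡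
  A (P ++ suc l ∷ L) (suc (length P)) e + A (P ++ l ∷ L) (length P) e
A-corner P l L outer inner e = begin
  A (P ++ suc l ∷ L) i e + t (A (P ++ l ∷ L) i) e
    ≡⟨ cong₂ _+_ (cong (λ m → Σᴸ (λ T → ⟦ des T + ⟦ row m T <? i ⟧ ≟ e ⟧) Ts) (sum-mid P l L))
                 (trans (sym (t-Σᴸ (λ T e → ⟦ des T + ⟦ row n T <? i ⟧ ≟ e ⟧) Ts′ e)) (sym (transfer (λ d → t (λ e → ⟦ d ≟ e ⟧) e)))) ⟩
  Σᴸ (λ T → ⟦ des T + ⟦ row (suc n) T <? i ⟧ ≟ e ⟧) Ts +
  Σᴸ (λ T → ⟦ row (suc n) T ≟ i ⟧ * t (λ e → ⟦ des T ≟ e ⟧) e) Ts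
    ≡⟨ Σᴸ-+ (λ T → ⟦ des T + ⟦ row (suc n) T <? i ⟧ ≟ e ⟧) _ Ts ⟨
  Σᴸ (λ T → ⟦ des T + ⟦ row (suc n) T <? i ⟧ ≟ e ⟧ + ⟦ row (suc n) T ≟ i ⟧ * t (λ e → ⟦ des T ≟ e ⟧) e) Ts
    ≡⟨ Σᴸ-cong∈ Ts (λ T _ → pointwise (des T) (row (suc n) T)) ⟩
  Σᴸ (λ T → ⟦ des T + ⟦ row (suc n) T <? suc i ⟧ ≟ e ⟧ + ⟦ row (suc n) T ≟ i ⟧ * ⟦ des T ≟ e ⟧) Ts
    ≡⟨ Σᴸ-+ (λ T → ⟦ des T + ⟦ row (suc n) T <? suc i ⟧ ≟ e ⟧) _ Ts ⟩
  Σᴸ (λ T → ⟦ des T + ⟦ row (suc n) T <? suc i ⟧ ≟ e ⟧) Ts +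
  Σᴸ (λ T → ⟦ row (suc n) T ≟ i ⟧ * ⟦ des T ≟ e ⟧) Ts
    ≡⟨ cong₂ _+_ (cong (λ m → Σᴸ (λ T → ⟦ des T + ⟦ row m T <? suc i ⟧ ≟ e ⟧) Ts) (sym (sum-mid P l L)))
                 (transfer (λ d → ⟦ d ≟ e ⟧)) ⟩
  A (P ++ suc l ∷ L) (suc i) e + A (P ++ l ∷ L) i e ∎
  where
  open ≡-Reasoning
  i n : ℕ
  i = length P
  n = sum (P ++ l ∷ L)
  Ts Ts′ : List Filling
  Ts  = SYT (P ++ suc l ∷ L)
  Ts′ = SYT (P ++ l ∷ L)
  transfer : ∀ (u : ℕ → ℕ) → Σᴸ (λ T → ⟦ row (suc n) T ≟ i ⟧ * u (des T)) Ts ≡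
                              Σᴸ (λ T → u (des T + ⟦ row n T <? i ⟧)) Ts′
  transfer u = begin
    Σᴸ (λ T → ⟦ row (suc n) T ≟ i ⟧ * u (des T)) Ts
      ≡⟨ Σᴸ-filter (λ T → row (suc n) T ≟ i) (u ∘ des) Ts ⟨
    Σᴸ (u ∘ des) (filter (λ T → row (suc n) T ≟ i) Ts)
      ≡⟨ Σᴸ-↭ (u ∘ des) (SYT-by-row P l L outer inner) ⟩
    Σᴸ (u ∘ des) (map (insert i (suc n)) Ts′)
      ≡⟨ Σᴸ-map (u ∘ des) (insert i (suc n)) Ts′ ⟩
    Σᴸ (u ∘ des ∘ insert i (suc n)) Ts′
      ≡⟨ Σᴸ-cong∈ Ts′ (λ T T∈ → cong u (des-insert P l L outer inner (Equivalence.to (∈-SYT {P ++ l ∷ L}) T∈))) ⟩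
    Σᴸ (λ T → u (des T + ⟦ row n T <? i ⟧)) Ts′ ∎
  pointwise : ∀ d r → ⟦ d + ⟦ r <? i ⟧ ≟ e ⟧ + ⟦ r ≟ i ⟧ * t (λ e → ⟦ d ≟ e ⟧) e ≡
                      ⟦ d + ⟦ r <? suc i ⟧ ≟ e ⟧ + ⟦ r ≟ i ⟧ * ⟦ d ≟ e ⟧
  pointwise d r with <-cmp r i
  ... | tri< r<i r≢i _ rewrite ⟦⟧-yes (r <? i) r<i | ⟦⟧-yes (r <? suc i) (m≤n⇒m≤1+n r<i) | ⟦⟧-no (r ≟ i) r≢i = refl
  ... | tri> r≮i r≢i i<r rewrite ⟦⟧-no (r <? i) r≮i | ⟦⟧-no (r <? suc i) (<⇒≱ (s≤s i<r)) | ⟦⟧-no (r ≟ i) r≢i = refl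
  ... | tri≈ r≮i refl _ rewrite ⟦⟧-no (r <? r) r≮i | ⟦⟧-yes (r <? suc r) ≤-refl | ⟦⟧-yes (r ≟ r) refl
        | t-δ d e | +-identityʳ d | +-comm d 1 = lemma ⟦ d ≟ e ⟧ ⟦ suc d ≟ e ⟧
    where
    lemma : ∀ a b → a + 1 * b ≡ b + 1 * a
    lemma = solve-∀

A-flat : ∀ P l L → l ≤ hd L → ∀ e → A (P ++ l ∷ L) (length P) e ≡ A (P ++ l ∷ L) (suc (length P)) e
A-flat P l L l≤ e = Σᴸ-cong∈ (SYT (P ++ l ∷ L)) λ T T∈ → cong (λ x → ⟦ des T + x ≟ e ⟧)
  (⟦⟧-cong (row n T <? length P) (row n T <? suc (length P)) m≤n⇒m≤1+n
    λ lt → ≤∧≢⇒< (s≤s⁻¹ lt) (row-max-≢ P l L l≤ (Equivalence.to (∈-SYT {P ++ l ∷ L}) T∈)))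
  where
  n : ℕ
  n = sum (P ++ l ∷ L)

G : List ℕ → ℕ → ℕ → ℕ
G L i = S^ (suc (sum L)) (A L i)

-- As power series, `A-corner` reads A₀ - A₁ = (1 - t) A′. The factor 1 - t undoes one `S`, and the
-- inner shape is one box smaller, so each term carries the power of `S` that its own size
-- prescribes.
G-corner : ∀ P l L → Decreasing (P ++ suc l ∷ L) → Decreasing (P ++ l ∷ L) → ∀ k →
  G (P ++ suc l ∷ L) (length P) k ≡ G (P ++ suc l ∷ L) (suc (length P)) k + G (P ++ l ∷ L) (length P) k
G-corner P l L outer inner k = trans (by (cong suc (sum-mid P l L)) A₀) (trans (+-cancelʳ-≡ (t (S^ (suc m) A′) k) _ _ (begin
  S^ (suc m) A₀ k + t (S^ (suc m) A′) k
    ≡⟨ cong (S^ (suc m) A₀ k +_) (S^-t (suc m) A′ k) ⟨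
  S^ (suc m) A₀ k + S^ (suc m) (t A′) k
    ≡⟨ S^-+ (suc m) A₀ (t A′) k ⟨
  S^ (suc m) (λ e → A₀ e + t A′ e) k
    ≡⟨ S^-cong (suc m) (A-corner P l L outer inner) k ⟩
  S^ (suc m) (λ e → A₁ e + A′ e) k
    ≡⟨ S^-+ (suc m) A₁ A′ k ⟩
  S^ (suc m) A₁ k + S^ (suc m) A′ k
    ≡⟨ cong (S^ (suc m) A₁ k +_) (S-unfold (S^ m A′) k) ⟩
  S^ (suc m) A₁ k + (S^ m A′ k + t (S^ (suc m) A′) k)
    ≡⟨ +-assoc (S^ (suc m) A₁ k) _ _ ⟨
  S^ (suc m) A₁ k + S^ m A′ k + t (S^ (suc m) A′) k ∎))
  (cong (_+ S^ m A′ k) (sym (by (cong suc (sum-mid P l L)) A₁))))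
  where
  by : ∀ {a b} → a ≡ b → ∀ u → S^ a u k ≡ S^ b u k
  by eq u = cong (λ m → S^ m u k) eq
  open ≡-Reasoning
  m : ℕ
  m = suc (sum (P ++ l ∷ L))
  A₀ A₁ A′ : ℕ → ℕ
  A₀ = A (P ++ suc l ∷ L) (length P)
  A₁ = A (P ++ suc l ∷ L) (suc (length P))
  A′ = A (P ++ l ∷ L) (length P)

-- Corners are taken from one row until it is as long as the next; then `A-flat` moves the extra box
-- down without cost.
G-row : ∀ P l L → Decreasing (P ++ l ∷ L) → hd L ≤ l → ∀ k →
        G (P ++ l ∷ L) (length P) k ≡ ∑ (hd L) l λ x → G (P ++ x ∷ L) (suc (length P)) k
G-row P l L d hd≤l k with m≤n⇒m<n∨m≡n hd≤l
... | inj₂ refl = trans (S^-cong (suc (sum (P ++ l ∷ L))) (A-flat P l L ≤-refl) k)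
                        (sym (∑-single l λ x → G (P ++ x ∷ L) (suc (length P)) k))
G-row P (suc l) L d hd≤l k | inj₁ (s≤s hd≤) = begin
  G (P ++ suc l ∷ L) (length P) k
    ≡⟨ G-corner P l L d inner k ⟩
  g (suc l) + G (P ++ l ∷ L) (length P) k
    ≡⟨ cong (g (suc l) +_) (G-row P l L inner hd≤ k) ⟩
  g (suc l) + ∑ (hd L) l g
    ≡⟨ +-comm (g (suc l)) _ ⟩
  ∑ (hd L) l g + g (suc l)
    ≡⟨ ∑-suc g hd≤l ⟨
  ∑ (hd L) (suc l) g ∎
  where
  open ≡-Reasoning
  g : ℕ → ℕ
  g x = G (P ++ x ∷ L) (suc (length P)) k
  inner : Decreasing (P ++ l ∷ L)
  inner = Decreasing-lower P d hd≤ (n≤1+n l)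

Decreasing-hd : ∀ P {l L} → Decreasing (P ++ l ∷ L) → hd L ≤ l
Decreasing-hd []      (p , _) = p
Decreasing-hd (_ ∷ P) (_ , d) = Decreasing-hd P d

-- Rows are shortened from the top, so each is bounded below by the next row before that one
-- shrinks: exactly the interlacing condition.
G-rows : ∀ P L → Decreasing (P ++ L) → ∀ k →
         G (P ++ L) (length P) k ≡ down (λ M → G (P ++ M) (length (P ++ M)) k) L
G-rows P []      _ k = cong (λ Q → G (P ++ []) (length Q) k) (sym (++-identityʳ P))
G-rows P (l ∷ L) d k = trans (G-row P l L d (Decreasing-hd P d) k)
  (∑-cong (hd L) l λ x p q → begin
    G (P ++ x ∷ L) (suc (length P)) k
      ≡⟨ cong₂ (λ Q m → G Q m k) (sym (++-assoc P [ x ] L)) (sym (length-∷ʳ P x)) ⟩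
    G ((P ∷ʳ x) ++ L) (length (P ∷ʳ x)) k
      ≡⟨ G-rows (P ∷ʳ x) L (subst Decreasing (sym (++-assoc P [ x ] L)) (Decreasing-lower P d p q)) k ⟩
    down (λ M → G ((P ∷ʳ x) ++ M) (length ((P ∷ʳ x) ++ M)) k) L
      ≡⟨ down-cong (λ M → cong (λ Q → G Q (length Q) k) (++-assoc P [ x ] M)) L ⟩
    down (λ M → G (P ++ x ∷ M) (length (P ++ x ∷ M)) k) L ∎)
  where open ≡-Reasoning

-- Descent numbers and semistandard tableaux.

descents : List ℕ → ℕ → ℕ
descents L e = Σᴸ (λ T → ⟦ des T ≟ e ⟧) (SYT L)

A-0 : ∀ L e → A L 0 e ≡ descents L e
A-0 L e = Σᴸ-cong∈ (SYT L) λ T _ → cong (λ x → ⟦ x ≟ e ⟧) (trans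
  (cong (des T +_) (⟦⟧-no (row (sum L) T <? 0) λ ())) (+-identityʳ (des T)))

-- A box below all rows always makes a descent, provided there is a largest entry to compare with;
-- the empty shape is left to `A-zero`.
A-positive : ∀ L e → 0 < sum L → A L (length L) e ≡ t (descents L) e
A-positive L e pos = trans (Σᴸ-cong∈ (SYT L) λ T T∈ → term T (Equivalence.to (∈-SYT {L}) T∈))
                           (t-Σᴸ (λ T e → ⟦ des T ≟ e ⟧) (SYT L) e)
  where
  max∈ : ∀ n → 0 < n → n ∈ [1‥ n ]
  max∈ (suc n) _ = ∈-applyUpTo⁺ suc ≤-refl
  term : ∀ T → IsSYT L T → ⟦ des T + ⟦ row (sum L) T <? length L ⟧ ≟ e ⟧ ≡ t (λ e → ⟦ des T ≟ e ⟧) e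
  term T s = trans
    (cong (λ x → ⟦ x ≟ e ⟧) (trans
      (cong (des T +_) (⟦⟧-yes (row (sum L) T <? length L) (subst (row (sum L) T <_)
        (trans (sym (length-map length T)) (cong length (IsSYT.shape s)))
        (row-∈ T (∈-resp-↭ (↭-sym (IsSYT.entries s)) (max∈ (sum L) pos))))))
      (+-comm (des T) 1)))
    (sym (t-δ (des T) e))

concat-empty : ∀ (L : List ℕ) → concat (map (λ _ → []) L) ≡ ([] {A = ℕ})
concat-empty []      = refl
concat-empty (_ ∷ L) = concat-empty L

SYT-zero : ∀ L → sum L ≡ 0 → SYT L ↭ [ map (λ _ → []) L ]
SYT-zero L L≡0 = unique∧⊆⊇⇒↭ (SYT-unique L) ([] ∷ []) to from
  where
  empty : ∀ L T → sum L ≡ 0 → map length T ≡ L → T ≡ map (λ _ → []) L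
  empty []         []       _ _  = refl
  empty (zero ∷ L) ([] ∷ T) z eq = cong ([] ∷_) (empty L T z (∷-injectiveʳ eq))
  to : SYT L ⊆ [ map (λ _ → []) L ]
  to {T} T∈ = here (empty L T L≡0 (IsSYT.shape (Equivalence.to (∈-SYT {L}) T∈)))
  shape : ∀ L → sum L ≡ 0 → map length (map (λ _ → []) L) ≡ L
  shape []         _ = refl
  shape (zero ∷ L) z = cong (0 ∷_) (shape L z)
  rows : ∀ (L : List ℕ) → All (Linked _<_) (map (λ _ → []) L)
  rows []      = []
  rows (_ ∷ L) = [] ∷ rows L
  columns : ∀ (L : List ℕ) → Linked Above (map (λ _ → []) L)
  columns []          = []
  columns (_ ∷ [])    = [-]
  columns (_ ∷ l ∷ L) = [] ∷ columns (l ∷ L)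
  from : [ map (λ _ → []) L ] ⊆ SYT L
  from (here refl) = Equivalence.from (∈-SYT {L}) (isSYT (shape L L≡0)
    (↭-reflexive (trans (concat-empty L) (sym (cong [1‥_] L≡0)))) (rows L) (columns L))

descents-zero : ∀ L → sum L ≡ 0 → ∀ e → descents L e ≡ ⟦ 0 ≟ e ⟧
descents-zero L L≡0 e = trans (Σᴸ-↭ (λ T → ⟦ des T ≟ e ⟧) (SYT-zero L L≡0))
  (trans (+-identityʳ _) (cong (λ x → ⟦ x ≟ e ⟧) (noDescents L)))
  where
  noDescents : ∀ (L : List ℕ) → des (map (λ _ → []) L) ≡ 0
  noDescents L = cong (λ xs → length (filter (λ j → row j T <? row (suc j) T) [1‥ length xs ∸ 1 ])) (concat-empty L)
    where
    T : Filling
    T = map (λ _ → []) L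

A-zero : ∀ L → sum L ≡ 0 → ∀ e → A L (length L) e ≡ ⟦ 0 ≟ e ⟧
A-zero L L≡0 e = trans (Σᴸ-cong∈ (SYT L) λ T T∈ → term T (Equivalence.to (∈-SYT {L}) T∈)) (descents-zero L L≡0 e)
  where
  term : ∀ T → IsSYT L T → ⟦ des T + ⟦ row (sum L) T <? length L ⟧ ≟ e ⟧ ≡ ⟦ des T ≟ e ⟧
  term T s = cong (λ x → ⟦ x ≟ e ⟧) (trans
    (cong (des T +_) (⟦⟧-no (row (sum L) T <? length L) (<-irrefl (trans
      (row-∉ T λ p → absent (SYT-entries-≤ s p) (∈-resp-↭ (IsSYT.entries s) p))
      (trans (sym (length-map length T)) (cong length (IsSYT.shape s)))))))
    (+-identityʳ (des T)))
    where
    absent : ∀ {k} → k ≤ sum L → k ∈ [1‥ sum L ] → ⊥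
    absent _ k∈ rewrite L≡0 with k∈
    ... | ()

-- The extra box starts in row 0 without a descent and ends below `M` with one. That descent is a
-- factor t, which lowers k by one: the removed strip holds the largest letter, and `M` is filled
-- with one letter fewer.
S^-descents : ∀ k L → Decreasing L → S^ (suc (sum L)) (descents L) k ≡ ssyt (suc k) L
S^-descents k L d = trans (sym (S^-cong (suc (sum L)) (A-0 L) k)) (trans (G-rows [] L d k)
  (down-cong≺ L λ M i → last k M (≺⇒Decreasing i)))
  where
  open ≡-Reasoning
  last : ∀ k M → Decreasing M → G M (length M) k ≡ ssyt k M
  last k M d with sum M ≟ 0
  last zero M d | yes M≡0 = trans (S^-at-0 (suc (sum M)) (A M (length M)))
    (trans (A-zero M M≡0 0) (sym (⟦⟧-yes (sum M ≟ 0) M≡0)))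
  -- Here the factor t is missing, but the partial sums of the unit sequence are constant, so k may
  -- be lowered all the same.
  last (suc k) M d | yes M≡0 = begin
    S^ (suc (sum M)) (A M (length M)) (suc k)
      ≡⟨ S^-cong (suc (sum M)) (A-zero M M≡0) (suc k) ⟩
    S^ (suc (sum M)) (λ e → ⟦ 0 ≟ e ⟧) (suc k)
      ≡⟨ cong (λ m → S^ (suc m) (λ e → ⟦ 0 ≟ e ⟧) (suc k)) M≡0 ⟩
    S (λ e → ⟦ 0 ≟ e ⟧) k + 0
      ≡⟨ +-identityʳ _ ⟩
    S (λ e → ⟦ 0 ≟ e ⟧) k
      ≡⟨ cong (λ m → S^ (suc m) (λ e → ⟦ 0 ≟ e ⟧) k) M≡0 ⟨
    S^ (suc (sum M)) (λ e → ⟦ 0 ≟ e ⟧) k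
      ≡⟨ S^-cong (suc (sum M)) (descents-zero M M≡0) k ⟨
    S^ (suc (sum M)) (descents M) k
      ≡⟨ S^-descents k M d ⟩
    ssyt (suc k) M ∎
  last zero M d | no M≢0 = trans (S^-at-0 (suc (sum M)) (A M (length M)))
    (trans (A-positive M 0 (n≢0⇒n>0 M≢0)) (sym (⟦⟧-no (sum M ≟ 0) M≢0)))
  last (suc k) M d | no M≢0 = begin
    S^ (suc (sum M)) (A M (length M)) (suc k)
      ≡⟨ S^-cong (suc (sum M)) (λ e → A-positive M e (n≢0⇒n>0 M≢0)) (suc k) ⟩
    S^ (suc (sum M)) (t (descents M)) (suc k)
      ≡⟨ S^-t (suc (sum M)) (descents M) (suc k) ⟩
    S^ (suc (sum M)) (descents M) k
      ≡⟨ S^-descents k M d ⟩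
    ssyt (suc k) M ∎

-- Horizontal strips as interlacing

at : List ℕ → ℕ → ℕ
at []      _       = 0
at (l ∷ _) zero    = l
at (_ ∷ L) (suc k) = at L k

∈-cellsFrom⁺ : ∀ i L k {j} → j < at L k → (i + k , j) ∈ cellsFrom i L
∈-cellsFrom⁺ i (l ∷ L) zero    {j} j<l = ∈-++⁺ˡ (subst (λ x → (x , j) ∈ map (i ,_) (upTo l))
  (sym (+-identityʳ i)) (∈-map⁺ (i ,_) (∈-upTo⁺ j<l)))
∈-cellsFrom⁺ i (l ∷ L) (suc k) {j} j< = ∈-++⁺ʳ (map (i ,_) (upTo l))
  (subst (λ x → (x , j) ∈ cellsFrom (suc i) L) (sym (+-suc i k)) (∈-cellsFrom⁺ (suc i) L k j<))

∈-cellsFrom⁻ : ∀ i L {c} → c ∈ cellsFrom i L → ∃ λ k → proj₁ c ≡ i + k × proj₂ c < at L k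
∈-cellsFrom⁻ i (l ∷ L) p with ∈-++⁻ (map (i ,_) (upTo l)) p
... | inj₁ q with ∈-map⁻ (i ,_) q
...   | _ , j∈ , refl = 0 , sym (+-identityʳ i) , ∈-upTo⁻ j∈
∈-cellsFrom⁻ i (l ∷ L) p | inj₂ q with ∈-cellsFrom⁻ (suc i) L q
...   | k , eq , j< = suc k , trans eq (sym (+-suc i k)) , j<

∈-cells⁺ : ∀ L k {j} → j < at L k → (k , j) ∈ cells L
∈-cells⁺ = ∈-cellsFrom⁺ 0

∈-cells⁻ : ∀ L {k j} → (k , j) ∈ cells L → j < at L k
∈-cells⁻ L p with ∈-cellsFrom⁻ 0 L p
... | _ , refl , j< = j<

cellsFrom-unique : ∀ i L → Unique (cellsFrom i L)
cellsFrom-unique i []      = []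
cellsFrom-unique i (l ∷ L) = Unique.++⁺
  (Unique.map⁺ (cong proj₂) (Unique.upTo⁺ l)) (cellsFrom-unique (suc i) L) disjoint
  where
  disjoint : ∀ {c} → ¬ (c ∈ map (i ,_) (upTo l) × c ∈ cellsFrom (suc i) L)
  disjoint (p , q) with ∈-map⁻ (i ,_) p | ∈-cellsFrom⁻ (suc i) L q
  ... | _ , _ , refl | k , eq , _ = m≢1+m+n i eq

unique-map⁺ : ∀ {A B : Set} {g : A → B} xs → (∀ {x y} → x ∈ xs → y ∈ xs → g x ≡ g y → x ≡ y) →
              Unique xs → Unique (map g xs)
unique-map⁺ []       _   []      = []
unique-map⁺ (x ∷ xs) inj (p ∷ u) =
  All.map⁺ (All.tabulate λ y∈ eq → All.lookup p y∈ (inj (here refl) (there y∈) eq)) ∷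
  unique-map⁺ xs (λ p q → inj (there p) (there q)) u

unique-map⁻ : ∀ {A B : Set} {g : A → B} {xs x y} → Unique (map g xs) → x ∈ xs → y ∈ xs → g x ≡ g y → x ≡ y
unique-map⁻ (p ∷ u) (here refl) (here refl) _  = refl
unique-map⁻ (p ∷ u) (here refl) (there y∈)  eq = ⊥-elim (All.lookup (All.map⁻ p) y∈ eq)
unique-map⁻ (p ∷ u) (there x∈)  (here refl) eq = ⊥-elim (All.lookup (All.map⁻ p) x∈ (sym eq))
unique-map⁻ (p ∷ u) (there x∈)  (there y∈)  eq = unique-map⁻ u x∈ y∈ eq

at-suc : ∀ {L} k → Decreasing L → at L (suc k) ≤ at L k
at-suc {[]}        _       _       = z≤n
at-suc {_ ∷ []}    _       _       = z≤n
at-suc {_ ∷ _ ∷ _} zero    (p , _) = p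
at-suc {_ ∷ _ ∷ _} (suc k) (_ , d) = at-suc k d

at-antitone : ∀ {L i k} → Decreasing L → i ≤ k → at L k ≤ at L i
at-antitone {L} {i} d i≤k = go (≤⇒≤′ i≤k)
  where
  go : ∀ {k} → i ≤′ k → at L k ≤ at L i
  go (≤′-reflexive refl) = ≤-refl
  go (≤′-step {k} p)     = ≤-trans (at-suc k d) (go p)

∈-∖⁺ : ∀ nu la {k j} → j < at nu k → at la k ≤ j → (k , j) ∈ nu ∖ la
∈-∖⁺ nu la {k} j< ≤j = ∈-filter⁺ (_∉ᶜ? cells la) (∈-cells⁺ nu k j<) λ p → <⇒≱ (∈-cells⁻ la p) ≤j

∈-∖⁻ : ∀ nu la {k j} → (k , j) ∈ nu ∖ la → j < at nu k × at la k ≤ j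
∈-∖⁻ nu la {k} {j} p with ∈-filter⁻ (_∉ᶜ? cells la) {xs = cells nu} p
... | q , ∉la = ∈-cells⁻ nu q , ≮⇒≥ (∉la ∘ ∈-cells⁺ la k)

⊇ᵈ⇒at≤ : ∀ nu la → nu ⊇ᵈ la → ∀ k → at la k ≤ at nu k
⊇ᵈ⇒at≤ nu la nu⊇la k = ≮⇒≥ λ nu<la → <-irrefl refl (∈-cells⁻ nu (nu⊇la (∈-cells⁺ la k nu<la)))

at≤⇒⊇ᵈ : ∀ nu la → (∀ k → at la k ≤ at nu k) → nu ⊇ᵈ la
at≤⇒⊇ᵈ nu la le {k , j} p = ∈-cells⁺ nu k (<-≤-trans (∈-cells⁻ la p) (le k))

-- Otherwise column `at la k` would contain cells of the skew diagram in both rows k and k + 1.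
columns⇒at≤ : ∀ {nu la} → Decreasing nu → Decreasing la → Unique (map proj₂ (nu ∖ la)) →
              ∀ k → at nu (suc k) ≤ at la k
columns⇒at≤ {nu} {la} dn dl u k = ≮⇒≥ λ la<nu → 1+n≢n (cong proj₁
  (unique-map⁻ u (∈-∖⁺ nu la {suc k} la<nu (at-suc k dl))
                 (∈-∖⁺ nu la {k} (<-≤-trans la<nu (at-suc k dn)) ≤-refl) refl))

at≤⇒columns : ∀ {nu la} → Decreasing nu → (∀ k → at nu (suc k) ≤ at la k) → Unique (map proj₂ (nu ∖ la))
at≤⇒columns {nu} {la} dn le = unique-map⁺ (nu ∖ la) inj (Unique.filter⁺ (_∉ᶜ? cells la) (cellsFrom-unique 0 nu))
  where
  lower : ∀ {i k j} → (i , j) ∈ nu ∖ la → (k , j) ∈ nu ∖ la → ¬ i < k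
  lower {i} p q i<k = <-irrefl refl (<-≤-trans (proj₁ (∈-∖⁻ nu la q))
    (≤-trans (at-antitone {nu} dn i<k) (≤-trans (le i) (proj₂ (∈-∖⁻ nu la p)))))
  inj : ∀ {c d} → c ∈ nu ∖ la → d ∈ nu ∖ la → proj₂ c ≡ proj₂ d → c ≡ d
  inj {i , j} {k , _} p q refl with <-cmp i k
  ... | tri< i<k _ _  = ⊥-elim (lower p q i<k)
  ... | tri≈ _ refl _ = refl
  ... | tri> _ _ k<i  = ⊥-elim (lower q p k<i)

-- Partitions have positive parts, whereas `_≺_` fixes the number of parts; `pad` and `strip`
-- translate. Longer lists are cut by `pad`, whence the length hypotheses.
pad : ℕ → List ℕ → List ℕ
pad zero    _       = []
pad (suc n) []      = 0 ∷ pad n []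
pad (suc n) (l ∷ L) = l ∷ pad n L

strip : List ℕ → List ℕ
strip = filter (0 <?_)

sum-pad : ∀ n L → length L ≤ n → sum (pad n L) ≡ sum L
sum-pad zero    []      _        = refl
sum-pad (suc n) []      _        = sum-pad n [] z≤n
sum-pad (suc n) (l ∷ L) (s≤s le) = cong (l +_) (sum-pad n L le)

hd-pad : ∀ n L → length L ≤ n → hd (pad n L) ≡ hd L
hd-pad zero    []      _ = refl
hd-pad (suc n) []      _ = refl
hd-pad (suc n) (l ∷ L) _ = refl

at-pad : ∀ n L → length L ≤ n → ∀ k → at (pad n L) k ≡ at L k
at-pad zero    []      _        k       = refl
at-pad (suc n) []      _        zero    = refl
at-pad (suc n) []      _        (suc k) = at-pad n [] z≤n k
at-pad (suc n) (l ∷ L) _        zero    = refl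
at-pad (suc n) (l ∷ L) (s≤s le) (suc k) = at-pad n L le k

strip-pad : ∀ n L → All (0 <_) L → length L ≤ n → strip (pad n L) ≡ L
strip-pad zero    []          _        _        = refl
strip-pad (suc n) []          _        _        = strip-pad n [] [] z≤n
strip-pad (suc n) (suc l ∷ L) (_ ∷ ps) (s≤s le) = cong (suc l ∷_) (strip-pad n L ps le)

pad-strip : ∀ L → Decreasing L → pad (length L) (strip L) ≡ L
pad-strip []          _       = refl
pad-strip (suc l ∷ L) (_ , d) = cong (suc l ∷_) (pad-strip L d)
pad-strip (zero ∷ L)  (p , d) = trans (cong (pad (suc (length L))) (proj₁ (zeros L p d)))
                                      (cong (0 ∷_) (proj₂ (zeros L p d)))
  where
  zeros : ∀ L → hd L ≤ 0 → Decreasing L → strip L ≡ [] × pad (length L) [] ≡ L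
  zeros []         _ _       = refl , refl
  zeros (zero ∷ L) _ (p , d) = proj₁ (zeros L p d) , cong (0 ∷_) (proj₂ (zeros L p d))

length-≺ : ∀ {M L} → M ≺ L → length M ≡ length L
length-≺ []      = refl
length-≺ (_ ∷ i) = cong suc (length-≺ i)

pad-≺ : ∀ la b nu → at nu 0 ≤ b → (∀ k → at la k ≤ at nu k) → (∀ k → at nu (suc k) ≤ at la k) →
        pad (suc (length la)) nu ≺ b ∷ la
pad-≺ []       b []       q _ _  = (z≤n , q) ∷ []
pad-≺ []       b (x ∷ nu) q _ _  = (z≤n , q) ∷ []
pad-≺ (l ∷ la) b []       q u v  = (u 0 , q) ∷ pad-≺ la l [] z≤n (u ∘ suc) (λ _ → z≤n)
pad-≺ (l ∷ la) b (x ∷ nu) q u v  = (u 0 , q) ∷ pad-≺ la l nu (v 0) (u ∘ suc) (v ∘ suc)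

≺⇒at≥ : ∀ {M b la} → M ≺ b ∷ la → ∀ k → at la k ≤ at M k
≺⇒at≥ {la = []}     _                     k       = z≤n
≺⇒at≥ {la = _ ∷ _}  ((p , _) ∷ _)         zero    = p
≺⇒at≥ {la = _ ∷ la} (_ ∷ i)               (suc k) = ≺⇒at≥ i k

≺⇒at≤ : ∀ {M la} → M ≺ la → ∀ k → at M k ≤ at la k
≺⇒at≤ []            k       = z≤n
≺⇒at≤ ((_ , q) ∷ _) zero    = q
≺⇒at≤ (_ ∷ i)       (suc k) = ≺⇒at≤ i k

≺⇒at-suc≤ : ∀ {M b la} → M ≺ b ∷ la → ∀ k → at M (suc k) ≤ at la k
≺⇒at-suc≤ (_ ∷ i) k = ≺⇒at≤ i k

at-positive : ∀ {L} k → All (0 <_) L → at L k ≡ 0 → length L ≤ k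
at-positive {[]}    k       _        _  = z≤n
at-positive {_ ∷ _} zero    (p ∷ _)  eq = ⊥-elim (<-irrefl (sym eq) p)
at-positive {_ ∷ L} (suc k) (_ ∷ ps) eq = s≤s (at-positive k ps eq)

at-length : ∀ L → at L (length L) ≡ 0
at-length []      = refl
at-length (_ ∷ L) = at-length L

at-0≤sum : ∀ L → at L 0 ≤ sum L
at-0≤sum []      = z≤n
at-0≤sum (l ∷ L) = m≤m+n l (sum L)

Decreasing⇒Linked : ∀ L → Decreasing L → Linked _≥_ L
Decreasing⇒Linked []          _       = []
Decreasing⇒Linked (_ ∷ [])    _       = [-]
Decreasing⇒Linked (_ ∷ m ∷ L) (p , d) = p ∷ Decreasing⇒Linked (m ∷ L) d

below : List ℕ → List (List ℕ)
below []      = [] ∷ []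
below (l ∷ L) = cartesianProductWith _∷_ (filter (hd L ≤?_) (upTo (suc l))) (below L)

∈-below⁺ : ∀ {M L} → M ≺ L → M ∈ below L
∈-below⁺ []                    = here refl
∈-below⁺ {L = l ∷ L} ((p , q) ∷ i) =
  ∈-cartesianProductWith⁺ _∷_ (∈-filter⁺ (hd L ≤?_) (∈-upTo⁺ (s≤s q)) p) (∈-below⁺ i)

∈-below⁻ : ∀ L {M} → M ∈ below L → M ≺ L
∈-below⁻ []      (here refl) = []
∈-below⁻ (l ∷ L) p with ∈-cartesianProductWith⁻ _∷_ (filter (hd L ≤?_) (upTo (suc l))) (below L) p
... | x , M , x∈ , M∈ , refl with ∈-filter⁻ (hd L ≤?_) {xs = upTo (suc l)} x∈
...   | x≤l , hd≤x = (hd≤x , s≤s⁻¹ (∈-upTo⁻ x≤l)) ∷ ∈-below⁻ L M∈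

below-unique : ∀ L → Unique (below L)
below-unique []      = [] ∷ []
below-unique (l ∷ L) = Unique.cartesianProductWith⁺ _∷_ ∷-injective
  (Unique.filter⁺ (hd L ≤?_) (Unique.upTo⁺ (suc l))) (below-unique L)

Σᴸ-upTo : ∀ g n → Σᴸ g (upTo (suc n)) ≡ S g n
Σᴸ-upTo g zero    = +-identityʳ (g 0)
Σᴸ-upTo g (suc n) = trans (cong (Σᴸ g) (sym (upTo-∷ʳ (suc n)))) (trans
  (Σᴸ-++ g (upTo (suc n)) [ suc n ]) (cong₂ _+_ (Σᴸ-upTo g n) (+-identityʳ (g (suc n)))))

Σᴸ-cartesianProductWith : ∀ {A B C : Set} (g : C → ℕ) (φ : A → B → C) xs ys →
  Σᴸ g (cartesianProductWith φ xs ys) ≡ Σᴸ (λ x → Σᴸ (g ∘ φ x) ys) xs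
Σᴸ-cartesianProductWith g φ []       ys = refl
Σᴸ-cartesianProductWith g φ (x ∷ xs) ys = trans (Σᴸ-++ g (map (φ x) ys) _)
  (cong₂ _+_ (Σᴸ-map g (φ x) ys) (Σᴸ-cartesianProductWith g φ xs ys))

Σᴸ-below : ∀ g L → Σᴸ g (below L) ≡ down g L
Σᴸ-below g []      = +-identityʳ (g [])
Σᴸ-below g (l ∷ L) = begin
  Σᴸ g (below (l ∷ L))
    ≡⟨ Σᴸ-cartesianProductWith g _∷_ (filter (hd L ≤?_) (upTo (suc l))) (below L) ⟩
  Σᴸ (λ x → Σᴸ (g ∘ (x ∷_)) (below L)) (filter (hd L ≤?_) (upTo (suc l)))
    ≡⟨ Σᴸ-filter (hd L ≤?_) (λ x → Σᴸ (g ∘ (x ∷_)) (below L)) (upTo (suc l)) ⟩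
  Σᴸ (λ x → ⟦ hd L ≤? x ⟧ * Σᴸ (g ∘ (x ∷_)) (below L)) (upTo (suc l))
    ≡⟨ Σᴸ-upTo (λ x → ⟦ hd L ≤? x ⟧ * Σᴸ (g ∘ (x ∷_)) (below L)) l ⟩
  ∑ (hd L) l (λ x → Σᴸ (g ∘ (x ∷_)) (below L))
    ≡⟨ ∑-cong (hd L) l (λ x _ _ → Σᴸ-below (g ∘ (x ∷_)) L) ⟩
  down g (l ∷ L) ∎
  where open ≡-Reasoning

module _ {la} (la-partition : IsPartition la) (r : ℕ) where

  private
    m b : ℕ
    m = suc (length la)
    b = sum la + r

    la-decreasing : Decreasing la
    la-decreasing = Linked⇒Decreasing (IsPartition.decreasing la-partition)

    size? : Decidable (λ M → sum M ≡ sum la + r)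
    size? M = sum M ≟ sum la + r

  extension-at : ∀ {nu} → IsPartition nu → nu ⊇ᵈ la → IsHorizontalStrip r (nu ∖ la) →
                 ∀ k → at nu (suc k) ≤ at la k
  extension-at {nu} part _ strip′ = columns⇒at≤ {nu} {la} (Linked⇒Decreasing (IsPartition.decreasing part))
    la-decreasing (IsHorizontalStrip.distinctColumns strip′)

  extension-length : ∀ {nu} → nu ∈ horizontalExtensions r la → length nu ≤ m
  extension-length {nu} p with Equivalence.to (∈-horizontalExtensions {r} {la}) p
  ... | part , nu⊇la , strip′ = at-positive m (IsPartition.positive part)
    (n≤0⇒n≡0 (≤-trans (extension-at part (λ {c} → nu⊇la {c}) strip′ (length la)) (≤-reflexive (at-length la))))

  extension-sum : ∀ {nu} → nu ∈ horizontalExtensions r la → sum nu ≡ sum la + r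
  extension-sum {nu} p with Equivalence.to (∈-horizontalExtensions {r} {la}) p
  ... | _ , nu⊇la , strip′ = trans (∖-size {nu} {la} nu⊇la) (cong (sum la +_) (IsHorizontalStrip.size strip′))

  -- A horizontal strip adds at most one row, so length `m` suffices; the bound `b` excludes
  -- nothing, since no part exceeds the size.
  extensions-↭ : map (pad m) (horizontalExtensions r la) ↭ filter size? (below (b ∷ la))
  extensions-↭ = unique∧⊆⊇⇒↭
    (unique-map⁺ (horizontalExtensions r la) inj (horizontalExtensions-unique r la))
    (Unique.filter⁺ size? (below-unique (b ∷ la))) to from
    where
    strip-pad-extension : ∀ {nu} → nu ∈ horizontalExtensions r la → strip (pad m nu) ≡ nu
    strip-pad-extension {nu} p = strip-pad m nu
      (IsPartition.positive (proj₁ (Equivalence.to (∈-horizontalExtensions {r} {la}) p))) (extension-length p)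
    inj : ∀ {x y} → x ∈ horizontalExtensions r la → y ∈ horizontalExtensions r la → pad m x ≡ pad m y → x ≡ y
    inj p q eq = trans (sym (strip-pad-extension p)) (trans (cong strip eq) (strip-pad-extension q))
    to : map (pad m) (horizontalExtensions r la) ⊆ filter size? (below (b ∷ la))
    to p with ∈-map⁻ (pad m) p
    ... | nu , nu∈ , refl with Equivalence.to (∈-horizontalExtensions {r} {la}) nu∈
    ...   | part , nu⊇la , strip′ = ∈-filter⁺ size?
      (∈-below⁺ (pad-≺ la b nu (subst (at nu 0 ≤_) (extension-sum nu∈) (at-0≤sum nu))
        (⊇ᵈ⇒at≤ nu la nu⊇la) (extension-at part (λ {c} → nu⊇la {c}) strip′)))
      (trans (sum-pad m nu (extension-length nu∈)) (extension-sum nu∈))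
    from : filter size? (below (b ∷ la)) ⊆ map (pad m) (horizontalExtensions r la)
    from {M} p with ∈-filter⁻ size? {xs = below (b ∷ la)} p
    ... | M∈ , size = subst (_∈ map (pad m) (horizontalExtensions r la)) pad-nu
      (∈-map⁺ (pad m) (Equivalence.from (∈-horizontalExtensions {r} {la})
        ( isPartition (All.all-filter (0 <?_) M) nu-linked
        , (λ {c} → nu⊇la {c})
        , isHorizontalStrip (+-cancelˡ-≡ (sum la) _ _ (trans (sym (∖-size {nu} {la} nu⊇la)) sum-nu))
            (at≤⇒columns {nu} {la} (Linked⇒Decreasing nu-linked)
              λ k → subst (_≤ at la k) (at-nu (suc k)) (≺⇒at-suc≤ M≺ k)))))
      where
      M≺ : M ≺ b ∷ la
      M≺ = ∈-below⁻ (b ∷ la) M∈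
      nu : List ℕ
      nu = strip M
      pad-nu : pad m nu ≡ M
      pad-nu = subst (λ n → pad n nu ≡ M) (length-≺ M≺) (pad-strip M (≺⇒Decreasing M≺))
      nu-length : length nu ≤ m
      nu-length = ≤-trans (length-filter (0 <?_) M) (≤-reflexive (length-≺ M≺))
      at-nu : ∀ k → at M k ≡ at nu k
      at-nu k = trans (cong (λ L → at L k) (sym pad-nu)) (at-pad m nu nu-length k)
      nu-linked : Linked _≥_ nu
      nu-linked = Linked.filter⁺ (0 <?_) (λ p q → ≤-trans q p) (Decreasing⇒Linked M (≺⇒Decreasing M≺))
      nu⊇la : nu ⊇ᵈ la
      nu⊇la = at≤⇒⊇ᵈ nu la λ k → subst (at la k ≤_) (at-nu k) (≺⇒at≥ M≺ k)
      sum-nu : sum nu ≡ sum la + r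
      sum-nu = trans (sym (sum-pad m nu nu-length)) (trans (cong sum pad-nu) size)

down-pad : ∀ g m L → length L ≤ m → down g (pad m L) ≡ down (g ∘ pad m) L
down-pad g zero    []      _        = refl
down-pad g (suc m) []      _        = trans (cong (λ a → ∑ a 0 λ x → down (g ∘ (x ∷_)) (pad m [])) (hd-pad m [] z≤n))
  (trans (∑-single 0 λ x → down (g ∘ (x ∷_)) (pad m [])) (down-pad (g ∘ (0 ∷_)) m [] z≤n))
down-pad g (suc m) (l ∷ L) (s≤s le) = trans
  (cong (λ a → ∑ a l λ x → down (g ∘ (x ∷_)) (pad m L)) (hd-pad m L le))
  (∑-cong (hd L) l λ x _ _ → down-pad (g ∘ (x ∷_)) m L le)

ssyt-pad : ∀ K m L → length L ≤ m → ssyt K (pad m L) ≡ ssyt K L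
ssyt-pad zero    m L le = cong (λ n → ⟦ n ≟ 0 ⟧) (sum-pad m L le)
ssyt-pad (suc K) m L le = trans (down-pad (ssyt K) m L le)
  (down-cong≺ L λ M i → ssyt-pad K m M (subst (_≤ m) (sym (length-≺ i)) le))

ssyt-extensions : ∀ {la} → IsPartition la → ∀ r K → Σᴸ (ssyt K) (horizontalExtensions r la) ≡ multisets K r * ssyt K la
ssyt-extensions {la} part r K = begin
  Σᴸ (ssyt K) (horizontalExtensions r la)
    ≡⟨ Σᴸ-cong∈ (horizontalExtensions r la) (λ nu nu∈ → sym (ssyt-pad K m nu (extension-length part r nu∈))) ⟩
  Σᴸ (ssyt K ∘ pad m) (horizontalExtensions r la)
    ≡⟨ Σᴸ-map (ssyt K) (pad m) (horizontalExtensions r la) ⟨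
  Σᴸ (ssyt K) (map (pad m) (horizontalExtensions r la))
    ≡⟨ Σᴸ-↭ (ssyt K) (extensions-↭ part r) ⟩
  Σᴸ (ssyt K) (filter (λ M → sum M ≟ sum la + r) (below (sum la + r ∷ la)))
    ≡⟨ Σᴸ-filter (λ M → sum M ≟ sum la + r) (ssyt K) (below (sum la + r ∷ la)) ⟩
  Σᴸ (λ M → ⟦ sum M ≟ sum la + r ⟧ * ssyt K M) (below (sum la + r ∷ la))
    ≡⟨ Σᴸ-below (λ M → ⟦ sum M ≟ sum la + r ⟧ * ssyt K M) (sum la + r ∷ la) ⟩
  down (λ M → ⟦ sum M ≟ sum la + r ⟧ * ssyt K M) (sum la + r ∷ la)
    ≡⟨ pieri K la (sum la + r) r (+-monoˡ-≤ r (hd≤sum la)) ⟩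
  multisets K r * ssyt K la ∎
  where
  open ≡-Reasoning
  m : ℕ
  m = suc (length la)

-- Comparison of coefficients

des≤ : ∀ {L T} → IsSYT L T → des T ≤ sum L
des≤ {L} {T} s = begin
  des T                                    ≤⟨ length-filter (λ j → row j T <? row (suc j) T) [1‥ length (concat T) ∸ 1 ] ⟩
  length [1‥ length (concat T) ∸ 1 ]       ≡⟨ length-applyUpTo suc _ ⟩
  length (concat T) ∸ 1                    ≤⟨ m∸n≤m _ 1 ⟩
  length (concat T)                        ≡⟨ length-concat s ⟩
  sum L                                    ∎
  where open ≤-Reasoning

-- The case r = 0 is defined apart in 𝒢; the closed form covers it too, its only term being l = 0.
𝒢*-γ : ∀ r w d b → 𝒢* r w (suc d) b ≡ S (λ e → γ b d r e * w (suc e) (b + d + r ∸ e)) (b + d + r)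
𝒢*-γ r w d b = trans (explicit r) (γ-S b d r (λ e → w (suc e) (b + d + r ∸ e)))
  where
  exponent : ∀ r l → r + b ∸ l ≡ b + d + r ∸ (d + l)
  exponent r l = trans (sym ([m+n]∸[m+o]≡n∸o d (r + b) l)) (cong (_∸ (d + l)) (lemma d r b))
    where
    lemma : ∀ d r b → d + (r + b) ≡ b + d + r
    lemma = solve-∀
  reindex : ∀ r → S (λ l → (b C l) * (((d + r) C (d + l)) * w (suc (d + l)) (r + b ∸ l))) r ≡
                  S (λ l → (b C l) * (((d + r) C (d + l)) * w (suc (d + l)) (b + d + r ∸ (d + l)))) r
  reindex r = S-cong (λ l → cong (λ z → (b C l) * (((d + r) C (d + l)) * w (suc (d + l)) z)) (exponent r l)) r
  explicit : ∀ r → 𝒢* r w (suc d) b ≡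
                   S (λ l → (b C l) * (((d + r) C (d + l)) * w (suc (d + l)) (b + d + r ∸ (d + l)))) r
  explicit (suc r) = trans (taylor-translate r w d b) (reindex (suc r))
  explicit zero    = trans (trans (trans (cong (λ z → w (suc z) b) (sym (+-identityʳ d))) (lemma _))
    (cong (λ c → 1 * (c * w (suc (d + 0)) b)) (sym (nCn≡1 (d + 0))))) (reindex 0)
    where
    lemma : ∀ x → x ≡ 1 * (1 * x)
    lemma = solve-∀

ev-Y : ∀ w L → ev w (Y L) ≡ ι (Σᴸ (λ T → w (suc (des T)) (sum L ∸ des T)) (SYT L))
ev-Y w L = go (SYT L)
  where
  value : Filling → ℕ
  value T = w (suc (des T)) (sum L ∸ des T)
  go : ∀ Ts → ev w (Σₚ (map (λ T → mono 1ℚ (des T + 1) (sum L ∸ des T)) Ts)) ≡ ι (Σᴸ value Ts)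
  go []       = refl
  go (T ∷ Ts) = trans
    (cong₂ ℚ._+_ (trans (ℚ.*-identityˡ (ι (w (des T + 1) (sum L ∸ des T))))
                        (cong (λ a → ι (w a (sum L ∸ des T))) (+-comm (des T) 1))) (go Ts))
    (sym (ι-+ (value T) (Σᴸ value Ts)))

ev-Σₚ-Y : ∀ w Ls → ev w (Σₚ (map Y Ls)) ≡
          ι (Σᴸ (λ L → Σᴸ (λ T → w (suc (des T)) (sum L ∸ des T)) (SYT L)) Ls)
ev-Σₚ-Y w []       = refl
ev-Σₚ-Y w (L ∷ Ls) = trans (ev-++ w (Y L) (Σₚ (map Y Ls)))
  (trans (cong₂ ℚ._+_ (ev-Y w L) (ev-Σₚ-Y w Ls)) (sym (ι-+ (value L) (Σᴸ value Ls))))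
  where
  value : List ℕ → ℕ
  value L = Σᴸ (λ T → w (suc (des T)) (sum L ∸ des T)) (SYT L)

S-Σᴸ : ∀ {B : Set} (g : B → ℕ → ℕ) (u : ℕ → ℕ) xs n →
       Σᴸ (λ x → S (λ e → g x e * u e) n) xs ≡ S (λ e → Σᴸ (λ x → g x e) xs * u e) n
S-Σᴸ g u []       n = sym (S-0 n)
S-Σᴸ g u (x ∷ xs) n = trans (cong (S (λ e → g x e * u e) n +_) (S-Σᴸ g u xs n)) (trans
  (sym (S-+ _ _ n)) (S-cong (λ e → sym (*-distribʳ-+ (u e) (g x e) _)) n))

S-δ : ∀ (u : ℕ → ℕ) {d n} → d ≤ n → S (λ e → ⟦ d ≟ e ⟧ * u e) n ≡ u d
S-δ u {zero}  {zero}  _        = +-identityʳ (u 0)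
S-δ u {zero}  {suc n} _        = trans (S-front _ n) (trans (cong₂ _+_ (+-identityʳ (u 0)) (S-0 n)) (+-identityʳ (u 0)))
S-δ u {suc d} {suc n} (s≤s le) = trans (S-front _ n) (S-δ (u ∘ suc) le)

-- The theorem for coefficient sequences. In `S^-γ` the exponent b + d equals N for every tableau,
-- so the factor h_r leaves the sum over tableaux.
γ-descents : ∀ {la} → IsPartition la → ∀ r e →
  Σᴸ (λ T → γ (sum la ∸ des T) (des T) r e) (SYT la) ≡ Σᴸ (λ nu → descents nu e) (horizontalExtensions r la)
γ-descents {la} part r = S^-injective (suc (N + r)) λ k → begin
  S^ (suc (N + r)) (λ e → Σᴸ (λ T → γ (N ∸ des T) (des T) r e) (SYT la)) k
    ≡⟨ S^-Σᴸ (suc (N + r)) (λ T → γ (N ∸ des T) (des T) r) (SYT la) k ⟩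
  Σᴸ (λ T → S^ (suc (N + r)) (γ (N ∸ des T) (des T) r) k) (SYT la)
    ≡⟨ Σᴸ-cong∈ (SYT la) (λ T T∈ → by k T (m∸n+n≡m (des≤ (Equivalence.to (∈-SYT {la}) T∈)))) ⟩
  Σᴸ (λ T → multisets (suc k) r * S^ (suc N) (λ e → ⟦ des T ≟ e ⟧) k) (SYT la)
    ≡⟨ Σᴸ-* (multisets (suc k) r) _ (SYT la) ⟩
  multisets (suc k) r * Σᴸ (λ T → S^ (suc N) (λ e → ⟦ des T ≟ e ⟧) k) (SYT la)
    ≡⟨ cong (multisets (suc k) r *_) (S^-Σᴸ (suc N) (λ T e → ⟦ des T ≟ e ⟧) (SYT la) k) ⟨
  multisets (suc k) r * S^ (suc N) (descents la) k
    ≡⟨ cong (multisets (suc k) r *_) (S^-descents k la (Linked⇒Decreasing (IsPartition.decreasing part))) ⟩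
  multisets (suc k) r * ssyt (suc k) la
    ≡⟨ ssyt-extensions part r (suc k) ⟨
  Σᴸ (ssyt (suc k)) (horizontalExtensions r la)
    ≡⟨ Σᴸ-cong∈ (horizontalExtensions r la) (λ nu nu∈ → sym (trans
         (cong (λ m → S^ (suc m) (descents nu) k) (sym (extension-sum part r nu∈)))
         (S^-descents k nu (Linked⇒Decreasing (IsPartition.decreasing
           (proj₁ (Equivalence.to (∈-horizontalExtensions {r} {la}) nu∈))))))) ⟩
  Σᴸ (λ nu → S^ (suc (N + r)) (descents nu) k) (horizontalExtensions r la)
    ≡⟨ S^-Σᴸ (suc (N + r)) descents (horizontalExtensions r la) k ⟨
  S^ (suc (N + r)) (λ e → Σᴸ (λ nu → descents nu e) (horizontalExtensions r la)) k ∎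
  where
  open ≡-Reasoning
  N : ℕ
  N = sum la
  Σᴸ-* : ∀ {B : Set} c (g : B → ℕ) xs → Σᴸ (λ x → c * g x) xs ≡ c * Σᴸ g xs
  Σᴸ-* c g []       = sym (*-zeroʳ c)
  Σᴸ-* c g (x ∷ xs) = trans (cong (c * g x +_) (Σᴸ-* c g xs)) (sym (*-distribˡ-+ c (g x) _))
  by : ∀ k T → N ∸ des T + des T ≡ N → S^ (suc (N + r)) (γ (N ∸ des T) (des T) r) k ≡
       multisets (suc k) r * S^ (suc N) (λ e → ⟦ des T ≟ e ⟧) k
  by k T eq = trans (cong (λ n → S^ (suc (n + r)) (γ (N ∸ des T) (des T) r) k) (sym eq)) (trans
    (S^-γ (N ∸ des T) (des T) r k)
    (cong (λ n → multisets (suc k) r * S^ (suc n) (λ e → ⟦ des T ≟ e ⟧) k) eq))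

theorem17 : ∀ (N : ℕ) (la : List ℕ) → la ⊢ N → ∀ (r : ℕ) →
    𝒢 r (Y la) ≈ Σₚ (map Y (horizontalExtensions r la))
theorem17 N la (part , refl) r a b = begin
  coeff (𝒢 r (Y la)) a b
    ≡⟨ coeff-ev (𝒢 r (Y la)) a b ⟩
  ev w (𝒢 r (Y la))
    ≡⟨ ev-𝒢 r w (Y la) ⟩
  ev (𝒢* r w) (Y la)
    ≡⟨ ev-Y (𝒢* r w) la ⟩
  ι (Σᴸ (λ T → 𝒢* r w (suc (des T)) (N ∸ des T)) (SYT la))
    ≡⟨ cong ι (Σᴸ-cong∈ (SYT la) λ T T∈ → by T (m∸n+n≡m (des≤ (Equivalence.to (∈-SYT {la}) T∈)))) ⟩
  ι (Σᴸ (λ T → S (λ e → γ (N ∸ des T) (des T) r e * u e) (N + r)) (SYT la))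
    ≡⟨ cong ι (S-Σᴸ (λ T → γ (N ∸ des T) (des T) r) u (SYT la) (N + r)) ⟩
  ι (S (λ e → Σᴸ (λ T → γ (N ∸ des T) (des T) r e) (SYT la) * u e) (N + r))
    ≡⟨ cong ι (S-cong (λ e → cong (_* u e) (γ-descents part r e)) (N + r)) ⟩
  ι (S (λ e → Σᴸ (λ nu → descents nu e) (horizontalExtensions r la) * u e) (N + r))
    ≡⟨ cong ι (S-Σᴸ descents u (horizontalExtensions r la) (N + r)) ⟨
  ι (Σᴸ (λ nu → S (λ e → descents nu e * u e) (N + r)) (horizontalExtensions r la))
    ≡⟨ cong ι (Σᴸ-cong∈ (horizontalExtensions r la) λ nu nu∈ → collect nu (extension-sum part r nu∈)) ⟩
  ι (Σᴸ (λ nu → Σᴸ (λ T → w (suc (des T)) (sum nu ∸ des T)) (SYT nu)) (horizontalExtensions r la))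
    ≡⟨ ev-Σₚ-Y w (horizontalExtensions r la) ⟨
  ev w (Σₚ (map Y (horizontalExtensions r la)))
    ≡⟨ coeff-ev (Σₚ (map Y (horizontalExtensions r la))) a b ⟨
  coeff (Σₚ (map Y (horizontalExtensions r la))) a b ∎
  where
  open ≡-Reasoning
  w : Weight
  w = δ a b
  u : ℕ → ℕ
  -- All monomials on both sides have total degree N + r + 1, so a single index e describes them.
  u e = w (suc e) (N + r ∸ e)
  by : ∀ T → N ∸ des T + des T ≡ N → 𝒢* r w (suc (des T)) (N ∸ des T) ≡
       S (λ e → γ (N ∸ des T) (des T) r e * u e) (N + r)
  by T eq = trans (𝒢*-γ r w (des T) (N ∸ des T))
    (cong (λ n → S (λ e → γ (N ∸ des T) (des T) r e * w (suc e) (n + r ∸ e)) (n + r)) eq)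
  collect : ∀ nu → sum nu ≡ N + r → S (λ e → descents nu e * u e) (N + r) ≡
            Σᴸ (λ T → w (suc (des T)) (sum nu ∸ des T)) (SYT nu)
  collect nu eq = trans (sym (S-Σᴸ (λ T e → ⟦ des T ≟ e ⟧) u (SYT nu) (N + r)))
    (Σᴸ-cong∈ (SYT nu) λ T T∈ → trans
      (S-δ u (≤-trans (des≤ (Equivalence.to (∈-SYT {nu}) T∈)) (≤-reflexive eq)))
      (cong (λ n → w (suc (des T)) (n ∸ des T)) (sym eq)))
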